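{- Consider the commutative polynomial algebra $\mathcal{T} = \mathbb{C}\bigl[X_\pi \mid \pi \in \sqcup_{n=1}^\infty (NC(n)\setminus\{1_n\})\bigr]$, with the comultiplication $\Delta$, the counit $\epsilon$ and the grading $\mathcal{T}=\bigoplus_{m=0}^\infty \mathcal{T}_m$ defined in the context. When endowed with this structure, $\mathcal{T}$ becomes a graded connected Hopf algebra.
   Context: $NC(n)$ is the set of non-crossing partitions of $\{1,\ldots,n\}$, ordered by reverse refinement ($\pi\le\sigma$ iff every block of $\sigma$ is a union of blocks of $\pi$); $1_n\in NC(n)$ is the partition with one block; $|\pi|$ is the number of blocks of $\pi$. For $\pi \in NC(n)$ and a non-empty $W = \{p_1 < \cdots < p_m\} \subseteq \{1,\ldots,n\}$, $\pi_W \in NC(m)$ is the partition for which $i,j$ are in the same block of $\pi_W$ iff $p_i,p_j$ are in the same block of $\pi$. In $\mathcal{T}$ one uses the convention $X_{1_n}:=1_{\mathcal{T}}$ for all $n\ge1$. Comultiplication: $\Delta:\mathcal{T}\to\mathcal{T}\otimes\mathcal{T}$ is the unital algebra homomorphism determined by $\Delta(X_\pi)=\sum_{\sigma\in NC(n),\ \sigma\ge\pi}\bigl(\prod_{W\in\sigma}X_{\pi_W}\bigr)\otimes X_\sigma$ for all $n\ge1$, $\pi\in NC(n)$. Counit: $\epsilon:\mathcal{T}\to\mathbb{C}$ is the unital algebra homomorphism determined by $\epsilon(X_\pi)=0$ for all $\pi\in\sqcup_{n}(NC(n)\setminus\{1_n\})$. Grading: $\mathcal{T}_0=\mathbb{C}1_{\mathcal{T}}$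 and, for $m\ge1$, $\mathcal{T}_m$ is the linear span of all monomials $X_{\pi_1}\cdots X_{\pi_k}$ with $1\le k\le m$, $\pi_1,\ldots,\pi_k\in\sqcup_n(NC(n)\setminus\{1_n\})$ and $|\pi_1|+\cdots+|\pi_k|=m+k$; i.e. $X_\pi$ has degree $|\pi|-1$. A graded connected Hopf algebra is a graded bialgebra (multiplication, comultiplication and counit compatible with the grading) whose degree-$0$ component is $\mathbb{C}1$ and which has an antipode. -}

module Defs where

open import Level using (Level; 0ℓ; _⊔_) renaming (suc to lsuc)
open import Algebra.Bundles using (CommutativeRing; RawRing)
open import Algebra.Definitions.RawMonoid using (sum)
open import Algebra.Module.Bundles.Raw using (RawLeftModule)
open import Algebra.Module.Morphism.Structures using (IsLeftModuleHomomorphism)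
open import Algebra.Module.Structures using (IsLeftModule)
open import Algebra.Morphism.Structures using (IsRingHomomorphism)
open import Algebra.Structures using (IsRing)
import Data.Bool.Properties as Bool
open import Data.Fin.Base as Fin using (Fin; zero; suc; toℕ)
import Data.Fin.Properties as Fin
open import Data.Fin.Subset
  using (Subset; inside; outside; ∣_∣; ⋃; ⊤)
  renaming (_∈_ to _∈ₛ_; _⊆_ to _⊆ₛ_)
open import Data.Fin.Subset.Properties
  using (∉⊥; ∈⊤; _∈?_; _⊆?_; ⊆-antisym; x∈p∪q⁻; p⊆p∪q; q⊆p∪q)
open import Data.List.Base as List
  using (List; []; _∷_; [_]; _++_; map; foldr; filter; concatMap;
         cartesianProductWith; deduplicate; length)
open import Data.List.Membership.Propositional using (_∈_)
open import Data.List.Membership.Propositional.Properties using (∈-filter⁺; ∈-filter⁻)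
open import Data.List.Relation.Unary.All as All using (All; all?)
open import Data.List.Relation.Unary.Any using (here; there)
open import Data.Nat.Base as ℕ using (ℕ; zero; suc)
open import Data.Nat.ListAction using () renaming (sum to ℕ-sum)
import Data.Nat.Properties as ℕ
open import Data.Product.Base as Product using (Σ; ∃; _×_; _,_; proj₁; proj₂)
open import Data.Rational.Base as ℚ using (ℚ; 0ℚ; 1ℚ; ½; Positive)
import Data.Rational.Properties as ℚ
open import Data.Rational.Solver
open import Data.Sum.Base using (inj₁; inj₂)
open import Data.Vec.Base as Vec using (Vec; []; _∷_; lookup; tabulate; replicate; toList)
import Data.Vec.Properties as Vec
open import Function.Base using (id; _∘_)
open import Function.Bundles using (_⇔_)
open import Relation.Binary.Core using (Rel)
open import Relation.Binary.PropositionalEquality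
  using (_≡_; _≢_; refl; sym; trans; cong; subst; subst₂)
open import Relation.Binary.Structures using (IsEquivalence)
open import Relation.Nullary using (Dec; yes; no; _×-dec_; _→-dec_)
open import Relation.Nullary.Decidable using (map′)
open import Relation.Unary using (Pred)

private variable
  c ℓ a ℓa b ℓb d ℓd v : Level
  n : ℕ

module Real where

  -- a m n → 0 as m, n → ∞
  Vanish : (ℕ → ℕ → ℚ) → Set
  Vanish a = ∀ ε → .{{_ : Positive ε}} →
    ∃ λ N → ∀ m n → N ℕ.≤ m → N ℕ.≤ n → ℚ.∣ a m n ∣ ℚ.< ε

  -- For Cauchy sequences, x m - y n → 0 as m, n → ∞ says the same as
  -- x n - y n → 0; taking y = x it says that x is Cauchy.
  infix 4 _~_
  _~_ : Rel (ℕ → ℚ) 0ℓ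
  x ~ y = Vanish (λ m n → x m ℚ.- y n)

  IsCauchy : (ℕ → ℚ) → Set
  IsCauchy x = x ~ x

  record ℝ : Set where
    constructor real
    field
      seq    : ℕ → ℚ
      cauchy : IsCauchy seq
  open ℝ public

  infix 4 _≃_
  _≃_ : Rel ℝ 0ℓ
  x ≃ y = seq x ~ seq y

  private
    half : ∀ ε → .{{Positive ε}} → Positive (½ ℚ.* ε)
    half ε = ℚ.pos*pos⇒pos ½ ε

    half+half : ∀ ε → ½ ℚ.* ε ℚ.+ ½ ℚ.* ε ≡ ε
    half+half ε = trans (sym (ℚ.*-distribʳ-+ ε ½ ½)) (ℚ.*-identityˡ ε)

    vanish-cong : ∀ {a b} → (∀ m n → a m n ≡ b m n) → Vanish a → Vanish b
    vanish-cong eq va ε with va ε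
    ... | N , h = N , λ m n p q → subst (λ t → ℚ.∣ t ∣ ℚ.< ε) (eq m n) (h m n p q)

    vanish-+ : ∀ {a b} → Vanish a → Vanish b → Vanish (λ m n → a m n ℚ.+ b m n)
    vanish-+ {a} {b} va vb ε
      with va (½ ℚ.* ε) {{half ε}} | vb (½ ℚ.* ε) {{half ε}}
    ... | N , h | M , k = N ℕ.⊔ M , λ m n p q →
      ℚ.≤-<-trans (ℚ.∣p+q∣≤∣p∣+∣q∣ (a m n) (b m n))
        (subst (ℚ.∣ a m n ∣ ℚ.+ ℚ.∣ b m n ∣ ℚ.<_) (half+half ε)
          (ℚ.+-mono-<
            (h m n (ℕ.≤-trans (ℕ.m≤m⊔n N M) p) (ℕ.≤-trans (ℕ.m≤m⊔n N M) q))
            (k m n (ℕ.≤-trans (ℕ.m≤n⊔m N M) p) (ℕ.≤-trans (ℕ.m≤n⊔m N M) q))))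

    vanish-neg : ∀ {a} → Vanish a → Vanish (λ m n → ℚ.- a m n)
    vanish-neg {a} va ε with va ε
    ... | N , h = N , λ m n p q →
      subst (ℚ._< ε) (sym (ℚ.∣-p∣≡∣p∣ (a m n))) (h m n p q)

    Bounded : (ℕ → ℕ → ℚ) → Set
    Bounded b = ∃ λ B → Positive B × ∃ λ N →
      ∀ m n → N ℕ.≤ m → N ℕ.≤ n → ℚ.∣ b m n ∣ ℚ.≤ B

    vanish-* : ∀ {a b} → Bounded b → Vanish a → Vanish (λ m n → b m n ℚ.* a m n)
    vanish-* {a} {b} (B , B>0 , M , k) va ε with va δ {{δ>0}}
      where
      instance _ = B>0
               _ = ℚ.pos⇒nonZero B
      δ = (ℚ.1/ B) ℚ.* ε
      δ>0 : Positive δ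
      δ>0 = ℚ.pos*pos⇒pos (ℚ.1/ B) {{ℚ.1/pos⇒pos B}} ε
    ... | N , h = N ℕ.⊔ M , λ m n p q →
      subst₂ ℚ._<_ (sym (ℚ.∣p*q∣≡∣p∣*∣q∣ (b m n) (a m n))) Bδ≡ε
        (ℚ.≤-<-trans
          (ℚ.*-monoʳ-≤-nonNeg ℚ.∣ a m n ∣ {{ℚ.∣-∣-nonNeg (a m n)}}
            (k m n (ℕ.≤-trans (ℕ.m≤n⊔m N M) p) (ℕ.≤-trans (ℕ.m≤n⊔m N M) q)))
          (ℚ.*-monoʳ-<-pos B
            (h m n (ℕ.≤-trans (ℕ.m≤m⊔n N M) p) (ℕ.≤-trans (ℕ.m≤m⊔n N M) q))))
      where
      instance _ = B>0
               _ = ℚ.pos⇒nonZero B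
      Bδ≡ε : B ℚ.* ((ℚ.1/ B) ℚ.* ε) ≡ ε
      Bδ≡ε = trans (sym (ℚ.*-assoc B (ℚ.1/ B) ε))
            (trans (cong (ℚ._* ε) (ℚ.*-inverseʳ B)) (ℚ.*-identityˡ ε))

    EventuallyBounded : (ℕ → ℚ) → Set
    EventuallyBounded x =
      ∃ λ B → Positive B × ∃ λ N → ∀ n → N ℕ.≤ n → ℚ.∣ x n ∣ ℚ.≤ B

    bound : ∀ {x} → IsCauchy x → EventuallyBounded x
    bound {x} cx with cx 1ℚ
    ... | N , h = ℚ.∣ x N ∣ ℚ.+ 1ℚ
      , ℚ.nonNeg+pos⇒pos ℚ.∣ x N ∣ {{ℚ.∣-∣-nonNeg (x N)}} 1ℚ
      , N , λ n p →
        ℚ.≤-trans (subst (λ t → ℚ.∣ t ∣ ℚ.≤ ℚ.∣ x N ∣ ℚ.+ ℚ.∣ x n ℚ.- x N ∣)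
                     (lemma (x N) (x n))
                     (ℚ.∣p+q∣≤∣p∣+∣q∣ (x N) (x n ℚ.- x N)))
                  (ℚ.+-monoʳ-≤ ℚ.∣ x N ∣ (ℚ.<⇒≤ (h n N p ℕ.≤-refl)))
      where
      open +-*-Solver
      lemma : ∀ p q → p ℚ.+ (q ℚ.- p) ≡ q
      lemma = solve 2 (λ p q → p :+ (q :- p) := q) refl

    -- Instances of the following three at x = x′ and y = y′ give closure
    -- of the Cauchy sequences under the operations.
    ~-+ : ∀ {x x′ y y′} → x ~ x′ → y ~ y′ →
          (λ n → x n ℚ.+ y n) ~ (λ n → x′ n ℚ.+ y′ n)
    ~-+ {x} {x′} {y} {y′} p q =
      vanish-cong (λ m n → lemma (x m) (x′ n) (y m) (y′ n))
        (vanish-+ {a = λ m n → x m ℚ.- x′ n} {b = λ m n → y m ℚ.- y′ n} p q)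
      where
      open +-*-Solver
      lemma : ∀ p p′ q q′ → (p ℚ.- p′) ℚ.+ (q ℚ.- q′) ≡ (p ℚ.+ q) ℚ.- (p′ ℚ.+ q′)
      lemma = solve 4 (λ p p′ q q′ →
        (p :- p′) :+ (q :- q′) := (p :+ q) :- (p′ :+ q′)) refl

    ~-neg : ∀ {x x′} → x ~ x′ → (λ n → ℚ.- x n) ~ (λ n → ℚ.- x′ n)
    ~-neg {x} {x′} p = vanish-cong (λ m n → lemma (x m) (x′ n)) (vanish-neg p)
      where
      open +-*-Solver
      lemma : ∀ p p′ → ℚ.- (p ℚ.- p′) ≡ (ℚ.- p) ℚ.- (ℚ.- p′)
      lemma = solve 2 (λ p p′ → :- (p :- p′) := (:- p) :- (:- p′)) refl

    ~-* : ∀ {x x′ y y′} → IsCauchy x → IsCauchy y′ → x ~ x′ → y ~ y′ →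
          (λ n → x n ℚ.* y n) ~ (λ n → x′ n ℚ.* y′ n)
    ~-* {x} {x′} {y} {y′} cx cy′ p q =
      vanish-cong (λ m n → lemma (x m) (x′ n) (y m) (y′ n))
        (vanish-+ {a = λ m n → x m ℚ.* (y m ℚ.- y′ n)}
                  {b = λ m n → y′ n ℚ.* (x m ℚ.- x′ n)}
          (vanish-* {a = λ m n → y m ℚ.- y′ n} {b = λ m n → x m}
            (boundˡ (bound {x} cx)) q)
          (vanish-* {a = λ m n → x m ℚ.- x′ n} {b = λ m n → y′ n}
            (boundʳ (bound {y′} cy′)) p))
      where
      boundˡ : ∀ {z} → EventuallyBounded z → Bounded (λ m n → z m)
      boundˡ (B , B>0 , N , h) = B , B>0 , N , λ m n r _ → h m r
      boundʳ : ∀ {z} → EventuallyBounded z → Bounded (λ m n → z n)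
      boundʳ (B , B>0 , N , h) = B , B>0 , N , λ m n _ r → h n r
      open +-*-Solver
      lemma : ∀ p p′ q q′ →
              p ℚ.* (q ℚ.- q′) ℚ.+ q′ ℚ.* (p ℚ.- p′) ≡ (p ℚ.* q) ℚ.- (p′ ℚ.* q′)
      lemma = solve 4 (λ p p′ q q′ →
        p :* (q :- q′) :+ q′ :* (p :- p′) := (p :* q) :- (p′ :* q′)) refl

    const-cauchy : ∀ p → IsCauchy (λ _ → p)
    const-cauchy p ε = 0 , λ _ _ _ _ →
      subst (λ t → ℚ.∣ t ∣ ℚ.< ε) (sym (ℚ.+-inverseʳ p)) (ℚ.positive⁻¹ ε)

  0ᵣ 1ᵣ : ℝ
  0ᵣ = real (λ _ → 0ℚ) (const-cauchy 0ℚ)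
  1ᵣ = real (λ _ → 1ℚ) (const-cauchy 1ℚ)

  infixl 6 _+ᵣ_
  infixl 7 _*ᵣ_
  _+ᵣ_ _*ᵣ_ : ℝ → ℝ → ℝ
  x +ᵣ y = real (λ n → seq x n ℚ.+ seq y n)
    (~-+ {seq x} {seq x} {seq y} {seq y} (cauchy x) (cauchy y))
  x *ᵣ y = real (λ n → seq x n ℚ.* seq y n)
    (~-* {seq x} {seq x} {seq y} {seq y} (cauchy x) (cauchy y) (cauchy x) (cauchy y))

  -ᵣ_ : ℝ → ℝ
  -ᵣ x = real (λ n → ℚ.- seq x n) (~-neg {seq x} {seq x} (cauchy x))

  private
    pointwise : ∀ x y → (∀ n → seq x n ≡ seq y n) → x ≃ y
    pointwise x y eq =
      vanish-cong (λ m n → cong (λ t → seq x m ℚ.- t) (eq n)) (cauchy x)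

    ≃-sym : ∀ {x y} → x ≃ y → y ≃ x
    ≃-sym {x} {y} p ε with vanish-neg p ε
    ... | N , h = N , λ m n r s →
      subst (λ t → ℚ.∣ t ∣ ℚ.< ε) (lemma (seq x n) (seq y m)) (h n m s r)
      where
      open +-*-Solver
      lemma : ∀ p q → ℚ.- (p ℚ.- q) ≡ q ℚ.- p
      lemma = solve 2 (λ p q → :- (p :- q) := q :- p) refl

    ≃-trans : ∀ {x y z} → x ≃ y → y ≃ z → x ≃ z
    ≃-trans {x} {y} {z} p q =
      vanish-cong (λ m n → lemma (seq x m) (seq y n) (seq y m) (seq z n))
        (vanish-+ (vanish-+ p q) (vanish-neg (≃-refl′ y)))
      where
      open +-*-Solver
      ≃-refl′ : ∀ w → Vanish (λ m n → seq w m ℚ.- seq w n)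
      ≃-refl′ = cauchy
      lemma : ∀ p q q′ r → ((p ℚ.- q) ℚ.+ (q′ ℚ.- r)) ℚ.+ (ℚ.- (q′ ℚ.- q)) ≡ p ℚ.- r
      lemma = solve 4 (λ p q q′ r →
        ((p :- q) :+ (q′ :- r)) :+ (:- (q′ :- q)) := p :- r) refl

  ℝ-commutativeRing : CommutativeRing 0ℓ 0ℓ
  ℝ-commutativeRing = record
    { Carrier = ℝ ; _≈_ = _≃_ ; _+_ = _+ᵣ_ ; _*_ = _*ᵣ_ ; -_ = -ᵣ_ ; 0# = 0ᵣ ; 1# = 1ᵣ
    ; isCommutativeRing = record
      { isRing = record
        { +-isAbelianGroup = record
          { isGroup = record
            { isMonoid = record
              { isSemigroup = record
                { isMagma = record
                  { isEquivalence = record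
                    { refl  = λ {x} → cauchy x
                    ; sym   = λ {x} {y} → ≃-sym {x} {y}
                    ; trans = λ {x} {y} {z} → ≃-trans {x} {y} {z} }
                  ; ∙-cong = λ {x} {x′} {y} {y′} →
                      ~-+ {seq x} {seq x′} {seq y} {seq y′} }
                ; assoc = λ x y z → pointwise ((x +ᵣ y) +ᵣ z) (x +ᵣ (y +ᵣ z))
                    λ n → ℚ.+-assoc (seq x n) (seq y n) (seq z n) }
              ; identity =
                  (λ x → pointwise (0ᵣ +ᵣ x) x λ n → ℚ.+-identityˡ (seq x n))
                , (λ x → pointwise (x +ᵣ 0ᵣ) x λ n → ℚ.+-identityʳ (seq x n)) }
            ; inverse =
                (λ x → pointwise ((-ᵣ x) +ᵣ x) 0ᵣ λ n → ℚ.+-inverseˡ (seq x n))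
              , (λ x → pointwise (x +ᵣ (-ᵣ x)) 0ᵣ λ n → ℚ.+-inverseʳ (seq x n))
            ; ⁻¹-cong = λ {x} {x′} → ~-neg {seq x} {seq x′} }
          ; comm = λ x y → pointwise (x +ᵣ y) (y +ᵣ x)
              λ n → ℚ.+-comm (seq x n) (seq y n) }
        ; *-cong = λ {x} {x′} {y} {y′} →
            ~-* {seq x} {seq x′} {seq y} {seq y′} (cauchy x) (cauchy y′)
        ; *-assoc = λ x y z → pointwise ((x *ᵣ y) *ᵣ z) (x *ᵣ (y *ᵣ z))
            λ n → ℚ.*-assoc (seq x n) (seq y n) (seq z n)
        ; *-identity =
            (λ x → pointwise (1ᵣ *ᵣ x) x λ n → ℚ.*-identityˡ (seq x n))
          , (λ x → pointwise (x *ᵣ 1ᵣ) x λ n → ℚ.*-identityʳ (seq x n))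
        ; distrib =
            (λ x y z → pointwise (x *ᵣ (y +ᵣ z)) ((x *ᵣ y) +ᵣ (x *ᵣ z))
              λ n → ℚ.*-distribˡ-+ (seq x n) (seq y n) (seq z n))
          , (λ x y z → pointwise ((y +ᵣ z) *ᵣ x) ((y *ᵣ x) +ᵣ (z *ᵣ x))
              λ n → ℚ.*-distribʳ-+ (seq x n) (seq y n) (seq z n)) }
      ; *-comm = λ x y → pointwise (x *ᵣ y) (y *ᵣ x)
          λ n → ℚ.*-comm (seq x n) (seq y n) } }

-- R[i], with the pair (x , y) standing for x + i y.
module Complexify (R : CommutativeRing c ℓ) where
  open CommutativeRing R renaming (refl to ≈-refl; sym to ≈-sym; trans to ≈-trans)
  open import Algebra.Properties.Ring ring using (-‿distribˡ-*; -‿distribʳ-*; -‿+-comm)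
  open import Algebra.Properties.CommutativeSemigroup +-commutativeSemigroup
    using (interchange)
  open import Algebra.Properties.AbelianGroup +-abelianGroup using ()
    renaming (ε⁻¹≈ε to -0≈0)
  open import Relation.Binary.Reasoning.Setoid setoid

  private
    C = Carrier × Carrier

    _≈′_ : Rel C ℓ
    (x , y) ≈′ (x′ , y′) = (x ≈ x′) × (y ≈ y′)

    _+′_ _*′_ : C → C → C
    (x , y) +′ (x′ , y′) = x + x′ , y + y′
    (x , y) *′ (x′ , y′) = x * x′ - y * y′ , x * y′ + y * x′

    -′_ : C → C
    -′ (x , y) = - x , - y

    sub-interchange : ∀ p q r s → (p + q) - (r + s) ≈ (p - r) + (q - s)
    sub-interchange p q r s =
      ≈-trans (+-congˡ (≈-sym (-‿+-comm r s))) (interchange p q (- r) (- s))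

    sub-cong : ∀ {p q r s} → p ≈ q → r ≈ s → p - r ≈ q - s
    sub-cong e f = +-cong e (-‿cong f)

    distribˡ-sub : ∀ p q r → p * (q - r) ≈ p * q - p * r
    distribˡ-sub p q r = begin
      p * (q - r)         ≈⟨ distribˡ p q (- r) ⟩
      p * q + p * (- r)   ≈⟨ +-congˡ (-‿distribʳ-* p r) ⟨
      p * q - p * r       ∎

    distribʳ-sub : ∀ p q r → (q - r) * p ≈ q * p - r * p
    distribʳ-sub p q r = begin
      (q - r) * p         ≈⟨ distribʳ p q (- r) ⟩
      q * p + (- r) * p   ≈⟨ +-congˡ (-‿distribˡ-* r p) ⟨
      q * p - r * p       ∎

    *′-comm : ∀ z w → (z *′ w) ≈′ (w *′ z)
    *′-comm (x , y) (u , v) =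
      sub-cong (*-comm x u) (*-comm y v) , (begin
        x * v + y * u   ≈⟨ +-comm _ _ ⟩
        y * u + x * v   ≈⟨ +-cong (*-comm y u) (*-comm x v) ⟩
        u * y + v * x   ∎)

    *′-distribˡ : ∀ z w w′ → (z *′ (w +′ w′)) ≈′ ((z *′ w) +′ (z *′ w′))
    *′-distribˡ (x , y) (u , v) (u′ , v′) =
        (begin
          x * (u + u′) - y * (v + v′)
            ≈⟨ sub-cong (distribˡ x u u′) (distribˡ y v v′) ⟩
          (x * u + x * u′) - (y * v + y * v′)
            ≈⟨ sub-interchange _ _ _ _ ⟩
          (x * u - y * v) + (x * u′ - y * v′) ∎)
      , (begin
          x * (v + v′) + y * (u + u′)
            ≈⟨ +-cong (distribˡ x v v′) (distribˡ y u u′) ⟩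
          (x * v + x * v′) + (y * u + y * u′)
            ≈⟨ interchange _ _ _ _ ⟩
          (x * v + y * u) + (x * v′ + y * u′) ∎)

    *′-assoc : ∀ z w t → ((z *′ w) *′ t) ≈′ (z *′ (w *′ t))
    *′-assoc (x , y) (u , v) (p , q) =
        (begin
          (x * u - y * v) * p - (x * v + y * u) * q
            ≈⟨ sub-cong (distribʳ-sub p (x * u) (y * v)) (distribʳ q (x * v) (y * u)) ⟩
          (x * u * p - y * v * p) - (x * v * q + y * u * q)
            ≈⟨ sub-cong (sub-cong (*-assoc x u p) (*-assoc y v p))
                 (+-cong (*-assoc x v q) (*-assoc y u q)) ⟩
          (x * (u * p) - y * (v * p)) - (x * (v * q) + y * (u * q))
            ≈⟨ +-congˡ (-‿+-comm _ _) ⟨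
          (x * (u * p) - y * (v * p)) + (- (x * (v * q)) - y * (u * q))
            ≈⟨ interchange _ _ _ _ ⟩
          (x * (u * p) - x * (v * q)) + (- (y * (v * p)) - y * (u * q))
            ≈⟨ +-congˡ (-‿+-comm _ _) ⟩
          (x * (u * p) - x * (v * q)) - (y * (v * p) + y * (u * q))
            ≈⟨ sub-cong (distribˡ-sub x (u * p) (v * q))
                 (≈-trans (distribˡ y (u * q) (v * p)) (+-comm _ _)) ⟨
          x * (u * p - v * q) - y * (u * q + v * p) ∎)
      , (begin
          (x * u - y * v) * q + (x * v + y * u) * p
            ≈⟨ +-cong (distribʳ-sub q (x * u) (y * v)) (distribʳ p (x * v) (y * u)) ⟩
          (x * u * q - y * v * q) + (x * v * p + y * u * p)
            ≈⟨ +-cong (sub-cong (*-assoc x u q) (*-assoc y v q))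
                 (+-cong (*-assoc x v p) (*-assoc y u p)) ⟩
          (x * (u * q) - y * (v * q)) + (x * (v * p) + y * (u * p))
            ≈⟨ interchange _ _ _ _ ⟩
          (x * (u * q) + x * (v * p)) + (- (y * (v * q)) + y * (u * p))
            ≈⟨ +-cong (distribˡ x (u * q) (v * p))
                 (≈-trans (distribˡ-sub y (u * p) (v * q)) (+-comm _ _)) ⟨
          x * (u * q + v * p) + y * (u * p - v * q) ∎)

    *′-identityˡ : ∀ z → ((1# , 0#) *′ z) ≈′ z
    *′-identityˡ (x , y) =
        (begin
          1# * x - 0# * y   ≈⟨ sub-cong (*-identityˡ x) (zeroˡ y) ⟩
          x - 0#            ≈⟨ +-congˡ -0≈0 ⟩
          x + 0#            ≈⟨ +-identityʳ x ⟩
          x                 ∎)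
      , (begin
          1# * y + 0# * x   ≈⟨ +-cong (*-identityˡ y) (zeroˡ x) ⟩
          y + 0#            ≈⟨ +-identityʳ y ⟩
          y                 ∎)

    ≈′-trans : ∀ {z w t} → z ≈′ w → w ≈′ t → z ≈′ t
    ≈′-trans (p , q) (p′ , q′) = ≈-trans p p′ , ≈-trans q q′

    +′-cong : ∀ {z z′ w w′} → z ≈′ z′ → w ≈′ w′ → (z +′ w) ≈′ (z′ +′ w′)
    +′-cong (p , q) (p′ , q′) = +-cong p p′ , +-cong q q′

  complexification : CommutativeRing c ℓ
  complexification = record
    { Carrier = C ; _≈_ = _≈′_ ; _+_ = _+′_ ; _*_ = _*′_ ; -_ = -′_
    ; 0# = 0# , 0# ; 1# = 1# , 0#
    ; isCommutativeRing = record
      { isRing = record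
        { +-isAbelianGroup = record
          { isGroup = record
            { isMonoid = record
              { isSemigroup = record
                { isMagma = record
                  { isEquivalence = record
                    { refl  = ≈-refl , ≈-refl
                    ; sym   = λ (p , q) → ≈-sym p , ≈-sym q
                    ; trans = ≈′-trans }
                  ; ∙-cong = +′-cong }
                ; assoc = λ (x , y) (u , v) (p , q) → +-assoc x u p , +-assoc y v q }
              ; identity = (λ (x , y) → +-identityˡ x , +-identityˡ y)
                         , (λ (x , y) → +-identityʳ x , +-identityʳ y) }
            ; inverse = (λ (x , y) → -‿inverseˡ x , -‿inverseˡ y)
                      , (λ (x , y) → -‿inverseʳ x , -‿inverseʳ y)
            ; ⁻¹-cong = λ (p , q) → -‿cong p , -‿cong q }
          ; comm = λ (x , y) (u , v) → +-comm x u , +-comm y v }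
        ; *-cong = λ (p , q) (p′ , q′) →
              sub-cong (*-cong p p′) (*-cong q q′)
            , +-cong (*-cong p q′) (*-cong q p′)
        ; *-assoc = *′-assoc
        ; *-identity = *′-identityˡ
                     , (λ z → ≈′-trans (*′-comm z (1# , 0#)) (*′-identityˡ z))
        ; distrib = *′-distribˡ
                  , (λ z w w′ → ≈′-trans (*′-comm (w +′ w′) z)
                      (≈′-trans (*′-distribˡ z w w′)
                        (+′-cong (*′-comm z w) (*′-comm z w′)))) }
      ; *-comm = *′-comm } }

ℂ : CommutativeRing 0ℓ 0ℓ
ℂ = Complexify.complexification Real.ℝ-commutativeRing

record RawAlgebra (S : Set c) a ℓa : Set (c ⊔ lsuc (a ⊔ ℓa)) where
  infix  4 _≈_
  infixl 6 _+_
  infixl 7 _*_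
  infixr 7 _·_
  field
    Carrier : Set a
    _≈_     : Rel Carrier ℓa
    _+_     : Carrier → Carrier → Carrier
    _*_     : Carrier → Carrier → Carrier
    _·_     : S → Carrier → Carrier
    -_      : Carrier → Carrier
    0#      : Carrier
    1#      : Carrier

  rawRing : RawRing a ℓa
  rawRing = record
    { _≈_ = _≈_ ; _+_ = _+_ ; _*_ = _*_ ; -_ = -_ ; 0# = 0# ; 1# = 1# }

  rawLeftModule : RawLeftModule S a ℓa
  rawLeftModule = record
    { _≈ᴹ_ = _≈_ ; _+ᴹ_ = _+_ ; _*ₗ_ = _·_ ; 0ᴹ = 0# ; -ᴹ_ = -_ }

  product : List Carrier → Carrier
  product = foldr _*_ 1#

scalars : (K : CommutativeRing c ℓ) → RawAlgebra (CommutativeRing.Carrier K) c ℓ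
scalars K = record { RawRing rawRing ; _·_ = RawRing._*_ rawRing }
  where open CommutativeRing K using (rawRing)

record IsAlgebra (K : CommutativeRing c ℓ)
                 (A : RawAlgebra (CommutativeRing.Carrier K) a ℓa) :
                 Set (c ⊔ ℓ ⊔ a ⊔ ℓa) where
  open RawAlgebra A
  field
    isRing       : IsRing _≈_ _+_ _*_ -_ 0# 1#
    isLeftModule : IsLeftModule (CommutativeRing.ring K) _≈_ _+_ 0# -_ _·_
    ·-*-assocˡ   : ∀ k x y → k · (x * y) ≈ (k · x) * y
    ·-*-assocʳ   : ∀ k x y → k · (x * y) ≈ x * (k · y)

record IsAlgebraHomomorphism {S : Set c} (A : RawAlgebra S a ℓa) (B : RawAlgebra S b ℓb)
         (f : RawAlgebra.Carrier A → RawAlgebra.Carrier B) :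
         Set (c ⊔ a ⊔ ℓa ⊔ ℓb) where
  field
    isRingHomomorphism : IsRingHomomorphism (RawAlgebra.rawRing A) (RawAlgebra.rawRing B) f
    isLinear           : IsLeftModuleHomomorphism
                           (RawAlgebra.rawLeftModule A) (RawAlgebra.rawLeftModule B) f

module _ {S : Set c} (M : RawLeftModule S a ℓa) (N : RawLeftModule S b ℓb) where
  private
    module M = RawLeftModule M
    module N = RawLeftModule N

  -- The list (x₁ , y₁) ∷ … ∷ (xᵣ , yᵣ) ∷ [] stands for x₁ ⊗ y₁ + … + xᵣ ⊗ yᵣ.
  FormalSum : Set (a ⊔ b)
  FormalSum = List (M.Carrierᴹ × N.Carrierᴹ)

  infix 4 _≋_
  data _≋_ : Rel FormalSum (c ⊔ a ⊔ ℓa ⊔ b ⊔ ℓb) where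
    ≋-refl   : ∀ {s} → s ≋ s
    ≋-sym    : ∀ {s t} → s ≋ t → t ≋ s
    ≋-trans  : ∀ {s t u} → s ≋ t → t ≋ u → s ≋ u
    ++-cong  : ∀ {s s′ t t′} → s ≋ s′ → t ≋ t′ → s ++ t ≋ s′ ++ t′
    ++-comm  : ∀ s t → s ++ t ≋ t ++ s
    ⊗-cong   : ∀ {x x′ y y′} → x M.≈ᴹ x′ → y N.≈ᴹ y′ → [ x , y ] ≋ [ x′ , y′ ]
    ⊗-+ˡ     : ∀ x x′ y → [ x M.+ᴹ x′ , y ] ≋ (x , y) ∷ (x′ , y) ∷ []
    ⊗-+ʳ     : ∀ x y y′ → [ x , y N.+ᴹ y′ ] ≋ (x , y) ∷ (x , y′) ∷ []
    ⊗-0ˡ     : ∀ y → [ M.0ᴹ , y ] ≋ []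
    ⊗-0ʳ     : ∀ x → [ x , N.0ᴹ ] ≋ []
    balanced : ∀ k x y → [ k M.*ₗ x , y ] ≋ [ x , k N.*ₗ y ]

  infixr 7 _⊗_
  _⊗_ : RawLeftModule S (a ⊔ b) (c ⊔ a ⊔ ℓa ⊔ b ⊔ ℓb)
  _⊗_ = record
    { Carrierᴹ = FormalSum
    ; _≈ᴹ_     = _≋_
    ; _+ᴹ_     = _++_
    ; _*ₗ_     = λ k → map (λ (x , y) → k M.*ₗ x , y)
    ; 0ᴹ       = []
    ; -ᴹ_      = map (λ (x , y) → M.-ᴹ x , y)
    }

_⊗ₐ_ : {S : Set c} → RawAlgebra S a ℓa → RawAlgebra S b ℓb →
       RawAlgebra S (a ⊔ b) (c ⊔ a ⊔ ℓa ⊔ b ⊔ ℓb)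
A ⊗ₐ B = record
  { _≈_ = _≈ᴹ_
  ; _+_ = _+ᴹ_
  ; _*_ = cartesianProductWith (λ (x , y) (x′ , y′) → x A.* x′ , y B.* y′)
  ; _·_ = _*ₗ_
  ; -_  = -ᴹ_
  ; 0#  = 0ᴹ
  ; 1#  = [ A.1# , B.1# ]
  }
  where
  module A = RawAlgebra A
  module B = RawAlgebra B
  open RawLeftModule (A.rawLeftModule ⊗ B.rawLeftModule)

-- The underlying functions of f ⊗ g, of the associativity isomorphism
-- (X ⊗ Y) ⊗ Z → X ⊗ (Y ⊗ Z), and of the map X ⊗ Y → A induced by a
-- bilinear X × Y → A.
module _ {X : Set a} {Y : Set b} where

  _⊗₁_ : {X′ : Set c} {Y′ : Set d} → (X → X′) → (Y → Y′) → List (X × Y) → List (X′ × Y′)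
  f ⊗₁ g = map (Product.map f g)

  assoc : {Z : Set d} → List (List (X × Y) × Z) → List (X × List (Y × Z))
  assoc = concatMap (λ (s , z) → map (λ (x , y) → x , [ y , z ]) s)

  induced : {S : Set c} (A : RawAlgebra S d ℓd) →
            (X → Y → RawAlgebra.Carrier A) → List (X × Y) → RawAlgebra.Carrier A
  induced A β = foldr (λ (x , y) t → β x y + t) 0#
    where open RawAlgebra A

module _ {S : Set c} (M : RawLeftModule S a ℓa) where
  open RawLeftModule M

  data Span {p} (G : Pred Carrierᴹ p) : Pred Carrierᴹ (c ⊔ a ⊔ ℓa ⊔ p) where
    gen  : ∀ {x} → G x → Span G x
    zero : Span G 0ᴹ
    add  : ∀ {x y} → Span G x → Span G y → Span G (x +ᴹ y)
    scal : ∀ k {x} → Span G x → Span G (k *ₗ x)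
    resp : ∀ {x y} → x ≈ᴹ y → Span G x → Span G y

  record IsSubmodule {p} (P : Pred Carrierᴹ p) : Set (c ⊔ a ⊔ ℓa ⊔ p) where
    field
      respects : ∀ {x y} → x ≈ᴹ y → P x → P y
      0-closed : P 0ᴹ
      +-closed : ∀ {x y} → P x → P y → P (x +ᴹ y)
      ·-closed : ∀ k {x} → P x → P (k *ₗ x)

module _ (K : CommutativeRing c ℓ) (A : RawAlgebra (CommutativeRing.Carrier K) a ℓa) where
  private
    module K = CommutativeRing K
  open RawAlgebra A

  A⊗A : RawAlgebra K.Carrier a (c ⊔ a ⊔ ℓa)
  A⊗A = A ⊗ₐ A

  private
    module A⊗A = RawAlgebra A⊗A
    module A⊗A⊗A = RawAlgebra (A ⊗ₐ A⊗A)

  record IsBialgebra (Δ : Carrier → A⊗A.Carrier) (ε : Carrier → K.Carrier) :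
                     Set (c ⊔ ℓ ⊔ a ⊔ ℓa) where
    field
      isAlgebra        : IsAlgebra K A
      Δ-isHomomorphism : IsAlgebraHomomorphism A A⊗A Δ
      ε-isHomomorphism : IsAlgebraHomomorphism A (scalars K) ε
      coassociative    : ∀ x → assoc ((Δ ⊗₁ id) (Δ x)) A⊗A⊗A.≈ (id ⊗₁ Δ) (Δ x)
      counitˡ          : ∀ x → induced A _·_ ((ε ⊗₁ id) (Δ x)) ≈ x
      counitʳ          : ∀ x → induced A (λ y k → k · y) ((id ⊗₁ ε) (Δ x)) ≈ x

  record IsAntipode (Δ : Carrier → A⊗A.Carrier) (ε : Carrier → K.Carrier)
                    (S : Carrier → Carrier) : Set (c ⊔ a ⊔ ℓa) where
    field
      isLinear : IsLeftModuleHomomorphism rawLeftModule rawLeftModule S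
      inverseˡ : ∀ x → induced A _*_ ((S ⊗₁ id) (Δ x)) ≈ ε x · 1#
      inverseʳ : ∀ x → induced A _*_ ((id ⊗₁ S) (Δ x)) ≈ ε x · 1#

  -- A is the internal direct sum of the submodules G 0, G 1, …, and
  -- multiplication respects degrees.
  record IsGrading {p} (G : ℕ → Pred Carrier p) : Set (c ⊔ a ⊔ ℓa ⊔ p) where
    private
      Σ[_] : ∀ {N} → (Fin N → Carrier) → Carrier
      Σ[_] = sum (record { _≈_ = _≈_ ; _∙_ = _+_ ; ε = 0# })
    field
      isSubmodule   : ∀ m → IsSubmodule rawLeftModule (G m)
      decomposition : ∀ x → ∃ λ N → Σ (Fin N → Carrier) λ f →
                        (∀ m → G (toℕ m) (f m)) × x ≈ Σ[ f ]
      independent   : ∀ N (f : Fin N → Carrier) → (∀ m → G (toℕ m) (f m)) →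
                        Σ[ f ] ≈ 0# → ∀ m → f m ≈ 0#
      1-degree      : G 0 1#
      *-degree      : ∀ {i j x y} → G i x → G j y → G (i ℕ.+ j) (x * y)

  -- ⊕_{i + j = m} G i ⊗ G j
  tensorDegree : ∀ {p} → (ℕ → Pred Carrier p) → ℕ →
                 Pred A⊗A.Carrier (c ⊔ a ⊔ ℓa ⊔ p)
  tensorDegree G m = Span A⊗A.rawLeftModule λ t →
    ∃ λ i → ∃ λ j → ∃ λ x → ∃ λ y →
      (i ℕ.+ j ≡ m) × G i x × G j y × (t ≡ [ x , y ])

  record IsGradedConnectedHopfAlgebra
           (Δ : Carrier → A⊗A.Carrier) (ε : Carrier → K.Carrier)
           {p} (G : ℕ → Pred Carrier p) : Set (c ⊔ ℓ ⊔ a ⊔ ℓa ⊔ p) where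
    field
      isBialgebra : IsBialgebra Δ ε
      isGrading   : IsGrading G
      Δ-degree    : ∀ {m x} → G m x → tensorDegree G m (Δ x)
      ε-degree    : ∀ {m x} → m ≢ 0 → G m x → ε x K.≈ K.0#
      connected   : ∀ x → G 0 x ⇔ (∃ λ k → x ≈ k · 1#)
      antipode    : ∃ λ S → IsAntipode Δ ε S

-- K[V] as the free commutative K-algebra on V: polynomial expressions
-- modulo the laws of commutative K-algebras.  A normal form is not
-- available, since equality in K need not be decidable.
module _ (K : CommutativeRing c ℓ) (V : Set v) where
  private
    module K = CommutativeRing K

  infixl 6 _:+_
  infixl 7 _:*_
  data Poly : Set (c ⊔ v) where
    con  : K.Carrier → Poly
    var  : V → Poly
    _:+_ : Poly → Poly → Poly
    _:*_ : Poly → Poly → Poly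
    :-_  : Poly → Poly

  infix 4 _≈ₚ_
  data _≈ₚ_ : Rel Poly (c ⊔ ℓ ⊔ v) where
    ≈-refl      : ∀ {p} → p ≈ₚ p
    ≈-sym       : ∀ {p q} → p ≈ₚ q → q ≈ₚ p
    ≈-trans     : ∀ {p q r} → p ≈ₚ q → q ≈ₚ r → p ≈ₚ r
    +-cong      : ∀ {p p′ q q′} → p ≈ₚ p′ → q ≈ₚ q′ → p :+ q ≈ₚ p′ :+ q′
    *-cong      : ∀ {p p′ q q′} → p ≈ₚ p′ → q ≈ₚ q′ → p :* q ≈ₚ p′ :* q′
    neg-cong    : ∀ {p p′} → p ≈ₚ p′ → :- p ≈ₚ :- p′
    +-assoc     : ∀ p q r → (p :+ q) :+ r ≈ₚ p :+ (q :+ r)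
    +-comm      : ∀ p q → p :+ q ≈ₚ q :+ p
    +-identityˡ : ∀ p → con K.0# :+ p ≈ₚ p
    +-inverseˡ  : ∀ p → (:- p) :+ p ≈ₚ con K.0#
    *-assoc     : ∀ p q r → (p :* q) :* r ≈ₚ p :* (q :* r)
    *-comm      : ∀ p q → p :* q ≈ₚ q :* p
    *-identityˡ : ∀ p → con K.1# :* p ≈ₚ p
    distribˡ    : ∀ p q r → p :* (q :+ r) ≈ₚ p :* q :+ p :* r
    con-cong    : ∀ {k k′} → k K.≈ k′ → con k ≈ₚ con k′
    con-+       : ∀ k k′ → con (k K.+ k′) ≈ₚ con k :+ con k′
    con-*       : ∀ k k′ → con (k K.* k′) ≈ₚ con k :* con k′

  polynomialAlgebra : RawAlgebra K.Carrier (c ⊔ v) (c ⊔ ℓ ⊔ v)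
  polynomialAlgebra = record
    { _≈_ = _≈ₚ_
    ; _+_ = _:+_
    ; _*_ = _:*_
    ; _·_ = λ k p → con k :* p
    ; -_  = :-_
    ; 0#  = con K.0#
    ; 1#  = con K.1#
    }

-- For a commutative algebra A, the unital algebra homomorphism K[V] → A
-- with prescribed values on V.
extend : (K : CommutativeRing c ℓ) {V : Set v} (A : RawAlgebra (CommutativeRing.Carrier K) a ℓa) →
         (V → RawAlgebra.Carrier A) → Poly K V → RawAlgebra.Carrier A
extend K A f (con k)  = RawAlgebra._·_ A k (RawAlgebra.1# A)
extend K A f (var x)  = f x
extend K A f (p :+ q) = RawAlgebra._+_ A (extend K A f p) (extend K A f q)
extend K A f (p :* q) = RawAlgebra._*_ A (extend K A f p) (extend K A f q)
extend K A f (:- p)   = RawAlgebra.-_ A (extend K A f p)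

Related : Vec (Subset n) n → Rel (Fin n) 0ℓ
Related v i j = j ∈ₛ lookup v i

record IsNC (v : Vec (Subset n) n) : Set where
  field
    isEquivalence : IsEquivalence (Related v)
    noncrossing   : ∀ i j k l → i Fin.< j → j Fin.< k → k Fin.< l →
                    Related v i k → Related v j l → Related v i j

-- A partition of Fin n is given by the vector whose i-th entry is the
-- block containing i.  The proof is irrelevant, so that two elements of
-- NC n with the same blocks are equal.
record NC (n : ℕ) : Set where
  constructor nc
  field
    blockOf : Vec (Subset n) n
    .isNC   : IsNC blockOf
open NC public using (blockOf)

_≟ₛ_ : (V W : Subset n) → Dec (V ≡ W)
_≟ₛ_ = Vec.≡-dec Bool._≟_

_≟_ : (π σ : NC n) → Dec (π ≡ σ)
nc v _ ≟ nc w _ = map′ (λ { refl → refl }) (cong blockOf) (Vec.≡-dec _≟ₛ_ v w)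

blocks : NC n → List (Subset n)
blocks π = deduplicate _≟ₛ_ (toList (blockOf π))

#blocks : NC n → ℕ
#blocks π = length (blocks π)

isNC? : (v : Vec (Subset n) n) → Dec (IsNC v)
isNC? v = map′
  (λ (r , s , t , x) → record
    { isEquivalence = record
      { refl  = λ {i} → r i
      ; sym   = λ {i} {j} → s i j
      ; trans = λ {i} {j} {k} → t i j k }
    ; noncrossing = x })
  (λ p → (λ i → IsEquivalence.refl (IsNC.isEquivalence p))
       , (λ i j → IsEquivalence.sym (IsNC.isEquivalence p))
       , (λ i j k → IsEquivalence.trans (IsNC.isEquivalence p))
       , IsNC.noncrossing p)
  ( Fin.all? (λ i → R? i i)
  ×-dec Fin.all? (λ i → Fin.all? λ j → R? i j →-dec R? j i)
  ×-dec Fin.all? (λ i → Fin.all? λ j → Fin.all? λ k →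
          R? i j →-dec (R? j k →-dec R? i k))
  ×-dec Fin.all? (λ i → Fin.all? λ j → Fin.all? λ k → Fin.all? λ l →
          i Fin.<? j →-dec (j Fin.<? k →-dec (k Fin.<? l →-dec
            (R? i k →-dec (R? j l →-dec R? i j))))))
  where
  R? : ∀ i j → Dec (Related v i j)
  R? i j = j ∈? lookup v i

allVecs : {X : Set a} → List X → ∀ n → List (Vec X n)
allVecs xs zero    = [ [] ]
allVecs xs (suc n) = cartesianProductWith _∷_ xs (allVecs xs n)

selectNC : Vec (Subset n) n → List (NC n)
selectNC v with isNC? v
... | yes p = [ nc v p ]
... | no  _ = []

-- Every element of NC n, exactly once.
allNC : ∀ n → List (NC n)
allNC n = concatMap selectNC (allVecs (allVecs (inside ∷ outside ∷ []) n) n)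

1ₙ : ∀ n → NC n
1ₙ n = nc (replicate n ⊤) (record
  { isEquivalence = record
    { refl  = λ {i} → full i i
    ; sym   = λ {i} {j} _ → full j i
    ; trans = λ {i} {j} {k} _ _ → full i k }
  ; noncrossing = λ i j _ _ _ _ _ _ _ → full i j })
  where
  full : ∀ i j → Related (replicate n ⊤) i j
  full i j = subst (j ∈ₛ_) (sym (Vec.lookup-replicate i ⊤)) ∈⊤

IsUnionOf : List (Subset n) → Subset n → Set
IsUnionOf 𝒱 W = ∃ λ 𝒰 → All (_∈ 𝒱) 𝒰 × (W ≡ ⋃ 𝒰)

infix 4 _≤_
_≤_ : NC n → NC n → Set
π ≤ σ = All (IsUnionOf (blocks π)) (blocks σ)

private
  ⊆⋃ : ∀ {𝒰 : List (Subset n)} {U} → U ∈ 𝒰 → U ⊆ₛ ⋃ 𝒰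
  ⊆⋃ {𝒰 = V ∷ 𝒰} (here refl) x∈U = p⊆p∪q (⋃ 𝒰) x∈U
  ⊆⋃ {𝒰 = V ∷ 𝒰} (there U∈𝒰) x∈U = q⊆p∪q V (⋃ 𝒰) (⊆⋃ U∈𝒰 x∈U)

  ⋃⊆ : ∀ {W : Subset n} {𝒰} → (∀ {U} → U ∈ 𝒰 → U ⊆ₛ W) → ⋃ 𝒰 ⊆ₛ W
  ⋃⊆ {𝒰 = []}    h x∈ with () ← ∉⊥ x∈
  ⋃⊆ {𝒰 = V ∷ 𝒰} h x∈ with x∈p∪q⁻ V (⋃ 𝒰) x∈
  ... | inj₁ x∈V = h (here refl) x∈V
  ... | inj₂ x∈⋃ = ⋃⊆ {𝒰 = 𝒰} (λ U∈ → h (there U∈)) x∈⋃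

isUnionOf? : (𝒱 : List (Subset n)) (W : Subset n) → Dec (IsUnionOf 𝒱 W)
isUnionOf? 𝒱 W = map′ to from (W ≟ₛ ⋃ inner)
  where
  inner = filter (_⊆? W) 𝒱

  to : W ≡ ⋃ inner → IsUnionOf 𝒱 W
  to eq = inner , All.tabulate (λ U∈ → proj₁ (∈-filter⁻ (_⊆? W) U∈)) , eq

  from : IsUnionOf 𝒱 W → W ≡ ⋃ inner
  from (𝒰 , 𝒰⊆𝒱 , refl) = ⊆-antisym
    (⋃⊆ λ U∈𝒰 → ⊆⋃ (∈-filter⁺ (_⊆? W) (All.lookup 𝒰⊆𝒱 U∈𝒰) (⊆⋃ U∈𝒰)))
    (⋃⊆ {𝒰 = inner} λ U∈ → proj₂ (∈-filter⁻ (_⊆? W) {xs = 𝒱} U∈))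

_≤?_ : (π σ : NC n) → Dec (π ≤ σ)
π ≤? σ = all? (isUnionOf? (blocks π)) (blocks σ)

-- For W = {p₁ < … < pₘ}, the map i ↦ pᵢ; restrict π W below is π_W.
element : (W : Subset n) → Fin ∣ W ∣ → Fin n
element (inside  ∷ W) zero    = zero
element (inside  ∷ W) (suc i) = suc (element W i)
element (outside ∷ W) i       = suc (element W i)

element-mono : (W : Subset n) {i j : Fin ∣ W ∣} → i Fin.< j → element W i Fin.< element W j
element-mono (inside  ∷ W) {zero}  {suc j} _           = ℕ.z<s
element-mono (inside  ∷ W) {suc i} {suc j} (ℕ.s<s i<j) = ℕ.s<s (element-mono W i<j)
element-mono (outside ∷ W)                 i<j         = ℕ.s<s (element-mono W i<j)

restrict : NC n → (W : Subset n) → NC ∣ W ∣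
restrict {n} (nc v nc-v) W = nc w (record
  { isEquivalence = record
    { refl  = back (IsEquivalence.refl (IsNC.isEquivalence nc-v))
    ; sym   = λ r → back (IsEquivalence.sym (IsNC.isEquivalence nc-v) (forth r))
    ; trans = λ r s →
        back (IsEquivalence.trans (IsNC.isEquivalence nc-v) (forth r) (forth s)) }
  ; noncrossing = λ i j k l i<j j<k k<l r s → back
      (IsNC.noncrossing nc-v _ _ _ _
        (element-mono W i<j) (element-mono W j<k) (element-mono W k<l)
        (forth r) (forth s)) })
  where
  p = element W
  w = tabulate λ i → tabulate λ j → lookup (lookup v (p i)) (p j)

  entry : ∀ i j → lookup (lookup w i) j ≡ lookup (lookup v (p i)) (p j)
  entry i j = trans (cong (λ u → lookup u j) (Vec.lookup∘tabulate _ i))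
                    (Vec.lookup∘tabulate _ j)

  forth : ∀ {i j} → Related w i j → Related v (p i) (p j)
  forth {i} {j} r = Vec.lookup⇒[]= (p j) _
    (trans (sym (entry i j)) (Vec.[]=⇒lookup r))

  back : ∀ {i j} → Related v (p i) (p j) → Related w i j
  back {i} {j} r = Vec.lookup⇒[]= j _ (trans (entry i j) (Vec.[]=⇒lookup r))

-- ⊔ₙ (NC n ∖ {1ₙ}); there is no contribution from n = 0, since the only
-- element of NC 0 is 1ₙ 0.
record Generator : Set where
  constructor generator
  field
    {size} : ℕ
    π      : NC size
    .π≢1   : π ≢ 1ₙ size

module _ (K : CommutativeRing c ℓ) where
  open CommutativeRing K using () renaming (Carrier to Kᶜ; 0# to 0ₖ)

  𝒯 : RawAlgebra Kᶜ c (c ⊔ ℓ)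
  𝒯 = polynomialAlgebra K Generator

  open RawAlgebra 𝒯

  X : NC n → Carrier
  X {n} π with π ≟ 1ₙ n
  ... | yes _   = 1#
  ... | no  π≢1 = var (generator π π≢1)

  Δ : Carrier → RawAlgebra.Carrier (𝒯 ⊗ₐ 𝒯)
  Δ = extend K (𝒯 ⊗ₐ 𝒯) λ (generator {n} π _) →
    map (λ σ → product (map (λ W → X (restrict π W)) (blocks σ)) , X σ)
        (filter (π ≤?_) (allNC n))

  ε : Carrier → Kᶜ
  ε = extend K (scalars K) (λ _ → 0ₖ)

  𝒯ₘ : ℕ → Pred Carrier (c ⊔ ℓ)
  𝒯ₘ zero      = Span rawLeftModule (_≡ 1#)
  𝒯ₘ m@(suc _) = Span rawLeftModule λ x → ∃ λ (gs : List Generator) →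
    (1 ℕ.≤ length gs) × (length gs ℕ.≤ m) ×
    (ℕ-sum (map (#blocks ∘ Generator.π) gs) ≡ m ℕ.+ length gs) ×
    (x ≡ product (map var gs))

{-# OPTIONS --safe #-}
module Submission where

-- Algebra homomorphisms φ, ψ from 𝒯 to a commutative algebra C have a convolution product
-- φ ⋆ ψ, which is again a homomorphism because C ⊗ C → C is one.  On generators,
-- (φ ⋆ ψ)(X_π) = Σ_{σ ≥ π} (∏_{W ∈ σ} φ(X_{π_W})) ψ(X_σ).  For σ ≥ π, restriction to the blocks
-- of σ identifies the interval [π, σ] with ∏_{W ∈ σ} [π_W, 1]: a family of non-crossing
-- partitions of the blocks glues to a partition which is non-crossing because σ is.  Expanding
-- a product of sums along this bijection shows that ⋆ is associative.  Coassociativity is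
-- this associativity for the three inclusions 𝒯 → 𝒯 ⊗ 𝒯 ⊗ 𝒯.  A left ⋆-inverse of φ is
-- defined by recursion on n, since the blocks of σ ≠ 1ₙ have fewer than n elements; as every
-- homomorphism has a left inverse, left inverses are two-sided, and the antipode is the
-- inverse of the identity.  The sum of the 𝒯ₘ is direct because 𝒯ₘ consists of
-- eigenvectors with eigenvalue m of the derivation X_π ↦ (|π| - 1) X_π.

open import Defs hiding
  ( assoc; ≈-refl; ≈-sym; ≈-trans; +-cong; *-cong; neg-cong; +-assoc; +-comm; +-identityˡ
  ; +-inverseˡ; *-assoc; *-comm; *-identityˡ; distribˡ; con-cong; con-+; con-* )
open import Algebra.Bundles using (CommutativeMonoid; CommutativeRing)
open import Algebra.Module.Bundles.Raw using (RawLeftModule)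
import Algebra.Properties.AbelianGroup
import Algebra.Properties.CommutativeMonoid.Sum
import Algebra.Properties.CommutativeSemigroup
import Algebra.Properties.Group
import Algebra.Properties.Ring
import Algebra.Properties.Semiring.Sum
import Algebra.Solver.Ring.NaturalCoefficients.Default
open import Data.Bool.Base using (Bool; true; false; if_then_else_)
import Data.Bool.Properties as Bool
open import Data.Empty using (⊥; ⊥-elim; ⊥-elim-irr)
open import Data.Fin.Base as Fin using (Fin; zero; suc; toℕ)
import Data.Fin.Properties as Fin
open import Data.Fin.Subset using (Subset; ∣_∣; ⋃; ⊤) renaming (_∈_ to _∈ₛ_)
open import Data.Fin.Subset.Properties
  using (∉⊥; ∣⊤∣≡n; ∣p∣≤n; ∣p∣≡n⇒p≡⊤; _⊆?_; ⊆-antisym; x∈p∪q⁻; p⊆p∪q; q⊆p∪q)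
open import Data.List.Base
  using (List; []; _∷_; [_]; _++_; map; foldr; filter; concatMap; cartesianProductWith; length)
import Data.List.Properties as List
open import Data.List.Membership.Propositional using (_∈_; find; lose)
open import Data.List.Membership.Propositional.Properties
  using (∈-filter⁺; ∈-filter⁻; ∈-map⁺; ∈-map⁻; ∈-concatMap⁺; ∈-concatMap⁻; ∈-deduplicate⁺;
         ∈-deduplicate⁻; ∈-cartesianProductWith⁺; ∈-cartesianProductWith⁻)
open import Data.List.Membership.Propositional.Properties.WithK using (unique⇒irrelevant; unique∧set⇒bag)
open import Data.List.Relation.Binary.BagAndSetEquality using (∼bag⇒↭)
open import Data.List.Relation.Binary.Permutation.Propositional as Perm using (_↭_)
open import Data.List.Relation.Binary.Permutation.Propositional.Properties using (↭-length)
open import Data.List.Relation.Unary.All as All using (All; []; _∷_)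
import Data.List.Relation.Unary.All.Properties as All
open import Data.List.Relation.Unary.AllPairs using ([]; _∷_)
open import Data.List.Relation.Unary.Any using (here; there)
open import Data.List.Relation.Unary.Unique.Propositional using (Unique)
import Data.List.Relation.Unary.Unique.DecPropositional.Properties as UniqueDec
import Data.List.Relation.Unary.Unique.Propositional.Properties as Unique
open import Data.Nat.Base as ℕ using (ℕ; zero; suc)
open import Data.Nat.ListAction using () renaming (sum to ℕ-sum)
open import Data.Nat.ListAction.Properties using () renaming (sum-++ to ℕ-sum-++)
import Data.Nat.Properties as ℕ
open import Data.Product.Base as Product using (Σ; ∃; _×_; _,_; proj₁; proj₂; uncurry)
open import Data.Rational.Base as ℚ using (ℚ; 0ℚ; 1ℚ; NonNegative; Positive)
import Data.Rational.Properties as ℚ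
open import Data.Sum.Base using (_⊎_; inj₁; inj₂)
open import Data.Vec.Base as Vec using (Vec; []; _∷_; lookup; tabulate; toList)
import Data.Vec.Membership.Propositional.Properties as Vec
import Data.Vec.Properties as Vec
import Data.Vec.Relation.Unary.Any as VecAny
import Data.Vec.Relation.Unary.Any.Properties as VecAny
open import Function.Base using (id; _∘_; case_of_)
open import Function.Bundles using (_⇔_; mk⇔)
open import Level using (0ℓ)
open import Relation.Binary.Definitions using (DecidableEquality)
open import Relation.Binary.PropositionalEquality as ≡
  using (_≡_; _≢_; refl; sym; trans; cong; cong₂; subst; subst₂; module ≡-Reasoning)
import Relation.Binary.Reasoning.Setoid
open import Relation.Binary.Structures using (IsEquivalence)
open import Relation.Nullary using (Dec; yes; no; does; ¬?; contradiction; _×-dec_; _⊎-dec_)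
open import Relation.Nullary.Decidable using (map′; recompute; dec-true)
open import Relation.Unary using (Pred; Decidable)

open Algebra.Properties.CommutativeSemigroup ℕ.+-commutativeSemigroup
  using () renaming (interchange to ℕ-interchange)

-- Coefficients cannot be compared: equality in the base ring is not decidable, and polynomials and
-- tensors are formal expressions modulo generated relations. Identities are therefore proved by
-- comparing homomorphisms on the `X π`, and directness of the grading by an operator defined on
-- expressions. Only that last point divides by positive integers; the rest holds over an arbitrary
-- commutative ring `K`. The target `C` of the homomorphisms is kept arbitrary because associativity
-- of convolution is needed twice, for the triple tensor product (coassociativity) and for the
-- algebra itself (uniqueness of inverses). The partitions π_W live in `NC ∣ W ∣`, a type that
-- varies with the block. Hence families of them are elements of `All` over the list of blocks, and
-- iterated restrictions are compared together with their sizes.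

private
  variable
    m n : ℕ
    A B I J : Set

-- Non-crossing partitions

-- The bijections behind the sums and products below are all reduced to this: two inclusions of
-- membership and the absence of repetitions.
unique-sets⇒↭ : {xs ys : List A} → Unique xs → Unique ys →
                (∀ {z} → z ∈ xs → z ∈ ys) → (∀ {z} → z ∈ ys → z ∈ xs) → xs ↭ ys
unique-sets⇒↭ u v f g = ∼bag⇒↭ (unique∧set⇒bag u v (mk⇔ f g))

concatMap-unique : (f : A → List B) {xs : List A} → Unique xs →
                   (∀ {x} → x ∈ xs → Unique (f x)) →
                   (∀ {x y z} → x ∈ xs → y ∈ xs → z ∈ f x → z ∈ f y → x ≡ y) →
                   Unique (concatMap f xs)
concatMap-unique f [] h d = []
concatMap-unique f (x∉ ∷ u) h d = Unique.++⁺ (h (here refl))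
  (concatMap-unique f u (h ∘ there) λ p q → d (there p) (there q))
  λ (z∈ , z∈′) → let y , y∈ , z∈fy = find (∈-concatMap⁻ f z∈′)
                 in All.lookup x∉ y∈ (d (here refl) (there y∈) z∈ z∈fy)

-- Injectivity is asked for on `xs` only, because a partition is determined by its restrictions to
-- the blocks of `σ` only if it lies below `σ`.
map-unique : (f : A → B) {xs : List A} → Unique xs →
             (∀ {x y} → x ∈ xs → y ∈ xs → f x ≡ f y → x ≡ y) → Unique (map f xs)
map-unique f []       inj = []
map-unique f (x∉ ∷ u) inj =
  All.map⁺ (All.tabulate λ y∈ eq → All.lookup x∉ y∈ (inj (here refl) (there y∈) eq))
  ∷ map-unique f u λ p q → inj (there p) (there q)

true-ext : {b c : Bool} → (b ≡ true → c ≡ true) → (c ≡ true → b ≡ true) → b ≡ c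
true-ext {false} {false} f g = refl
true-ext {false} {true}  f g = g refl
true-ext {true}  {c}     f g = sym (f refl)

lookup-ext : {v w : Vec A n} → (∀ i → lookup v i ≡ lookup w i) → v ≡ w
lookup-ext {v = v} {w} eq =
  trans (sym (Vec.tabulate∘lookup v)) (trans (Vec.tabulate-cong eq) (Vec.tabulate∘lookup w))

matrix : (Fin n → Fin n → A) → Vec (Vec A n) n
matrix r = tabulate λ i → tabulate (r i)

lookup-matrix : (r : Fin n → Fin n → A) → ∀ i j → lookup (lookup (matrix r) i) j ≡ r i j
lookup-matrix r i j = trans (cong (λ v → lookup v j) (Vec.lookup∘tabulate _ i)) (Vec.lookup∘tabulate _ j)

block : NC n → Fin n → Subset n
block π = lookup (blockOf π)

rel : NC n → Fin n → Fin n → Bool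
rel π i j = lookup (block π i) j

infix 4 _⊢_∼_
_⊢_∼_ : NC n → Fin n → Fin n → Set
π ⊢ i ∼ j = rel π i j ≡ true

-- The stored proof is irrelevant, but the property is decidable, so a usable proof can be
-- recomputed.
isNC : (π : NC n) → IsNC (blockOf π)
isNC (nc v nc-v) = recompute (isNC? v) nc-v

module _ (π : NC n) where
  private
    module E = IsEquivalence (IsNC.isEquivalence (isNC π))

    related : ∀ {i j} → π ⊢ i ∼ j → Related (blockOf π) i j
    related = Vec.lookup⇒[]= _ _

  ∼-refl : ∀ i → π ⊢ i ∼ i
  ∼-refl i = Vec.[]=⇒lookup (E.refl {i})

  ∼-sym : ∀ {i j} → π ⊢ i ∼ j → π ⊢ j ∼ i
  ∼-sym p = Vec.[]=⇒lookup (E.sym (related p))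

  ∼-trans : ∀ {i j k} → π ⊢ i ∼ j → π ⊢ j ∼ k → π ⊢ i ∼ k
  ∼-trans p q = Vec.[]=⇒lookup (E.trans (related p) (related q))

  ∼-noncrossing : ∀ {i j k l} → i Fin.< j → j Fin.< k → k Fin.< l →
                  π ⊢ i ∼ k → π ⊢ j ∼ l → π ⊢ i ∼ j
  ∼-noncrossing i<j j<k k<l p q =
    Vec.[]=⇒lookup (IsNC.noncrossing (isNC π) _ _ _ _ i<j j<k k<l (related p) (related q))

  ∈-blocks⁺ : ∀ i → block π i ∈ blocks π
  ∈-blocks⁺ i = ∈-deduplicate⁺ _≟ₛ_ (Vec.∈-toList⁺ (Vec.∈-lookup i (blockOf π)))

  ∈-blocks⁻ : ∀ {W} → W ∈ blocks π → ∃ λ i → W ≡ block π i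
  ∈-blocks⁻ W∈ = VecAny.index W∈′ , VecAny.lookup-index W∈′
    where W∈′ = Vec.∈-toList⁻ (∈-deduplicate⁻ _≟ₛ_ (toList (blockOf π)) W∈)

  blocks-unique : Unique (blocks π)
  blocks-unique = UniqueDec.deduplicate-! _≟ₛ_ (toList (blockOf π))

  ∈-block⇒≡ : ∀ {W i} → W ∈ blocks π → lookup W i ≡ true → W ≡ block π i
  ∈-block⇒≡ {i = i} W∈ i∈W with ∈-blocks⁻ W∈
  ... | k , refl = lookup-ext λ j → true-ext (∼-trans (∼-sym i∈W)) (∼-trans i∈W)

  same-block : ∀ {W i j} → W ∈ blocks π → lookup W i ≡ true → lookup W j ≡ true → π ⊢ i ∼ j
  same-block {j = j} W∈ i∈W j∈W = subst (λ V → lookup V j ≡ true) (∈-block⇒≡ W∈ i∈W) j∈W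

NC-ext : {π σ : NC n} → (∀ i j → rel π i j ≡ rel σ i j) → π ≡ σ
NC-ext {π = nc v _} {nc w _} eq with lookup-ext {v = v} {w} (λ i → lookup-ext (eq i))
... | refl = refl

∈-⋃⁺ : ∀ {𝒰 : List (Subset n)} {U i} → U ∈ 𝒰 → i ∈ₛ U → i ∈ₛ ⋃ 𝒰
∈-⋃⁺ {𝒰 = V ∷ 𝒰} (here refl) i∈U = p⊆p∪q (⋃ 𝒰) i∈U
∈-⋃⁺ {𝒰 = V ∷ 𝒰} (there U∈𝒰) i∈U = q⊆p∪q V (⋃ 𝒰) (∈-⋃⁺ U∈𝒰 i∈U)

∈-⋃⁻ : ∀ (𝒰 : List (Subset n)) {i} → i ∈ₛ ⋃ 𝒰 → ∃ λ U → U ∈ 𝒰 × i ∈ₛ U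
∈-⋃⁻ []      i∈ = ⊥-elim (∉⊥ i∈)
∈-⋃⁻ (V ∷ 𝒰) i∈ with x∈p∪q⁻ V (⋃ 𝒰) i∈
... | inj₁ i∈V = V , here refl , i∈V
... | inj₂ i∈⋃ = let U , U∈ , i∈U = ∈-⋃⁻ 𝒰 i∈⋃ in U , there U∈ , i∈U

module _ (π σ : NC n) where

  -- The block of `σ` through `i` is a union of blocks of `π`. The one among them that contains `i`
  -- is the block of `π` through `i`, so it contains `j`. With the converse below, the order becomes
  -- inclusion of equivalence relations.
  ≤⇒∼ : π ≤ σ → ∀ {i j} → π ⊢ i ∼ j → σ ⊢ i ∼ j
  ≤⇒∼ π≤σ {i} {j} i∼j with All.lookup π≤σ (∈-blocks⁺ σ i)
  ... | 𝒰 , 𝒰⊆ , eq with ∈-⋃⁻ 𝒰 (subst (i ∈ₛ_) eq (Vec.lookup⇒[]= i _ (∼-refl σ i)))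
  ... | U , U∈ , i∈U = Vec.[]=⇒lookup (subst (j ∈ₛ_) (sym eq) (∈-⋃⁺ U∈ (Vec.lookup⇒[]= j U
          (trans (cong (λ V → lookup V j)
            (∈-block⇒≡ π (All.lookup 𝒰⊆ U∈) (Vec.[]=⇒lookup i∈U))) i∼j))))

  ∼⇒≤ : (∀ {i j} → π ⊢ i ∼ j → σ ⊢ i ∼ j) → π ≤ σ
  ∼⇒≤ f = All.tabulate unionOf
    where
    unionOf : ∀ {W} → W ∈ blocks σ → IsUnionOf (blocks π) W
    unionOf {W} W∈ with ∈-blocks⁻ σ W∈
    ... | k , refl = inner , All.tabulate (λ U∈ → proj₁ (∈-filter⁻ (_⊆? W) U∈))
        , ⊆-antisym
            (λ {i} i∈W → ∈-⋃⁺ (∈-filter⁺ (_⊆? W) (∈-blocks⁺ π i) (λ {j} j∈ →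
                 Vec.lookup⇒[]= j W (∼-trans σ (Vec.[]=⇒lookup i∈W) (f (Vec.[]=⇒lookup j∈)))))
               (Vec.lookup⇒[]= i _ (∼-refl π i)))
            (λ i∈⋃ → let U , U∈ , i∈U = ∈-⋃⁻ inner i∈⋃
                     in proj₂ (∈-filter⁻ (_⊆? W) {xs = blocks π} U∈) i∈U)
      where inner = filter (_⊆? W) (blocks π)

≤-refl : (π : NC n) → π ≤ π
≤-refl π = ∼⇒≤ π π id

≤-trans : (π σ τ : NC n) → π ≤ σ → σ ≤ τ → π ≤ τ
≤-trans π σ τ p q = ∼⇒≤ π τ (≤⇒∼ σ τ q ∘ ≤⇒∼ π σ p)

≤-antisym : {π σ : NC n} → π ≤ σ → σ ≤ π → π ≡ σ
≤-antisym {π = π} {σ} p q = NC-ext λ _ _ → true-ext (≤⇒∼ π σ p) (≤⇒∼ σ π q)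

1ₙ-∼ : ∀ (i j : Fin n) → 1ₙ n ⊢ i ∼ j
1ₙ-∼ {n} i j = trans (cong (λ W → lookup W j) (Vec.lookup-replicate {n = n} i ⊤))
                     (Vec.lookup-replicate j true)

≤-1ₙ : (π : NC n) → π ≤ 1ₙ n
≤-1ₙ π = ∼⇒≤ π (1ₙ _) λ {i} {j} _ → 1ₙ-∼ i j

1ₙ≤⇒≡ : {π : NC n} → 1ₙ n ≤ π → π ≡ 1ₙ n
1ₙ≤⇒≡ {π = π} = ≤-antisym (≤-1ₙ π)

-- Enumeration of the non-crossing partitions and of those above a given one

allVecs-unique : {xs : List A} → Unique xs → ∀ n → Unique (allVecs xs n)
allVecs-unique u zero    = [] ∷ []
allVecs-unique u (suc n) =
  Unique.cartesianProductWith⁺ _∷_ (λ { refl → refl , refl }) u (allVecs-unique u n)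

∈-allVecs : {xs : List A} → (∀ x → x ∈ xs) → (v : Vec A n) → v ∈ allVecs xs n
∈-allVecs h []      = here refl
∈-allVecs h (x ∷ v) = ∈-cartesianProductWith⁺ _∷_ (h x) (∈-allVecs h v)

∈-selectNC⁺ : (π : NC n) → π ∈ selectNC (blockOf π)
∈-selectNC⁺ (nc v p) with isNC? v
... | yes _ = here refl
... | no ¬p = ⊥-elim-irr (¬p p)

∈-selectNC⁻ : {π : NC n} (v : Vec (Subset n) n) → π ∈ selectNC v → blockOf π ≡ v
∈-selectNC⁻ v π∈ with isNC? v
∈-selectNC⁻ v (here refl) | yes _ = refl

selectNC-unique : (v : Vec (Subset n) n) → Unique (selectNC v)
selectNC-unique v with isNC? v
... | yes _ = [] ∷ []
... | no  _ = []

∈-allNC : (π : NC n) → π ∈ allNC n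
∈-allNC π = ∈-concatMap⁺ selectNC (lose (∈-allVecs (∈-allVecs ∈-sides) (blockOf π)) (∈-selectNC⁺ π))
  where
  ∈-sides : ∀ b → b ∈ true ∷ false ∷ []
  ∈-sides true  = here refl
  ∈-sides false = there (here refl)

allNC-unique : ∀ n → Unique (allNC n)
allNC-unique n = concatMap-unique selectNC
  (allVecs-unique (allVecs-unique (((λ ()) ∷ []) ∷ [] ∷ []) n) n)
  (λ {v} _ → selectNC-unique v)
  λ {v} {w} _ _ π∈ π∈′ → trans (sym (∈-selectNC⁻ v π∈)) (∈-selectNC⁻ w π∈′)

above : NC n → List (NC n)
above {n} π = filter (π ≤?_) (allNC n)

∈-above⁺ : (π : NC n) {σ : NC n} → π ≤ σ → σ ∈ above π
∈-above⁺ π {σ} = ∈-filter⁺ (π ≤?_) (∈-allNC σ)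

∈-above⁻ : (π : NC n) {σ : NC n} → σ ∈ above π → π ≤ σ
∈-above⁻ π σ∈ = proj₂ (∈-filter⁻ (π ≤?_) {xs = allNC _} σ∈)

above-unique : (π : NC n) → Unique (above π)
above-unique π = Unique.filter⁺ (π ≤?_) (allNC-unique _)

-- Restriction to a subset and its iteration

element-∈ : (W : Subset n) (p : Fin ∣ W ∣) → lookup W (element W p) ≡ true
element-∈ (true  ∷ W) zero    = refl
element-∈ (true  ∷ W) (suc p) = element-∈ W p
element-∈ (false ∷ W) p       = element-∈ W p

element-surjective : (W : Subset n) {i : Fin n} → lookup W i ≡ true → ∃ λ p → element W p ≡ i
element-surjective (true  ∷ W) {zero}  i∈ = zero , refl
element-surjective (true  ∷ W) {suc i} i∈ = Product.map suc (cong suc) (element-surjective W i∈)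
element-surjective (false ∷ W) {suc i} i∈ = Product.map id (cong suc) (element-surjective W i∈)

element-injective : (W : Subset n) {p q : Fin ∣ W ∣} → element W p ≡ element W q → p ≡ q
element-injective (true  ∷ W) {zero}  {zero}  eq = refl
element-injective (true  ∷ W) {suc p} {suc q} eq = cong suc (element-injective W (Fin.suc-injective eq))
element-injective (false ∷ W)                 eq = element-injective W (Fin.suc-injective eq)

element-cancel-< : (W : Subset n) {p q : Fin ∣ W ∣} → element W p Fin.< element W q → p Fin.< q
element-cancel-< (true  ∷ W) {zero}  {suc q} _           = ℕ.z<s
element-cancel-< (true  ∷ W) {suc p} {suc q} (ℕ.s<s p<q) = ℕ.s<s (element-cancel-< W p<q)
element-cancel-< (false ∷ W)                 (ℕ.s<s p<q) = element-cancel-< W p<q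

-- The image of a subset under `element W`; it carries blocks of a restriction back to subsets of
-- `Fin n`.
embed : (W : Subset n) → Subset ∣ W ∣ → Subset n
embed []          U       = []
embed (true  ∷ W) (b ∷ U) = b ∷ embed W U
embed (false ∷ W) U       = false ∷ embed W U

lookup-embed : (W : Subset n) (U : Subset ∣ W ∣) (p : Fin ∣ W ∣) →
               lookup (embed W U) (element W p) ≡ lookup U p
lookup-embed (true  ∷ W) (b ∷ U) zero    = refl
lookup-embed (true  ∷ W) (b ∷ U) (suc p) = lookup-embed W U p
lookup-embed (false ∷ W) U       p       = lookup-embed W U p

embed-⊆ : (W : Subset n) (U : Subset ∣ W ∣) {i : Fin n} → lookup (embed W U) i ≡ true → lookup W i ≡ true
embed-⊆ (true  ∷ W) (b ∷ U) {zero}  _  = refl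
embed-⊆ (true  ∷ W) (b ∷ U) {suc i} i∈ = embed-⊆ W U i∈
embed-⊆ (false ∷ W) U       {suc i} i∈ = embed-⊆ W U i∈

embed-injective : (W : Subset n) {U V : Subset ∣ W ∣} → embed W U ≡ embed W V → U ≡ V
embed-injective W {U} {V} eq = lookup-ext λ p →
  trans (sym (lookup-embed W U p))
    (trans (cong (λ T → lookup T (element W p)) eq) (lookup-embed W V p))

∣embed∣ : (W : Subset n) (U : Subset ∣ W ∣) → ∣ embed W U ∣ ≡ ∣ U ∣
∣embed∣ []          []          = refl
∣embed∣ (true  ∷ W) (true  ∷ U) = cong suc (∣embed∣ W U)
∣embed∣ (true  ∷ W) (false ∷ U) = ∣embed∣ W U
∣embed∣ (false ∷ W) U           = ∣embed∣ W U

element-embed : (W : Subset n) (U : Subset ∣ W ∣) (p : Fin ∣ embed W U ∣) →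
                element (embed W U) p ≡ element W (element U (Fin.cast (∣embed∣ W U) p))
element-embed (true  ∷ W) (true  ∷ U) zero    = refl
element-embed (true  ∷ W) (true  ∷ U) (suc p) = cong suc (element-embed W U p)
element-embed (true  ∷ W) (false ∷ U) p       = cong suc (element-embed W U p)
element-embed (false ∷ W) U           p       = cong suc (element-embed W U p)

element-⊤ : ∀ n (p : Fin ∣ ⊤ {n} ∣) → element (⊤ {n}) p ≡ Fin.cast (∣⊤∣≡n n) p
element-⊤ (suc n) zero    = refl
element-⊤ (suc n) (suc p) = cong suc (element-⊤ n p)

rel-restrict : (π : NC n) (W : Subset n) (p q : Fin ∣ W ∣) →
               rel (restrict π W) p q ≡ rel π (element W p) (element W q)
rel-restrict (nc v _) W = lookup-matrix _

module _ (π : NC n) (W : Subset n) {p q : Fin ∣ W ∣} where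

  restrict-∼⁺ : π ⊢ element W p ∼ element W q → restrict π W ⊢ p ∼ q
  restrict-∼⁺ = trans (rel-restrict π W p q)

  restrict-∼⁻ : restrict π W ⊢ p ∼ q → π ⊢ element W p ∼ element W q
  restrict-∼⁻ = trans (sym (rel-restrict π W p q))

-- Restricting to `embed W U`, or first to `W` and then to `U`, gives partitions of sizes that agree
-- only up to a proved equality. Equality of pairs of a size and a partition expresses the
-- agreement, and every function defined on all `NC n` respects it.
pack-≡ : {α : NC m} {β : NC n} (e : m ≡ n) →
         (∀ i j → rel α i j ≡ rel β (Fin.cast e i) (Fin.cast e j)) →
         _≡_ {A = Σ ℕ NC} (m , α) (n , β)
pack-≡ {β = β} refl eq = cong (_ ,_) (NC-ext λ i j →
  trans (eq i j) (cong₂ (rel β) (Fin.cast-is-id refl i) (Fin.cast-is-id refl j)))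

restrict-embed : (π : NC n) (W : Subset n) (U : Subset ∣ W ∣) →
  _≡_ {A = Σ ℕ NC} (∣ embed W U ∣ , restrict π (embed W U)) (∣ U ∣ , restrict (restrict π W) U)
restrict-embed π W U = pack-≡ (∣embed∣ W U) λ i j →
  trans (rel-restrict π (embed W U) i j)
  (trans (cong₂ (rel π) (element-embed W U i) (element-embed W U j))
  (trans (sym (rel-restrict π W _ _)) (sym (rel-restrict (restrict π W) U _ _))))

restrict-⊤ : (π : NC n) → _≡_ {A = Σ ℕ NC} (∣ ⊤ {n} ∣ , restrict π ⊤) (n , π)
restrict-⊤ {n} π = pack-≡ (∣⊤∣≡n n) λ i j →
  trans (rel-restrict π ⊤ i j) (cong₂ (rel π) (element-⊤ n i) (element-⊤ n j))

restrict-mono : (π σ : NC n) (W : Subset n) → π ≤ σ → restrict π W ≤ restrict σ W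
restrict-mono π σ W π≤σ =
  ∼⇒≤ (restrict π W) (restrict σ W) (restrict-∼⁺ σ W ∘ ≤⇒∼ π σ π≤σ ∘ restrict-∼⁻ π W)

restrict-block : (π : NC n) {W : Subset n} → W ∈ blocks π → restrict π W ≡ 1ₙ ∣ W ∣
restrict-block π {W} W∈ = 1ₙ≤⇒≡ (∼⇒≤ (1ₙ _) (restrict π W) λ {p} {q} _ →
  restrict-∼⁺ π W (same-block π W∈ (element-∈ W p) (element-∈ W q)))

-- As `π ≤ σ`, two points related by `π` lie in a common block of `σ`, so the restriction to that
-- block sees their relation.
≤-from-restrictions : (π τ σ : NC n) → π ≤ σ →
  (∀ {W} → W ∈ blocks σ → restrict π W ≤ restrict τ W) → π ≤ τ
≤-from-restrictions π τ σ π≤σ h = ∼⇒≤ π τ λ {i} {j} i∼j →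
  let W = block σ i
      p , eqp = element-surjective W (∼-refl σ i)
      q , eqq = element-surjective W (≤⇒∼ π σ π≤σ i∼j)
  in subst₂ (τ ⊢_∼_) eqp eqq (restrict-∼⁻ τ W (≤⇒∼ (restrict π W) (restrict τ W) (h (∈-blocks⁺ σ i))
       (restrict-∼⁺ π W (subst₂ (π ⊢_∼_) (sym eqp) (sym eqq) i∼j))))

module _ (τ σ : NC n) (τ≤σ : τ ≤ σ) where

  -- Since `τ ≤ σ`, the block of `τ` through a point of `W` stays inside `W`, so restriction to `W`
  -- cuts nothing off.
  embed-block : ∀ {W} → W ∈ blocks σ → ∀ p → embed W (block (restrict τ W) p) ≡ block τ (element W p)
  embed-block {W} W∈ p = lookup-ext λ j → true-ext (to j) (from j)
    where
    U = block (restrict τ W) p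
    to : ∀ j → lookup (embed W U) j ≡ true → τ ⊢ element W p ∼ j
    to j j∈ with element-surjective W (embed-⊆ W U j∈)
    ... | q , refl = restrict-∼⁻ τ W (trans (sym (lookup-embed W U q)) j∈)
    from : ∀ j → τ ⊢ element W p ∼ j → lookup (embed W U) j ≡ true
    from j p∼j with element-surjective W (trans
        (cong (λ V → lookup V j) (∈-block⇒≡ σ W∈ (element-∈ W p))) (≤⇒∼ τ σ τ≤σ p∼j))
    ... | q , refl = trans (lookup-embed W U q) (restrict-∼⁺ τ W p∼j)

  private
    pieces : Subset n → List (Subset n)
    pieces W = map (embed W) (blocks (restrict τ W))

    ∈-pieces⁻ : ∀ {W U} → W ∈ blocks σ → U ∈ pieces W → ∃ λ p → U ≡ block τ (element W p)
    ∈-pieces⁻ {W} W∈ U∈ with ∈-map⁻ (embed W) U∈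
    ... | V , V∈ , refl with ∈-blocks⁻ (restrict τ W) V∈
    ... | p , refl = p , embed-block W∈ p

    -- A piece is a block of `τ` and so contains a point; that point lies in only one block of `σ`.
    overlapping : ∀ {V W U} → V ∈ blocks σ → W ∈ blocks σ → U ∈ pieces V → U ∈ pieces W → V ≡ W
    overlapping {V} {W} V∈ W∈ U∈V U∈W with ∈-pieces⁻ V∈ U∈V | ∈-pieces⁻ W∈ U∈W
    ... | p , refl | q , eq = trans (∈-block⇒≡ σ V∈ (element-∈ V p))
      (sym (∈-block⇒≡ σ W∈ (trans (cong (λ T → lookup T (element V p)) (∈-block⇒≡ σ W∈ (element-∈ W q)))
        (≤⇒∼ τ σ τ≤σ (trans (cong (λ T → lookup T (element V p)) (sym eq)) (∼-refl τ (element V p)))))))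

  -- The blocks of `τ` are grouped by the block of `σ` containing them. This yields both the
  -- factorisation of products over blocks and the additivity of block counts.
  blocks-decomposition :
    blocks τ ↭ concatMap (λ W → map (embed W) (blocks (restrict τ W))) (blocks σ)
  blocks-decomposition = unique-sets⇒↭ (blocks-unique τ)
    (concatMap-unique pieces (blocks-unique σ)
      (λ {W} _ → Unique.map⁺ (embed-injective W) (blocks-unique (restrict τ W))) overlapping)
    to from
    where
    to : ∀ {U} → U ∈ blocks τ → U ∈ concatMap pieces (blocks σ)
    to U∈ with ∈-blocks⁻ τ U∈
    ... | i , refl with element-surjective (block σ i) (∼-refl σ i)
    ... | p , eq = ∈-concatMap⁺ pieces (lose (∈-blocks⁺ σ i)
      (subst (_∈ pieces (block σ i)) (trans (embed-block (∈-blocks⁺ σ i) p) (cong (block τ) eq))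
        (∈-map⁺ (embed (block σ i)) (∈-blocks⁺ (restrict τ (block σ i)) p))))
    from : ∀ {U} → U ∈ concatMap pieces (blocks σ) → U ∈ blocks τ
    from U∈ with find (∈-concatMap⁻ pieces U∈)
    ... | W , W∈ , U∈W with ∈-pieces⁻ W∈ U∈W
    ... | p , refl = ∈-blocks⁺ τ (element W p)

-- Choice functions on a list

module _ {B : A → Set} (L : ∀ x → List (B x)) where

  -- These index the terms of an expanded product of sums. The type `B x` may vary with `x`, as
  -- `NC ∣ W ∣` does with the block `W`.
  choices : ∀ xs → List (All B xs)
  choices []       = [ [] ]
  choices (x ∷ xs) = cartesianProductWith _∷_ (L x) (choices xs)

  choices-unique : (∀ x → Unique (L x)) → ∀ xs → Unique (choices xs)
  choices-unique u []       = [] ∷ []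
  choices-unique u (x ∷ xs) =
    Unique.cartesianProductWith⁺ _∷_ (λ { refl → refl , refl }) (u x) (choices-unique u xs)

  ∈-choices⁺ : ∀ {xs} (ρ : All B xs) → (∀ {x} (x∈ : x ∈ xs) → All.lookup ρ x∈ ∈ L x) → ρ ∈ choices xs
  ∈-choices⁺ []      h = here refl
  ∈-choices⁺ (b ∷ ρ) h = ∈-cartesianProductWith⁺ _∷_ (h (here refl)) (∈-choices⁺ ρ (h ∘ there))

  ∈-choices⁻ : ∀ {xs} {ρ : All B xs} → ρ ∈ choices xs → ∀ {x} (x∈ : x ∈ xs) → All.lookup ρ x∈ ∈ L x
  ∈-choices⁻ {y ∷ xs} ρ∈ x∈ with ∈-cartesianProductWith⁻ _∷_ (L y) (choices xs) ρ∈
  ∈-choices⁻ {y ∷ xs} ρ∈ (here refl) | b , ρ , b∈ , ρ∈′ , refl = b∈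
  ∈-choices⁻ {y ∷ xs} ρ∈ (there x∈)  | b , ρ , b∈ , ρ∈′ , refl = ∈-choices⁻ ρ∈′ x∈

lookup-universal : {P : A → Set} (f : ∀ x → P x) {xs : List A} {x : A} (x∈ : x ∈ xs) →
                   All.lookup (All.universal f xs) x∈ ≡ f x
lookup-universal f (here refl) = refl
lookup-universal f (there x∈)  = lookup-universal f x∈

universal≡ : {P : A → Set} (f : ∀ x → P x) {xs : List A} (ρ : All P xs) →
             (∀ {x} (x∈ : x ∈ xs) → f x ≡ All.lookup ρ x∈) → All.universal f xs ≡ ρ
universal≡ f []      h = refl
universal≡ f (b ∷ ρ) h = cong₂ _∷_ (h (here refl)) (universal≡ f ρ (h ∘ there))

isNC-matrix : {r : Fin n → Fin n → Bool} →
              (∀ i → r i i ≡ true) →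
              (∀ {i j} → r i j ≡ true → r j i ≡ true) →
              (∀ {i j k} → r i j ≡ true → r j k ≡ true → r i k ≡ true) →
              (∀ {i j k l} → i Fin.< j → j Fin.< k → k Fin.< l →
                r i k ≡ true → r j l ≡ true → r i j ≡ true) → IsNC (matrix r)
isNC-matrix {r = r} r-refl r-sym r-trans r-noncrossing = record
  { isEquivalence = record
    { refl  = back (r-refl _)
    ; sym   = λ p → back (r-sym (forth p))
    ; trans = λ p q → back (r-trans (forth p) (forth q)) }
  ; noncrossing = λ _ _ _ _ i<j j<k k<l p q → back (r-noncrossing i<j j<k k<l (forth p) (forth q)) }
  where
  back : ∀ {i j} → r i j ≡ true → Related (matrix r) i j
  back {i} {j} p = Vec.lookup⇒[]= j _ (trans (lookup-matrix r i j) p)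
  forth : ∀ {i j} → Related (matrix r) i j → r i j ≡ true
  forth {i} {j} p = trans (sym (lookup-matrix r i j)) (Vec.[]=⇒lookup p)

-- Gluing partitions of the blocks of a non-crossing partition

record Local (W : Subset n) (ρ : NC ∣ W ∣) (i j : Fin n) : Set where
  constructor local
  field
    {p q} : Fin ∣ W ∣
    p↦i   : element W p ≡ i
    q↦j   : element W q ≡ j
    p∼q   : ρ ⊢ p ∼ q

local? : (W : Subset n) (ρ : NC ∣ W ∣) (i j : Fin n) → Dec (Local W ρ i j)
local? W ρ i j = map′ (λ (p , q , a , b , c) → local {p = p} {q} a b c)
  (λ (local {p} {q} a b c) → p , q , a , b , c)
  (Fin.any? λ p → Fin.any? λ q → (element W p Fin.≟ i) ×-dec (element W q Fin.≟ j)
    ×-dec (rel ρ p q Bool.≟ true))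

Glued : {Ws : List (Subset n)} → All (λ W → NC ∣ W ∣) Ws → Fin n → Fin n → Set
Glued []      i j = ⊥
Glued (_∷_ {x = W} ρ ρs) i j = Local W ρ i j ⊎ Glued ρs i j

glued? : {Ws : List (Subset n)} (ρs : All (λ W → NC ∣ W ∣) Ws) (i j : Fin n) → Dec (Glued ρs i j)
glued? []       i j = no id
glued? (_∷_ {x = W} ρ ρs) i j = local? W ρ i j ⊎-dec glued? ρs i j

glued⁺ : {Ws : List (Subset n)} (ρs : All (λ W → NC ∣ W ∣) Ws) {W : Subset n} (W∈ : W ∈ Ws) {i j : Fin n} →
         Local W (All.lookup ρs W∈) i j → Glued ρs i j
glued⁺ (ρ ∷ ρs) (here refl) l = inj₁ l
glued⁺ (ρ ∷ ρs) (there W∈)  l = inj₂ (glued⁺ ρs W∈ l)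

glued⁻ : {Ws : List (Subset n)} (ρs : All (λ W → NC ∣ W ∣) Ws) {i j : Fin n} → Glued ρs i j →
         ∃ λ W → Σ (W ∈ Ws) λ W∈ → Local W (All.lookup ρs W∈) i j
glued⁻ (ρ ∷ ρs) (inj₁ l) = _ , here refl , l
glued⁻ (ρ ∷ ρs) (inj₂ g) = let W , W∈ , l = glued⁻ ρs g in W , there W∈ , l

module Glue (σ : NC n) (ρs : All (λ W → NC ∣ W ∣) (blocks σ)) where
  private
    r : Fin n → Fin n → Bool
    r i j = does (glued? ρs i j)

    r⁺ : ∀ {i j} → Glued ρs i j → r i j ≡ true
    r⁺ {i} {j} = dec-true (glued? ρs i j)

    r⁻ : ∀ {i j} → r i j ≡ true → Glued ρs i j
    r⁻ {i} {j} eq with yes g ← glued? ρs i j = g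

    -- A pair glued through some block is glued through every block of σ
    -- that contains one of its points, since that block is unique.
    at : ∀ {W} (W∈ : W ∈ blocks σ) {p j} → Glued ρs (element W p) j →
         ∃ λ q → element W q ≡ j × (All.lookup ρs W∈ ⊢ p ∼ q)
    at {W} W∈ {p} g with glued⁻ ρs g
    ... | V , V∈ , local {p′} {q′} eqp eqq p∼q
      with trans (∈-block⇒≡ σ V∈ (element-∈ V p′))
             (trans (cong (block σ) eqp) (sym (∈-block⇒≡ σ W∈ (element-∈ W p))))
    -- The member of `ρs` is looked up by a membership proof, so equality of the two blocks is not
    -- enough. As the blocks are listed without repetition, the two membership proofs agree as well.
    ... | refl with unique⇒irrelevant (blocks-unique σ) V∈ W∈ | element-injective W eqp
    ... | refl | refl = q′ , eqq , p∼q

    reflexive : ∀ i → Glued ρs i i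
    reflexive i = let p , eq = element-surjective (block σ i) (∼-refl σ i)
                  in glued⁺ ρs (∈-blocks⁺ σ i) (local eq eq (∼-refl (All.lookup ρs (∈-blocks⁺ σ i)) p))

    symmetric : ∀ {i j} → Glued ρs i j → Glued ρs j i
    symmetric g = let W , W∈ , local eqp eqq p∼q = glued⁻ ρs g
                  in glued⁺ ρs W∈ (local eqq eqp (∼-sym (All.lookup ρs W∈) p∼q))

    transitive : ∀ {i j k} → Glued ρs i j → Glued ρs j k → Glued ρs i k
    transitive g h with glued⁻ ρs g
    ... | W , W∈ , local eqp refl p∼q with at W∈ h
    ... | _ , eq , q∼s = glued⁺ ρs W∈ (local eqp eq (∼-trans (All.lookup ρs W∈) p∼q q∼s))

    ⊆σ : ∀ {i j} → Glued ρs i j → σ ⊢ i ∼ j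
    ⊆σ g with glued⁻ ρs g
    ... | W , W∈ , local {p} {q} refl refl _ = same-block σ W∈ (element-∈ W p) (element-∈ W q)

    -- The two crossing pairs are also related by `σ`, which therefore puts all four points into a
    -- single block. Inside that block only one member of `ρs` is involved, and it is non-crossing;
    -- `element` preserves and reflects the order.
    noncrossing : ∀ {i j k l} → i Fin.< j → j Fin.< k → k Fin.< l →
                  Glued ρs i k → Glued ρs j l → Glued ρs i j
    noncrossing {i} {j} i<j j<k k<l g h with glued⁻ ρs g
    ... | W , W∈ , local {p} refl refl p∼q
      with element-surjective W (trans (cong (λ V → lookup V j) (∈-block⇒≡ σ W∈ (element-∈ W p)))
             (∼-noncrossing σ i<j j<k k<l (⊆σ g) (⊆σ h)))
    ... | s , refl with at W∈ h
    ... | t , refl , s∼t = glued⁺ ρs W∈ (local refl refl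
      (∼-noncrossing (All.lookup ρs W∈) (element-cancel-< W i<j) (element-cancel-< W j<k)
         (element-cancel-< W k<l) p∼q s∼t))

  glue : NC n
  glue = nc (matrix r) (isNC-matrix (λ i → r⁺ (reflexive i)) (λ g → r⁺ (symmetric (r⁻ g)))
    (λ g h → r⁺ (transitive (r⁻ g) (r⁻ h)))
    (λ i<j j<k k<l g h → r⁺ (noncrossing i<j j<k k<l (r⁻ g) (r⁻ h))))

  private
    glue⁺ : ∀ {i j} → Glued ρs i j → glue ⊢ i ∼ j
    glue⁺ {i} {j} g = trans (lookup-matrix r i j) (r⁺ g)

    glue⁻ : ∀ {i j} → glue ⊢ i ∼ j → Glued ρs i j
    glue⁻ {i} {j} eq = r⁻ (trans (sym (lookup-matrix r i j)) eq)

  glue≤ : glue ≤ σ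
  glue≤ = ∼⇒≤ glue σ (⊆σ ∘ glue⁻)

  restrict-glue : ∀ {W} (W∈ : W ∈ blocks σ) → restrict glue W ≡ All.lookup ρs W∈
  restrict-glue {W} W∈ = NC-ext λ p q → true-ext (to p q)
    λ p∼q → restrict-∼⁺ glue W (glue⁺ (glued⁺ ρs W∈ (local refl refl p∼q)))
    where
    to : ∀ p q → restrict glue W ⊢ p ∼ q → All.lookup ρs W∈ ⊢ p ∼ q
    to p q g with at W∈ (glue⁻ (restrict-∼⁻ glue W g))
    ... | q′ , eq , p∼q with element-injective W eq
    ... | refl = p∼q

-- Intervals as products

interval : NC n → NC n → List (NC n)
interval π σ = filter (λ τ → (π ≤? τ) ×-dec (τ ≤? σ)) (allNC _)

∈-interval⁻ : (π σ : NC n) {τ : NC n} → τ ∈ interval π σ → (π ≤ τ) × (τ ≤ σ)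
∈-interval⁻ π σ τ∈ = proj₂ (∈-filter⁻ (λ τ → (π ≤? τ) ×-dec (τ ≤? σ)) {xs = allNC _} τ∈)

restrictions : NC n → (σ : NC n) → All (λ W → NC ∣ W ∣) (blocks σ)
restrictions τ σ = All.universal (restrict τ) (blocks σ)

-- [π, σ] is the product of the intervals [π_W, 1] over the blocks W of σ.
interval-factorisation : (π σ : NC n) → π ≤ σ →
  map (λ τ → restrictions τ σ) (interval π σ) ↭ choices (λ W → above (restrict π W)) (blocks σ)
interval-factorisation π σ π≤σ = unique-sets⇒↭
  (map-unique _ (Unique.filter⁺ (λ τ → (π ≤? τ) ×-dec (τ ≤? σ)) (allNC-unique _)) λ {τ} {τ′} τ∈ τ′∈ eq →
    ≤-antisym (determines τ τ′ τ∈ eq) (determines τ′ τ τ′∈ (sym eq)))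
  (choices-unique L (λ W → above-unique (restrict π W)) (blocks σ)) to from
  where
  L : ∀ W → List (NC ∣ W ∣)
  L W = above (restrict π W)
  determines : ∀ τ τ′ → τ ∈ interval π σ → restrictions τ σ ≡ restrictions τ′ σ → τ ≤ τ′
  determines τ τ′ τ∈ eq = ≤-from-restrictions τ τ′ σ (proj₂ (∈-interval⁻ π σ τ∈))
    λ {W} W∈ → subst (restrict τ W ≤_)
      (trans (sym (lookup-universal (restrict τ) W∈))
        (trans (cong (λ ρs → All.lookup ρs W∈) eq) (lookup-universal (restrict τ′) W∈)))
      (≤-refl (restrict τ W))
  to : ∀ {ρs} → ρs ∈ map (λ τ → restrictions τ σ) (interval π σ) → ρs ∈ choices L (blocks σ)
  to ρs∈ with ∈-map⁻ (λ τ → restrictions τ σ) ρs∈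
  ... | τ , τ∈ , refl = ∈-choices⁺ L (restrictions τ σ) λ {W} W∈ →
    subst (_∈ L W) (sym (lookup-universal (restrict τ) W∈))
      (∈-above⁺ (restrict π W) (restrict-mono π τ W
        (proj₁ (∈-interval⁻ π σ τ∈))))
  -- The preimage of a family is its gluing. It lies above `π` because it does so on every block of
  -- `σ`.
  from : ∀ {ρs} → ρs ∈ choices L (blocks σ) → ρs ∈ map (λ τ → restrictions τ σ) (interval π σ)
  from {ρs} ρs∈ = subst (_∈ map (λ τ → restrictions τ σ) (interval π σ))
    (universal≡ (restrict glue) ρs restrict-glue)
    (∈-map⁺ (λ τ → restrictions τ σ)
      (∈-filter⁺ (λ τ → (π ≤? τ) ×-dec (τ ≤? σ)) (∈-allNC glue) (π≤glue , glue≤)))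
    where
    open Glue σ ρs
    π≤glue : π ≤ glue
    π≤glue = ≤-from-restrictions π glue σ π≤σ λ {W} W∈ →
      subst (restrict π W ≤_) (sym (restrict-glue W∈)) (∈-above⁻ (restrict π W) (∈-choices⁻ L ρs∈ W∈))

-- The size is a successor because `1ₙ 0` has no blocks at all.
blocks-1ₙ : ∀ n → blocks (1ₙ (suc n)) ↭ [ ⊤ ]
blocks-1ₙ n = unique-sets⇒↭ (blocks-unique (1ₙ (suc n))) ([] ∷ []) to from
  where
  block≡⊤ : ∀ i → block (1ₙ (suc n)) i ≡ ⊤
  block≡⊤ i = Vec.lookup-replicate {n = suc n} i ⊤
  to : ∀ {W} → W ∈ blocks (1ₙ (suc n)) → W ∈ [ ⊤ ]
  to W∈ with ∈-blocks⁻ (1ₙ (suc n)) W∈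
  ... | i , eq = here (trans eq (block≡⊤ i))
  from : ∀ {W} → W ∈ [ ⊤ ] → W ∈ blocks (1ₙ (suc n))
  from (here refl) = ∈-blocks⁺ (1ₙ (suc n)) zero

-- A block with `n` elements is everything, and then any two points are related. This bound makes
-- the recursion for convolution inverses descend.
∣block∣<n : (σ : NC n) → σ ≢ 1ₙ n → ∀ {W} → W ∈ blocks σ → ∣ W ∣ ℕ.< n
∣block∣<n {n} σ σ≢1 {W} W∈ = ℕ.≤∧≢⇒< (∣p∣≤n W) λ ∣W∣≡n →
  σ≢1 (1ₙ≤⇒≡ (∼⇒≤ (1ₙ n) σ λ {i} {j} _ → same-block σ W∈ (∈W (∣p∣≡n⇒p≡⊤ ∣W∣≡n) i) (∈W (∣p∣≡n⇒p≡⊤ ∣W∣≡n) j)))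
  where
  ∈W : W ≡ ⊤ → ∀ i → lookup W i ≡ true
  ∈W refl i = Vec.lookup-replicate i true

NC-0 : (π : NC 0) → π ≡ 1ₙ 0
NC-0 π = NC-ext λ ()

-- If all restrictions of `π` to blocks of `σ` were trivial, then `σ ≤ π` would follow. Decidability
-- of equality turns the failure into an explicit block. The counit vanishes on the corresponding
-- factor.
finer⇒nontrivial : (π σ : NC n) → π ≤ σ → σ ≢ π → ∃ λ W → W ∈ blocks σ × restrict π W ≢ 1ₙ ∣ W ∣
finer⇒nontrivial π σ π≤σ σ≢π with All.all? (λ W → restrict π W ≟ 1ₙ ∣ W ∣) (blocks σ)
... | yes h = ⊥-elim (σ≢π (≤-antisym (≤-from-restrictions σ π σ (≤-refl σ) λ {W} W∈ →
                subst (restrict σ W ≤_) (sym (All.lookup h W∈)) (≤-1ₙ (restrict σ W))) π≤σ))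
... | no ¬h = find (All.¬All⇒Any¬ (λ W → restrict π W ≟ 1ₙ ∣ W ∣) (blocks σ) ¬h)

-- Counting blocks, and degrees

blocks-nonempty : (π : NC n) → Fin n → 1 ℕ.≤ #blocks π
blocks-nonempty π i with blocks π | ∈-blocks⁺ π i
... | _ ∷ _ | _ = ℕ.s≤s ℕ.z≤n

block-inhabited : (σ : NC n) {W : Subset n} → W ∈ blocks σ → Fin ∣ W ∣
block-inhabited σ {W} W∈ with ∈-blocks⁻ σ W∈
... | i , refl = proj₁ (element-surjective W (∼-refl σ i))

-- With at most one block any two points are related, so `π` is the top partition; the case without
-- blocks is that of no points. As a consequence every generator has positive degree.
2≤#blocks : (π : NC n) → π ≢ 1ₙ n → 2 ℕ.≤ #blocks π
2≤#blocks {n} π π≢1 with blocks π | ∈-blocks⁺ π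
... | []        | h = ⊥-elim (π≢1 (NC-ext λ i → ⊥-elim (case h i of λ ())))
... | W ∷ []    | h = ⊥-elim (π≢1 (1ₙ≤⇒≡ (∼⇒≤ (1ₙ n) π λ {i} {j} _ →
    trans (cong (λ V → lookup V j) (trans (only (h i)) (sym (only (h j))))) (∼-refl π j))))
  where
  only : ∀ {V} → V ∈ W ∷ [] → V ≡ W
  only (here eq) = eq
... | _ ∷ _ ∷ _ | h = ℕ.s≤s (ℕ.s≤s ℕ.z≤n)

#blocks-sum : (π σ : NC n) → π ≤ σ → #blocks π ≡ ℕ-sum (map (λ W → #blocks (restrict π W)) (blocks σ))
#blocks-sum π σ π≤σ = trans (↭-length (blocks-decomposition π σ π≤σ)) (go (blocks σ))
  where
  go : ∀ Ws → length (concatMap (λ W → map (embed W) (blocks (restrict π W))) Ws) ≡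
              ℕ-sum (map (λ W → #blocks (restrict π W)) Ws)
  go []       = refl
  go (W ∷ Ws) = trans (List.length-++ (map (embed W) (blocks (restrict π W))))
    (cong₂ ℕ._+_ (List.length-map (embed W) (blocks (restrict π W))) (go Ws))

-- The truncation matters only for the empty partition, which has no blocks; it gets degree 0, in
-- agreement with `X (1ₙ 0)` being 1.
degree : NC n → ℕ
degree π = #blocks π ℕ.∸ 1

-- Summing |π_W| - 1 over the blocks `W` of `σ` gives |π| - |σ|, and adding |σ| - 1 leaves |π| - 1.
-- For positive size all counts involved are positive, so the truncated subtractions are exact. This
-- is why `Δ` preserves degrees.
degree-sum : (π σ : NC n) → π ≤ σ →
             ℕ-sum (map (λ W → degree (restrict π W)) (blocks σ)) ℕ.+ degree σ ≡ degree π
degree-sum {zero}  (nc [] _) (nc [] _) π≤σ = refl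
degree-sum {suc _} π σ π≤σ = ℕ.suc-injective (begin
  suc (ℕ-sum (map (degree ∘ restrict π) (blocks σ)) ℕ.+ degree σ)
    ≡⟨ ℕ.+-suc (ℕ-sum (map (degree ∘ restrict π) (blocks σ))) (degree σ) ⟨
  ℕ-sum (map (degree ∘ restrict π) (blocks σ)) ℕ.+ suc (degree σ)
    ≡⟨ cong (ℕ-sum (map (degree ∘ restrict π) (blocks σ)) ℕ.+_) (ℕ.m+[n∸m]≡n (blocks-nonempty σ zero)) ⟩
  ℕ-sum (map (degree ∘ restrict π) (blocks σ)) ℕ.+ #blocks σ
    ≡⟨ go (blocks σ) id ⟨
  ℕ-sum (map (#blocks ∘ restrict π) (blocks σ))
    ≡⟨ #blocks-sum π σ π≤σ ⟨
  #blocks π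
    ≡⟨ ℕ.m+[n∸m]≡n (blocks-nonempty π zero) ⟨
  suc (degree π) ∎)
  where
  open ≡-Reasoning
  go : ∀ Ws → (∀ {W} → W ∈ Ws → W ∈ blocks σ) →
       ℕ-sum (map (#blocks ∘ restrict π) Ws) ≡ ℕ-sum (map (degree ∘ restrict π) Ws) ℕ.+ length Ws
  go []       h = refl
  go (W ∷ Ws) h = begin
    #blocks (restrict π W) ℕ.+ ℕ-sum (map (#blocks ∘ restrict π) Ws)
      ≡⟨ cong₂ ℕ._+_
           (sym (ℕ.m∸n+n≡m (blocks-nonempty (restrict π W) (block-inhabited σ (h (here refl))))))
           (go Ws (h ∘ there)) ⟩
    (degree (restrict π W) ℕ.+ 1) ℕ.+ (ℕ-sum (map (degree ∘ restrict π) Ws) ℕ.+ length Ws)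
      ≡⟨ ℕ-interchange (degree (restrict π W)) 1 _ (length Ws) ⟩
    (degree (restrict π W) ℕ.+ ℕ-sum (map (degree ∘ restrict π) Ws)) ℕ.+ suc (length Ws) ∎

degree-1ₙ : ∀ n → degree (1ₙ n) ≡ 0
degree-1ₙ zero    = refl
degree-1ₙ (suc n) = cong (ℕ._∸ 1) (↭-length (blocks-1ₙ n))

-- Sums over lists

module Sum (M : CommutativeMonoid 0ℓ 0ℓ) where
  open CommutativeMonoid M renaming (ε to 𝟘; assoc to ∙-assoc; refl to refl′; sym to sym′; trans to trans′)
  open Relation.Binary.Reasoning.Setoid setoid
  open Algebra.Properties.CommutativeSemigroup commutativeSemigroup using (interchange; x∙yz≈y∙xz)

  ∑ : List A → (A → Carrier) → Carrier
  ∑ xs f = foldr _∙_ 𝟘 (map f xs)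

  ∑-cong : ∀ {xs : List A} {f g} → (∀ {x} → x ∈ xs → f x ≈ g x) → ∑ xs f ≈ ∑ xs g
  ∑-cong {xs = []}     h = refl′
  ∑-cong {xs = x ∷ xs} h = ∙-cong (h (here refl)) (∑-cong (h ∘ there))

  ∑-ε : ∀ (xs : List A) → ∑ xs (λ _ → 𝟘) ≈ 𝟘
  ∑-ε []       = refl′
  ∑-ε (x ∷ xs) = trans′ (identityˡ _) (∑-ε xs)

  ∑-zero : ∀ {xs : List A} {f} → (∀ {x} → x ∈ xs → f x ≈ 𝟘) → ∑ xs f ≈ 𝟘
  ∑-zero {xs = xs} h = trans′ (∑-cong h) (∑-ε xs)

  ∑-∙ : ∀ (xs : List A) {f g : A → Carrier} → ∑ xs (λ x → f x ∙ g x) ≈ ∑ xs f ∙ ∑ xs g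
  ∑-∙ []       = sym′ (identityˡ 𝟘)
  ∑-∙ (x ∷ xs) = trans′ (∙-congˡ (∑-∙ xs)) (interchange _ _ _ _)

  ∑-++ : ∀ (xs {ys} : List A) {f : A → Carrier} → ∑ (xs ++ ys) f ≈ ∑ xs f ∙ ∑ ys f
  ∑-++ []       = sym′ (identityˡ _)
  ∑-++ (x ∷ xs) = trans′ (∙-congˡ (∑-++ xs)) (sym′ (∙-assoc _ _ _))

  ∑-map : ∀ (xs : List A) {g : A → B} {f : B → Carrier} → ∑ (map g xs) f ≈ ∑ xs (f ∘ g)
  ∑-map []       = refl′
  ∑-map (x ∷ xs) = ∙-congˡ (∑-map xs)

  ∑-concatMap : ∀ (xs : List A) {g : A → List B} {f : B → Carrier} →
                ∑ (concatMap g xs) f ≈ ∑ xs (λ x → ∑ (g x) f)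
  ∑-concatMap []               = refl′
  ∑-concatMap (x ∷ xs) {g = g} = trans′ (∑-++ (g x)) (∙-congˡ (∑-concatMap xs))

  ∑-product : ∀ {C : Set} (xs : List A) (ys : List B) {g : A → B → C} {f : C → Carrier} →
              ∑ (cartesianProductWith g xs ys) f ≈ ∑ xs (λ x → ∑ ys (λ y → f (g x y)))
  ∑-product []       ys         = refl′
  ∑-product (x ∷ xs) ys {g = g} = trans′ (∑-++ (map (g x) ys)) (∙-cong (∑-map ys) (∑-product xs ys))

  ∑-comm : ∀ (xs : List A) (ys : List B) {f : A → B → Carrier} →
           ∑ xs (λ x → ∑ ys (f x)) ≈ ∑ ys (λ y → ∑ xs (λ x → f x y))
  ∑-comm []       ys = sym′ (∑-ε ys)
  ∑-comm (x ∷ xs) ys = trans′ (∙-congˡ (∑-comm xs ys)) (sym′ (∑-∙ ys))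

  ∑-↭ : ∀ {xs ys : List A} {f : A → Carrier} → xs ↭ ys → ∑ xs f ≈ ∑ ys f
  ∑-↭ Perm.refl         = refl′
  ∑-↭ (Perm.prep x p)   = ∙-congˡ (∑-↭ p)
  ∑-↭ (Perm.swap x y p) = trans′ (x∙yz≈y∙xz _ _ _) (∙-congˡ (∙-congˡ (∑-↭ p)))
  ∑-↭ (Perm.trans p q)  = trans′ (∑-↭ p) (∑-↭ q)

  module _ {P : A → Set} (P? : Decidable P) where

    ∑-filter : ∀ (xs : List A) {f : A → Carrier} →
               ∑ (filter P? xs) f ≈ ∑ xs (λ x → if does (P? x) then f x else 𝟘)
    ∑-filter []       = refl′
    ∑-filter (x ∷ xs) with does (P? x)
    ... | true  = ∙-congˡ (∑-filter xs)
    ... | false = trans′ (∑-filter xs) (sym′ (identityˡ _))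

  private
    ∑-if : ∀ b (xs : List A) {f : A → Carrier} →
           (if b then ∑ xs f else 𝟘) ≈ ∑ xs (λ x → if b then f x else 𝟘)
    ∑-if true  xs = refl′
    ∑-if false xs = sym′ (∑-ε xs)

    if-if : ∀ {P Q R S : Set} (P? : Dec P) (Q? : Dec Q) (R? : Dec R) (S? : Dec S) {x : Carrier} →
            (P → Q → R × S) → (R → S → P × Q) →
            (if does P? then (if does Q? then x else 𝟘) else 𝟘) ≈
            (if does R? then (if does S? then x else 𝟘) else 𝟘)
    if-if (yes p) (yes q) R? S? f g =
      sym′ (if-yes R? (proj₁ (f p q)) (if-yes S? (proj₂ (f p q)) refl′))
      where
      if-yes : ∀ {T : Set} (T? : Dec T) {x y : Carrier} → T → x ≈ y → (if does T? then x else 𝟘) ≈ y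
      if-yes (yes _) t e = e
      if-yes (no ¬t) t e = contradiction t ¬t
    if-if (yes p) (no ¬q) (yes r) (yes s) f g = contradiction (proj₂ (g r s)) ¬q
    if-if (no ¬p) Q?      (yes r) (yes s) f g = contradiction (proj₁ (g r s)) ¬p
    if-if (yes p) (no ¬q) (no ¬r) S?      f g = refl′
    if-if (yes p) (no ¬q) (yes r) (no ¬s) f g = refl′
    if-if (no ¬p) Q?      (no ¬r) S?      f g = refl′
    if-if (no ¬p) Q?      (yes r) (no ¬s) f g = refl′

  -- Both sides become sums over all pairs of terms multiplied by an indicator, and the two
  -- hypotheses say that the indicators agree. It serves to exchange summations whose ranges depend
  -- on each other.
  ∑-filter-comm : ∀ (xs : List A) (ys : List B)
    {P : A → Set} {Q : A → B → Set} {R : B → Set} {S : B → A → Set}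
    (P? : Decidable P) (Q? : ∀ x → Decidable (Q x)) (R? : Decidable R) (S? : ∀ y → Decidable (S y))
    {f : A → B → Carrier} →
    (∀ x y → P x → Q x y → R y × S y x) → (∀ x y → R y → S y x → P x × Q x y) →
    ∑ (filter P? xs) (λ x → ∑ (filter (Q? x) ys) (f x)) ≈
    ∑ (filter R? ys) (λ y → ∑ (filter (S? y) xs) (λ x → f x y))
  ∑-filter-comm xs ys P? Q? R? S? {f} to from = begin
    ∑ (filter P? xs) (λ x → ∑ (filter (Q? x) ys) (f x))
      ≈⟨ expand xs ys P? Q? ⟩
    ∑ xs (λ x → ∑ ys λ y → if does (P? x) then (if does (Q? x y) then f x y else 𝟘) else 𝟘)
      ≈⟨ ∑-comm xs ys ⟩
    ∑ ys (λ y → ∑ xs λ x → if does (P? x) then (if does (Q? x y) then f x y else 𝟘) else 𝟘)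
      ≈⟨ ∑-cong {xs = ys} (λ {y} _ → ∑-cong {xs = xs} λ {x} _ →
           if-if (P? x) (Q? x y) (R? y) (S? y x) (to x y) (from x y)) ⟩
    ∑ ys (λ y → ∑ xs λ x → if does (R? y) then (if does (S? y x) then f x y else 𝟘) else 𝟘)
      ≈⟨ expand ys xs R? S? ⟨
    ∑ (filter R? ys) (λ y → ∑ (filter (S? y) xs) (λ x → f x y)) ∎
    where
    expand : ∀ {A B : Set} (xs : List A) (ys : List B) {P : A → Set} {Q : A → B → Set}
      (P? : Decidable P) (Q? : ∀ x → Decidable (Q x)) {f : A → B → Carrier} →
      ∑ (filter P? xs) (λ x → ∑ (filter (Q? x) ys) (f x)) ≈
      ∑ xs (λ x → ∑ ys λ y → if does (P? x) then (if does (Q? x y) then f x y else 𝟘) else 𝟘)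
    expand xs ys P? Q? = trans′ (∑-filter P? xs) (∑-cong {xs = xs} λ {x} _ →
      trans′ (≈-if (does (P? x)) (∑-filter (Q? x) ys)) (∑-if (does (P? x)) ys))
      where
      ≈-if : ∀ b {x y : Carrier} → x ≈ y → (if b then x else 𝟘) ≈ (if b then y else 𝟘)
      ≈-if true  e = e
      ≈-if false e = refl′

  module _ (_≟_ : DecidableEquality A) where

    ∑-remove : ∀ {xs : List A} {x} {f : A → Carrier} → Unique xs → x ∈ xs →
               ∑ xs f ≈ f x ∙ ∑ (filter (λ y → ¬? (y ≟ x)) xs) f
    ∑-remove {xs} {x} u x∈ = ∑-↭ (unique-sets⇒↭ u
      (All.tabulate (λ y∈ x≡y → proj₂ (∈-filter⁻ ≢x? {xs = xs} y∈) (≡.sym x≡y)) ∷ Unique.filter⁺ ≢x? u)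
      to from)
      where
      ≢x? = λ y → ¬? (y ≟ x)
      to : ∀ {y} → y ∈ xs → y ∈ x ∷ filter ≢x? xs
      to {y} y∈ with y ≟ x
      ... | yes y≡x = here y≡x
      ... | no  y≢x = there (∈-filter⁺ ≢x? y∈ y≢x)
      from : ∀ {y} → y ∈ x ∷ filter ≢x? xs → y ∈ xs
      from (here refl) = x∈
      from (there y∈)  = proj₁ (∈-filter⁻ ≢x? {xs = xs} y∈)

    ∑-single : ∀ {xs : List A} {x} {f : A → Carrier} → Unique xs → x ∈ xs →
               (∀ {y} → y ∈ xs → y ≢ x → f y ≈ 𝟘) → ∑ xs f ≈ f x
    ∑-single {xs} {x} u x∈ h = trans′ (∑-remove u x∈) (trans′
      (∙-congˡ (∑-zero λ y∈ → let y∈′ , y≢x = ∈-filter⁻ (λ y → ¬? (y ≟ x)) {xs = xs} y∈ in h y∈′ y≢x))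
      (identityʳ _))

module _ (K : CommutativeRing 0ℓ 0ℓ) where
  private
    module K = CommutativeRing K

  -- Commutative algebras

  record IsCommutativeAlgebra (A : RawAlgebra K.Carrier 0ℓ 0ℓ) : Set where
    open RawAlgebra A
    field
      isEquivalence : IsEquivalence _≈_
      +-cong        : ∀ {x x′ y y′} → x ≈ x′ → y ≈ y′ → x + y ≈ x′ + y′
      +-assoc       : ∀ x y z → (x + y) + z ≈ x + (y + z)
      +-comm        : ∀ x y → x + y ≈ y + x
      +-identityˡ   : ∀ x → 0# + x ≈ x
      -‿cong        : ∀ {x x′} → x ≈ x′ → - x ≈ - x′
      -‿inverseˡ    : ∀ x → - x + x ≈ 0#
      *-cong        : ∀ {x x′ y y′} → x ≈ x′ → y ≈ y′ → x * y ≈ x′ * y′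
      *-assoc       : ∀ x y z → (x * y) * z ≈ x * (y * z)
      *-comm        : ∀ x y → x * y ≈ y * x
      *-identityˡ   : ∀ x → 1# * x ≈ x
      distribʳ      : ∀ x y z → (y + z) * x ≈ y * x + z * x
      ·-cong        : ∀ {k l x y} → k K.≈ l → x ≈ y → k · x ≈ l · y
      ·-distribˡ    : ∀ k x y → k · (x + y) ≈ k · x + k · y
      ·-distribʳ    : ∀ x k l → (k K.+ l) · x ≈ k · x + l · x
      ·-assoc       : ∀ k l x → (k K.* l) · x ≈ k · (l · x)
      ·-identityˡ   : ∀ x → K.1# · x ≈ x
      ·-*-assocˡ    : ∀ k x y → k · (x * y) ≈ (k · x) * y

    open IsEquivalence isEquivalence using () renaming (trans to _⨾_)

    commutativeRing : CommutativeRing 0ℓ 0ℓ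
    commutativeRing = record
      { Carrier = Carrier ; _≈_ = _≈_ ; _+_ = _+_ ; _*_ = _*_ ; -_ = -_ ; 0# = 0# ; 1# = 1#
      ; isCommutativeRing = record
        { isRing = record
          { +-isAbelianGroup = record
            { isGroup = record
              { isMonoid = record
                { isSemigroup = record
                  { isMagma = record { isEquivalence = isEquivalence ; ∙-cong = +-cong }
                  ; assoc   = +-assoc }
                ; identity = +-identityˡ , λ x → +-comm x 0# ⨾ +-identityˡ x }
              ; inverse = -‿inverseˡ , λ x → +-comm x (- x) ⨾ -‿inverseˡ x
              ; ⁻¹-cong = -‿cong }
            ; comm = +-comm }
          ; *-cong     = *-cong
          ; *-assoc    = *-assoc
          ; *-identity = *-identityˡ , λ x → *-comm x 1# ⨾ *-identityˡ x
          ; distrib    = (λ x y z → *-comm x (y + z) ⨾ (distribʳ x y z ⨾ +-cong (*-comm y x) (*-comm z x)))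
                       , distribʳ }
        ; *-comm = *-comm } }

    open CommutativeRing commutativeRing public
      using (setoid; ring; +-commutativeMonoid; *-commutativeMonoid; +-abelianGroup; +-group;
             commutativeSemiring;
             +-identityʳ; *-identityʳ; distribˡ; zeroˡ; zeroʳ; +-congˡ; +-congʳ; *-congˡ; *-congʳ)
      renaming (refl to ≈refl; sym to ≈sym; trans to ≈trans; reflexive to ≈reflexive)

    idempotent⇒0 : ∀ {x} → x + x ≈ x → x ≈ 0#
    idempotent⇒0 {x} e = ∙-cancelˡ x _ _ (≈trans e (≈sym (+-identityʳ x)))
      where open Algebra.Properties.Group +-group using (∙-cancelˡ)

    ·-zeroˡ : ∀ x → K.0# · x ≈ 0#
    ·-zeroˡ x = idempotent⇒0 (≈trans (≈sym (·-distribʳ x K.0# K.0#)) (·-cong (K.+-identityˡ K.0#) ≈refl))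

    ·-zeroʳ : ∀ k → k · 0# ≈ 0#
    ·-zeroʳ k = idempotent⇒0 (≈trans (≈sym (·-distribˡ k 0# 0#)) (·-cong K.refl (+-identityˡ 0#)))

    ·≈*1 : ∀ k x → k · x ≈ (k · 1#) * x
    ·≈*1 k x = ≈trans (·-cong K.refl (≈sym (*-identityˡ x))) (·-*-assocˡ k 1# x)

    ·-*-assocʳ : ∀ k x y → k · (x * y) ≈ x * (k · y)
    ·-*-assocʳ k x y = ≈trans (·-cong K.refl (*-comm x y)) (≈trans (·-*-assocˡ k y x) (*-comm _ x))

    isAlgebra : IsAlgebra K A
    isAlgebra = record
      { isRing       = CommutativeRing.isRing commutativeRing
      ; isLeftModule = record
        { isLeftSemimodule = record
          { +ᴹ-isCommutativeMonoid = CommutativeRing.+-isCommutativeMonoid commutativeRing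
          ; isPreleftSemimodule    = record
            { *ₗ-cong      = ·-cong
            ; *ₗ-zeroˡ     = ·-zeroˡ
            ; *ₗ-distribʳ  = ·-distribʳ
            ; *ₗ-identityˡ = ·-identityˡ
            ; *ₗ-assoc     = ·-assoc
            ; *ₗ-zeroʳ     = ·-zeroʳ
            ; *ₗ-distribˡ  = ·-distribˡ } }
        ; -ᴹ‿cong    = -‿cong
        ; -ᴹ‿inverse = CommutativeRing.-‿inverse commutativeRing }
      ; ·-*-assocˡ   = ·-*-assocˡ
      ; ·-*-assocʳ   = ·-*-assocʳ }

  record CommutativeAlgebra : Set₁ where
    field
      raw                  : RawAlgebra K.Carrier 0ℓ 0ℓ
      isCommutativeAlgebra : IsCommutativeAlgebra raw
    open RawAlgebra raw public
    open IsCommutativeAlgebra isCommutativeAlgebra public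
    open Sum +-commutativeMonoid public
    open Sum *-commutativeMonoid public using ()
      renaming (∑ to ∏; ∑-cong to ∏-cong; ∑-↭ to ∏-↭; ∑-concatMap to ∏-concatMap; ∑-map to ∏-map;
                ∑-∙ to ∏-*; ∑-zero to ∏-one)
    open Algebra.Properties.CommutativeSemigroup
      (CommutativeMonoid.commutativeSemigroup *-commutativeMonoid) public using () renaming (interchange to *-interchange)

    ∑-distribˡ : ∀ x (ys : List I) {f} → x * ∑ ys f ≈ ∑ ys (λ y → x * f y)
    ∑-distribˡ x []       = zeroʳ x
    ∑-distribˡ x (y ∷ ys) = ≈trans (distribˡ x _ _) (+-congˡ (∑-distribˡ x ys))

    ∑-distribʳ : ∀ x (ys : List I) {f} → ∑ ys f * x ≈ ∑ ys (λ y → f y * x)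
    ∑-distribʳ x ys = ≈trans (*-comm _ x) (≈trans (∑-distribˡ x ys) (∑-cong {xs = ys} λ _ → *-comm x _))

    ∑-*-∑ : ∀ (xs : List I) (ys : List J) {f g} →
            ∑ xs f * ∑ ys g ≈ ∑ xs (λ x → ∑ ys (λ y → f x * g y))
    ∑-*-∑ xs ys = ≈trans (∑-distribʳ _ xs) (∑-cong {xs = xs} λ _ → ∑-distribˡ _ ys)

  record IsHom (A B : CommutativeAlgebra)
               (f : CommutativeAlgebra.Carrier A → CommutativeAlgebra.Carrier B) : Set where
    private
      module A = CommutativeAlgebra A
      module B = CommutativeAlgebra B
    field
      f-cong : ∀ {x y} → x A.≈ y → f x B.≈ f y
      +-homo : ∀ x y → f (x A.+ y) B.≈ f x B.+ f y
      *-homo : ∀ x y → f (x A.* y) B.≈ f x B.* f y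
      1-homo : f A.1# B.≈ B.1#
      ·-homo : ∀ k x → f (k A.· x) B.≈ k B.· f x

    0-homo : f A.0# B.≈ B.0#
    0-homo = B.idempotent⇒0 (B.≈trans (B.≈sym (+-homo A.0# A.0#)) (f-cong (A.+-identityˡ A.0#)))

    neg-homo : ∀ x → f (A.- x) B.≈ B.- f x
    neg-homo x = inverseˡ-unique _ _
      (B.≈trans (B.≈sym (+-homo (A.- x) x)) (B.≈trans (f-cong (A.-‿inverseˡ x)) 0-homo))
      where open Algebra.Properties.Group B.+-group using (inverseˡ-unique)

    ∑-homo : ∀ (xs : List I) {g} → f (A.∑ xs g) B.≈ B.∑ xs (f ∘ g)
    ∑-homo []       = 0-homo
    ∑-homo (x ∷ xs) = B.≈trans (+-homo _ _) (B.+-congˡ (∑-homo xs))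

    ∏-homo : ∀ (xs : List I) {g} → f (A.∏ xs g) B.≈ B.∏ xs (f ∘ g)
    ∏-homo []       = 1-homo
    ∏-homo (x ∷ xs) = B.≈trans (*-homo _ _) (B.*-congˡ (∏-homo xs))

    isAlgebraHomomorphism : IsAlgebraHomomorphism A.raw B.raw f
    isAlgebraHomomorphism = record
      { isRingHomomorphism = record
        { isSemiringHomomorphism = record
          { isNearSemiringHomomorphism = record
            { +-isMonoidHomomorphism = record
              { isMagmaHomomorphism = record
                { isRelHomomorphism = record { cong = f-cong }
                ; homo = +-homo }
              ; ε-homo = 0-homo }
            ; *-homo = *-homo }
          ; 1#-homo = 1-homo }
        ; -‿homo = neg-homo }
      ; isLinear = record
        { +ᴹ-isGroupHomomorphism = record
          { isMonoidHomomorphism = record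
            { isMagmaHomomorphism = record
              { isRelHomomorphism = record { cong = f-cong }
              ; homo = +-homo }
            ; ε-homo = 0-homo }
          ; ⁻¹-homo = neg-homo }
        ; *ₗ-homo = ·-homo } }

  id-hom : ∀ {A} → IsHom A A id
  id-hom {A} = record
    { f-cong = id ; +-homo = λ _ _ → ≈refl ; *-homo = λ _ _ → ≈refl
    ; 1-homo = ≈refl ; ·-homo = λ _ _ → ≈refl }
    where open CommutativeAlgebra A

  ∘-hom : ∀ {A B C f g} → IsHom B C g → IsHom A B f → IsHom A C (g ∘ f)
  ∘-hom {C = C} hg hf = record
    { f-cong = G.f-cong ∘ F.f-cong
    ; +-homo = λ x y → ≈trans (G.f-cong (F.+-homo x y)) (G.+-homo _ _)
    ; *-homo = λ x y → ≈trans (G.f-cong (F.*-homo x y)) (G.*-homo _ _)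
    ; 1-homo = ≈trans (G.f-cong F.1-homo) G.1-homo
    ; ·-homo = λ k x → ≈trans (G.f-cong (F.·-homo k x)) (G.·-homo k _) }
    where
    open CommutativeAlgebra C
    module F = IsHom hf
    module G = IsHom hg

  scalarAlgebra : CommutativeAlgebra
  scalarAlgebra = record
    { raw = scalars K
    ; isCommutativeAlgebra = record
      { isEquivalence = K.isEquivalence
      ; +-cong = K.+-cong ; +-assoc = K.+-assoc ; +-comm = K.+-comm ; +-identityˡ = K.+-identityˡ
      ; -‿cong = K.-‿cong ; -‿inverseˡ = K.-‿inverseˡ
      ; *-cong = K.*-cong ; *-assoc = K.*-assoc ; *-comm = K.*-comm ; *-identityˡ = K.*-identityˡ
      ; distribʳ = K.distribʳ
      ; ·-cong = K.*-cong ; ·-distribˡ = K.distribˡ ; ·-distribʳ = K.distribʳ ; ·-assoc = K.*-assoc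
      ; ·-identityˡ = K.*-identityˡ
      ; ·-*-assocˡ = λ k x y → K.sym (K.*-assoc k x y) } }

  module _ (A : CommutativeAlgebra) where
    open CommutativeAlgebra A

    scalar-hom : IsHom scalarAlgebra A (_· 1#)
    scalar-hom = record
      { f-cong = λ e → ·-cong e ≈refl
      ; +-homo = ·-distribʳ 1#
      ; *-homo = λ k l → ≈trans (·-assoc k l 1#) (·≈*1 k (l · 1#))
      ; 1-homo = ·-identityˡ 1#
      ; ·-homo = λ k l → ·-assoc k l 1# }

  module _ (V : Set) where
    private
      module P = _≈ₚ_

    free : CommutativeAlgebra
    free = record
      { raw = polynomialAlgebra K V
      ; isCommutativeAlgebra = record
        { isEquivalence = record { refl = P.≈-refl ; sym = P.≈-sym ; trans = P.≈-trans }
        ; +-cong = P.+-cong ; +-assoc = P.+-assoc ; +-comm = P.+-comm ; +-identityˡ = P.+-identityˡ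
        ; -‿cong = P.neg-cong ; -‿inverseˡ = P.+-inverseˡ
        ; *-cong = P.*-cong ; *-assoc = P.*-assoc ; *-comm = P.*-comm ; *-identityˡ = P.*-identityˡ
        ; distribʳ = distribʳ
        ; ·-cong = λ e → P.*-cong (P.con-cong e)
        ; ·-distribˡ = λ k → P.distribˡ (con k)
        ; ·-distribʳ = λ x k l → P.≈-trans (P.*-cong (P.con-+ k l) P.≈-refl) (distribʳ x (con k) (con l))
        ; ·-assoc = λ k l x → P.≈-trans (P.*-cong (P.con-* k l) P.≈-refl) (P.*-assoc (con k) (con l) x)
        ; ·-identityˡ = P.*-identityˡ
        ; ·-*-assocˡ = λ k x y → P.≈-sym (P.*-assoc (con k) x y) } }
      where
      distribʳ : ∀ x y z → _≈ₚ_ K V ((y :+ z) :* x) (y :* x :+ z :* x)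
      distribʳ x y z = P.≈-trans (P.*-comm (y :+ z) x) 
        (P.≈-trans (P.distribˡ x y z) (P.+-cong (P.*-comm x y) (P.*-comm x z)))

    module _ (A : CommutativeAlgebra) where
      private
        module A = CommutativeAlgebra A

      extend-hom : (f : V → A.Carrier) → IsHom free A (extend K A.raw f)
      extend-hom f = record
        { f-cong = respects
        ; +-homo = λ _ _ → A.≈refl
        ; *-homo = λ _ _ → A.≈refl
        ; 1-homo = 1-homo
        ; ·-homo = λ k x → A.≈sym (A.·≈*1 k _) }
        where
        open IsHom (scalar-hom A)
        ⟦_⟧ = extend K A.raw f
        respects : ∀ {x y} → _≈ₚ_ K V x y → ⟦ x ⟧ A.≈ ⟦ y ⟧
        respects P.≈-refl = A.≈refl
        respects (P.≈-sym e) = A.≈sym (respects e)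
        respects (P.≈-trans e e′) = A.≈trans (respects e) (respects e′)
        respects (P.+-cong e e′) = A.+-cong (respects e) (respects e′)
        respects (P.*-cong e e′) = A.*-cong (respects e) (respects e′)
        respects (P.neg-cong e) = A.-‿cong (respects e)
        respects (P.+-assoc p q r) = A.+-assoc _ _ _
        respects (P.+-comm p q) = A.+-comm _ _
        respects (P.+-identityˡ p) = A.≈trans (A.+-congʳ 0-homo) (A.+-identityˡ _)
        respects (P.+-inverseˡ p) = A.≈trans (A.-‿inverseˡ _) (A.≈sym 0-homo)
        respects (P.*-assoc p q r) = A.*-assoc _ _ _
        respects (P.*-comm p q) = A.*-comm _ _
        respects (P.*-identityˡ p) = A.≈trans (A.*-congʳ 1-homo) (A.*-identityˡ _)
        respects (P.distribˡ p q r) = A.distribˡ _ _ _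
        respects (P.con-cong e) = f-cong e
        respects (P.con-+ k l) = +-homo k l
        respects (P.con-* k l) = *-homo k l

      hom-ext : ∀ {φ ψ} → IsHom free A φ → IsHom free A ψ →
                (∀ v → φ (var v) A.≈ ψ (var v)) → ∀ x → φ x A.≈ ψ x
      hom-ext {φ} {ψ} hφ hψ eq = go
        where
        module φ = IsHom hφ
        module ψ = IsHom hψ
        module F = CommutativeAlgebra free
        con≈ : ∀ {χ} → IsHom free A χ → ∀ k → χ (con k) A.≈ k A.· A.1#
        con≈ h k = A.≈trans (f-cong (F.≈sym (F.*-identityʳ (con k))))
          (A.≈trans (·-homo k F.1#) (A.·-cong K.refl 1-homo))
          where open IsHom h
        go : ∀ x → φ x A.≈ ψ x
        go (con k)  = A.≈trans (con≈ hφ k) (A.≈sym (con≈ hψ k))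
        go (var v)  = eq v
        go (p :+ q) = A.≈trans (φ.+-homo p q) (A.≈trans (A.+-cong (go p) (go q)) (A.≈sym (ψ.+-homo p q)))
        go (p :* q) = A.≈trans (φ.*-homo p q) (A.≈trans (A.*-cong (go p) (go q)) (A.≈sym (ψ.*-homo p q)))
        go (:- p)   = A.≈trans (φ.neg-homo p) (A.≈trans (A.-‿cong (go p)) (A.≈sym (ψ.neg-homo p)))

  -- Tensor products

  module _ (A B : CommutativeAlgebra) where
    private
      module A = CommutativeAlgebra A
      module B = CommutativeAlgebra B

    Formal : Set
    Formal = List (A.Carrier × B.Carrier)

    private
      T : RawAlgebra K.Carrier 0ℓ 0ℓ
      T = A.raw ⊗ₐ B.raw
    open RawAlgebra T using () renaming (_≈_ to _≈T_; _*_ to _*T_; _·_ to _·T_)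

    formalSums : CommutativeMonoid 0ℓ 0ℓ
    formalSums = record
      { Carrier = Formal ; _≈_ = _≈T_ ; _∙_ = _++_ ; ε = []
      ; isCommutativeMonoid = record
        { isMonoid = record
          { isSemigroup = record
            { isMagma = record
              { isEquivalence = record { refl = ≋-refl ; sym = ≋-sym ; trans = ≋-trans }
              ; ∙-cong = ++-cong }
            ; assoc = λ s t u → ≡⇒≋ (List.++-assoc s t u) }
          ; identity = (λ _ → ≋-refl) , λ s → ≡⇒≋ (List.++-identityʳ s) }
        ; comm = ++-comm } }
      where
      ≡⇒≋ : ∀ {s t} → s ≡ t → s ≈T t
      ≡⇒≋ refl = ≋-refl

    -- Values in a commutative monoid allow one lifting lemma to serve both for algebras and for
    -- formal sums. Without cancellation the zero laws do not follow from additivity, hence they are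
    -- listed.
    record IsBilinear (M : CommutativeMonoid 0ℓ 0ℓ)
                      (β : A.Carrier → B.Carrier → CommutativeMonoid.Carrier M) : Set where
      open CommutativeMonoid M using (_≈_; _∙_) renaming (ε to 𝟘)
      field
        β-cong     : ∀ {x x′ y y′} → x A.≈ x′ → y B.≈ y′ → β x y ≈ β x′ y′
        β-+ˡ       : ∀ x x′ y → β (x A.+ x′) y ≈ β x y ∙ β x′ y
        β-+ʳ       : ∀ x y y′ → β x (y B.+ y′) ≈ β x y ∙ β x y′
        β-0ˡ       : ∀ y → β A.0# y ≈ 𝟘
        β-0ʳ       : ∀ x → β x B.0# ≈ 𝟘
        β-balanced : ∀ k x y → β (k A.· x) y ≈ β x (k B.· y)

    module _ (M : CommutativeMonoid 0ℓ 0ℓ) {β : A.Carrier → B.Carrier → CommutativeMonoid.Carrier M}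
             (bilinear : IsBilinear M β) where
      open CommutativeMonoid M using (_≈_; _∙_; ∙-cong; ∙-congʳ; ∙-congˡ; comm; identityʳ)
        renaming (refl to refl′; sym to sym′; trans to trans′)
      open Sum M
      open IsBilinear bilinear

      -- The only induction over the generating relations of the tensor product: each of them is
      -- matched by a bilinearity law or a monoid law. Operations on tensors are shown to be well
      -- defined through it.
      lift-cong : ∀ {s t} → s ≈T t → ∑ s (uncurry β) ≈ ∑ t (uncurry β)
      lift-cong ≋-refl           = refl′
      lift-cong (≋-sym e)        = sym′ (lift-cong e)
      lift-cong (≋-trans e e′)   = trans′ (lift-cong e) (lift-cong e′)
      lift-cong (++-cong {s = s} {s′} e e′) =
        trans′ (∑-++ s) (trans′ (∙-cong (lift-cong e) (lift-cong e′)) (sym′ (∑-++ s′)))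
      lift-cong (++-comm s t)    = trans′ (∑-++ s) (trans′ (comm _ _) (sym′ (∑-++ t)))
      lift-cong (⊗-cong e e′)    = ∙-congʳ (β-cong e e′)
      lift-cong (⊗-+ˡ x x′ y)    = trans′ (identityʳ _) (trans′ (β-+ˡ x x′ y) (∙-congˡ (sym′ (identityʳ _))))
      lift-cong (⊗-+ʳ x y y′)    = trans′ (identityʳ _) (trans′ (β-+ʳ x y y′) (∙-congˡ (sym′ (identityʳ _))))
      lift-cong (⊗-0ˡ y)         = trans′ (identityʳ _) (β-0ˡ y)
      lift-cong (⊗-0ʳ x)         = trans′ (identityʳ _) (β-0ʳ x)
      lift-cong (balanced k x y) = ∙-congʳ (β-balanced k x y)

    open Sum formalSums

    map≋∑ : ∀ (xs : List I) {f : I → A.Carrier × B.Carrier} → map f xs ≈T ∑ xs (λ x → [ f x ])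
    map≋∑ []       = ≋-refl
    map≋∑ (x ∷ xs) = ++-cong (≋-refl {s = [ _ ]}) (map≋∑ xs)

    id≋∑ : ∀ s → s ≈T ∑ s [_]
    id≋∑ []      = ≋-refl
    id≋∑ (a ∷ s) = ++-cong (≋-refl {s = [ a ]}) (id≋∑ s)

    private
      module T = CommutativeMonoid formalSums

      infixl 7 _×ₚ_
      _×ₚ_ : A.Carrier × B.Carrier → A.Carrier × B.Carrier → A.Carrier × B.Carrier
      (x , y) ×ₚ (x′ , y′) = x A.* x′ , y B.* y′

      *≋∑ : ∀ s t → (s *T t) ≈T ∑ s (λ a → ∑ t (λ b → [ a ×ₚ b ]))
      *≋∑ []      t = ≋-refl
      *≋∑ (a ∷ s) t = ++-cong (map≋∑ t) (*≋∑ s t)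

      ∑-*T : ∀ s t (M : CommutativeMonoid 0ℓ 0ℓ) {f : A.Carrier × B.Carrier → CommutativeMonoid.Carrier M} →
             CommutativeMonoid._≈_ M (Sum.∑ M (s *T t) f) (Sum.∑ M s (λ a → Sum.∑ M t (λ b → f (a ×ₚ b))))
      ∑-*T s t M = Sum.∑-product M s t

      mapped : {f : A.Carrier → A.Carrier} → (∀ {x x′} → x A.≈ x′ → f x A.≈ f x′) →
               (∀ x x′ → f (x A.+ x′) A.≈ f x A.+ f x′) → f A.0# A.≈ A.0# →
               (∀ k x → f (k A.· x) A.≈ k A.· f x) →
               ∀ {s t} → s ≈T t → map (λ (x , y) → f x , y) s ≈T map (λ (x , y) → f x , y) t
      mapped {f} f-cong f-+ f-0 f-· {s} {t} e =
        ≋-trans (map≋∑ s) (≋-trans (lift-cong formalSums bilinear e) (≋-sym (map≋∑ t)))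
        where
        bilinear : IsBilinear formalSums (λ x y → [ (f x , y) ])
        bilinear = record
          { β-cong = λ e e′ → ⊗-cong (f-cong e) e′
          ; β-+ˡ = λ x x′ y → ≋-trans (⊗-cong (f-+ x x′) B.≈refl) (⊗-+ˡ (f x) (f x′) y)
          ; β-+ʳ = λ x y y′ → ⊗-+ʳ (f x) y y′
          ; β-0ˡ = λ y → ≋-trans (⊗-cong f-0 B.≈refl) (⊗-0ˡ y)
          ; β-0ʳ = λ x → ⊗-0ʳ (f x)
          ; β-balanced = λ k x y → ≋-trans (⊗-cong (f-· k x) B.≈refl) (balanced k (f x) y) }

      *T-comm : ∀ s t → (s *T t) ≈T (t *T s)
      *T-comm s t = ≋-trans (*≋∑ s t) (≋-trans (∑-comm s t) (≋-trans
        (∑-cong {xs = t} λ _ → ∑-cong {xs = s} λ _ → ⊗-cong (A.*-comm _ _) (B.*-comm _ _))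
        (≋-sym (*≋∑ t s))))

      -- For fixed `t` the product extends a bilinear map on pairs, so the lifting applies.
      -- Compatibility in the other factor is later obtained from commutativity.
      *T-congʳ : ∀ {s s′} t → s ≈T s′ → (s *T t) ≈T (s′ *T t)
      *T-congʳ {s} {s′} t e =
        ≋-trans (*≋∑ s t) (≋-trans (lift-cong formalSums bilinear e) (≋-sym (*≋∑ s′ t)))
        where
        bilinear : IsBilinear formalSums (λ x y → ∑ t (λ (x′ , y′) → [ (x A.* x′ , y B.* y′) ]))
        bilinear = record
          { β-cong = λ e e′ → ∑-cong {xs = t} λ _ → ⊗-cong (A.*-congʳ e) (B.*-congʳ e′)
          ; β-+ˡ = λ x x′ y → ≋-trans (∑-cong {xs = t} λ _ →
              ≋-trans (⊗-cong (A.distribʳ _ _ _) B.≈refl) (⊗-+ˡ _ _ _)) (∑-∙ t)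
          ; β-+ʳ = λ x y y′ → ≋-trans (∑-cong {xs = t} λ _ →
              ≋-trans (⊗-cong A.≈refl (B.distribʳ _ _ _)) (⊗-+ʳ _ _ _)) (∑-∙ t)
          ; β-0ˡ = λ y → ∑-zero {xs = t} λ _ → ≋-trans (⊗-cong (A.zeroˡ _) B.≈refl) (⊗-0ˡ _)
          ; β-0ʳ = λ x → ∑-zero {xs = t} λ _ → ≋-trans (⊗-cong A.≈refl (B.zeroˡ _)) (⊗-0ʳ _)
          ; β-balanced = λ k x y → ∑-cong {xs = t} λ _ →
              ≋-trans (⊗-cong (A.≈sym (A.·-*-assocˡ _ _ _)) B.≈refl)
              (≋-trans (balanced k _ _) (⊗-cong A.≈refl (B.·-*-assocˡ _ _ _))) }

      *T-assoc : ∀ s t u → ((s *T t) *T u) ≈T (s *T (t *T u))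
      *T-assoc s t u = ≋-trans (*≋∑ (s *T t) u) (≋-trans (∑-*T s t formalSums) (≋-trans
        (∑-cong {xs = s} λ _ → ≋-trans
          (∑-cong {xs = t} λ _ → ∑-cong {xs = u} λ _ → ⊗-cong (A.*-assoc _ _ _) (B.*-assoc _ _ _))
          (≋-sym (∑-*T t u formalSums)))
        (≋-sym (*≋∑ s (t *T u)))))

      map-cong≋ : ∀ s {f g : A.Carrier × B.Carrier → A.Carrier × B.Carrier} →
                  (∀ a → [ f a ] ≈T [ g a ]) → map f s ≈T map g s
      map-cong≋ s e = ≋-trans (map≋∑ s) (≋-trans (∑-cong {xs = s} λ _ → e _) (≋-sym (map≋∑ s)))

      map-id≋ : ∀ s {f : A.Carrier × B.Carrier → A.Carrier × B.Carrier} →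
                (∀ a → [ f a ] ≈T [ a ]) → map f s ≈T s
      map-id≋ s e = ≋-trans (map-cong≋ s e) (≋-trans (map≋∑ s) (≋-sym (id≋∑ s)))

    infixr 7 _⊗ᶜ_
    _⊗ᶜ_ : CommutativeAlgebra
    _⊗ᶜ_ = record
      { raw = A.raw ⊗ₐ B.raw
      ; isCommutativeAlgebra = record
        { isEquivalence = T.isEquivalence
        ; +-cong = ++-cong ; +-assoc = T.assoc ; +-comm = ++-comm ; +-identityˡ = λ _ → ≋-refl
        ; -‿cong = mapped A.-‿cong (λ _ _ → -‿+-comm′ _ _) -0≈0 (λ k x → -‿· k x)
        ; -‿inverseˡ = λ s → ≋-trans (++-cong (map≋∑ s) (id≋∑ s)) (≋-trans (≋-sym (∑-∙ s))
            (∑-zero {xs = s} λ _ → ≋-trans (≋-sym (⊗-+ˡ _ _ _))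
              (≋-trans (⊗-cong (A.-‿inverseˡ _) B.≈refl) (⊗-0ˡ _))))
        ; *-cong = λ {s} {s′} {t} {t′} e e′ → ≋-trans (*T-congʳ {s} {s′} t e)
            (≋-trans (*T-comm s′ t) (≋-trans (*T-congʳ {t} {t′} s′ e′) (*T-comm t′ s′)))
        ; *-assoc = *T-assoc
        ; *-comm = *T-comm
        ; *-identityˡ = λ s → ≋-trans (T.identityʳ _)
            (map-id≋ s λ _ → ⊗-cong (A.*-identityˡ _) (B.*-identityˡ _))
        ; distribʳ = λ s t u → T.reflexive (List.cartesianProductWith-distribʳ-++ _ t u s)
        ; ·-cong = λ {k} {l} {s} {t} e e′ → ≋-trans
            (mapped (A.·-cong K.refl) (A.·-distribˡ k) (A.·-zeroʳ k) (λ l x →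
               A.≈trans (A.≈sym (A.·-assoc k l x))
                 (A.≈trans (A.·-cong (K.*-comm k l) A.≈refl) (A.·-assoc l k x))) e′)
            (map-cong≋ t λ _ → ⊗-cong (A.·-cong e A.≈refl) B.≈refl)
        ; ·-distribˡ = λ k s t → T.reflexive (List.map-++ _ s t)
        ; ·-distribʳ = λ s k l → ≋-trans (map≋∑ s) (≋-trans (∑-cong {xs = s} λ _ → ≋-trans
            (⊗-cong (A.·-distribʳ _ k l) B.≈refl) (⊗-+ˡ _ _ _))
            (≋-trans (∑-∙ s) (++-cong (≋-sym (map≋∑ s)) (≋-sym (map≋∑ s)))))
        ; ·-assoc = λ k l s → ≋-trans (map-cong≋ s λ _ → ⊗-cong (A.·-assoc k l _) B.≈refl)
            (T.reflexive (List.map-∘ s))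
        ; ·-identityˡ = λ s → map-id≋ s λ _ → ⊗-cong (A.·-identityˡ _) B.≈refl
        ; ·-*-assocˡ = λ k s t → ≋-trans (map≋∑ (s *T t)) (≋-trans (∑-*T s t formalSums) (≋-trans
            (∑-cong {xs = s} λ _ → ∑-cong {xs = t} λ _ → ⊗-cong (A.·-*-assocˡ k _ _) B.≈refl)
            (≋-trans (≋-sym (∑-map s)) (≋-sym (*≋∑ (k ·T s) t)))))
        } }
      where
      open Algebra.Properties.AbelianGroup A.+-abelianGroup
        using (⁻¹-∙-comm; inverseˡ-unique) renaming (ε⁻¹≈ε to -0≈0)
      -‿+-comm′ : ∀ x y → A.- (x A.+ y) A.≈ A.- x A.+ A.- y
      -‿+-comm′ x y = A.≈sym (⁻¹-∙-comm x y)
      -‿· : ∀ k x → A.- (k A.· x) A.≈ k A.· (A.- x)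
      -‿· k x = A.≈sym (inverseˡ-unique _ _ (A.≈trans (A.≈sym (A.·-distribˡ k _ _))
                  (A.≈trans (A.·-cong K.refl (A.-‿inverseˡ x)) (A.·-zeroʳ k))))

  module _ {A B C : CommutativeAlgebra} where
    private
      module A = CommutativeAlgebra A
      module B = CommutativeAlgebra B
    open CommutativeAlgebra C

    copair : (A.Carrier → Carrier) → (B.Carrier → Carrier) → Formal A B → Carrier
    copair φ ψ s = ∑ s (λ (x , y) → φ x * ψ y)

    -- A ⊗ B is the coproduct of A and B.
    copair-hom : ∀ {φ ψ} → IsHom A C φ → IsHom B C ψ → IsHom (A ⊗ᶜ B) C (copair φ ψ)
    copair-hom {φ} {ψ} hφ hψ = record
      { f-cong = lift-cong A B +-commutativeMonoid record
        { β-cong = λ e e′ → *-cong (Φ.f-cong e) (Ψ.f-cong e′)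
        ; β-+ˡ = λ x x′ y → ≈trans (*-congʳ (Φ.+-homo x x′)) (distribʳ _ _ _)
        ; β-+ʳ = λ x y y′ → ≈trans (*-congˡ (Ψ.+-homo y y′)) (distribˡ _ _ _)
        ; β-0ˡ = λ y → ≈trans (*-congʳ Φ.0-homo) (zeroˡ _)
        ; β-0ʳ = λ x → ≈trans (*-congˡ Ψ.0-homo) (zeroʳ _)
        ; β-balanced = λ k x y → ≈trans (*-congʳ (Φ.·-homo k x)) (≈trans (≈sym (·-*-assocˡ k _ _))
            (≈trans (·-*-assocʳ k _ _) (*-congˡ (≈sym (Ψ.·-homo k y))))) }
      ; +-homo = λ s t → ∑-++ s
      ; *-homo = λ s t → ≈trans (∑-product s t) (≈trans
          (∑-cong {xs = s} λ _ → ∑-cong {xs = t} λ _ →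
            ≈trans (*-cong (Φ.*-homo _ _) (Ψ.*-homo _ _)) (*-interchange _ _ _ _))
          (≈sym (∑-*-∑ s t)))
      ; 1-homo = ≈trans (+-identityʳ _) (≈trans (*-cong Φ.1-homo Ψ.1-homo) (*-identityˡ 1#))
      ; ·-homo = λ k s → ≈trans (∑-map s) (≈trans (∑-cong {xs = s} λ _ →
          ≈trans (*-congʳ (Φ.·-homo k _)) (≈trans (≈sym (·-*-assocˡ k _ _)) (·≈*1 k _)))
          (≈trans (≈sym (∑-distribˡ _ s)) (≈sym (·≈*1 k _)))) }
      where
      module Φ = IsHom hφ
      module Ψ = IsHom hψ

  module _ {A B : CommutativeAlgebra} where
    private
      module A = CommutativeAlgebra A
      module B = CommutativeAlgebra B
      module T = CommutativeAlgebra (A ⊗ᶜ B)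

    ι₁ : A.Carrier → T.Carrier
    ι₁ x = [ (x , B.1#) ]

    ι₂ : B.Carrier → T.Carrier
    ι₂ y = [ (A.1# , y) ]

    ι₁-hom : IsHom A (A ⊗ᶜ B) ι₁
    ι₁-hom = record
      { f-cong = λ e → ⊗-cong e B.≈refl
      ; +-homo = λ x x′ → ⊗-+ˡ x x′ B.1#
      ; *-homo = λ x x′ → ⊗-cong A.≈refl (B.≈sym (B.*-identityˡ _))
      ; 1-homo = ≋-refl
      ; ·-homo = λ _ _ → ≋-refl }

    ι₂-hom : IsHom B (A ⊗ᶜ B) ι₂
    ι₂-hom = record
      { f-cong = λ e → ⊗-cong A.≈refl e
      ; +-homo = λ y y′ → ⊗-+ʳ A.1# y y′
      ; *-homo = λ y y′ → ⊗-cong (A.≈sym (A.*-identityˡ _)) B.≈refl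
      ; 1-homo = ≋-refl
      ; ·-homo = λ k y → ≋-sym (balanced k A.1# y) }

    ι₁*ι₂ : ∀ x y → ι₁ x T.* ι₂ y T.≈ [ (x , y) ]
    ι₁*ι₂ x y = ⊗-cong (A.*-identityʳ x) (B.*-identityˡ y)

  -- Convolution

  module _ (C : CommutativeAlgebra) where
    open CommutativeAlgebra C
    open Relation.Binary.Reasoning.Setoid setoid

    ∏ᴬ : {B : A → Set} → (∀ x → B x → Carrier) → ∀ {xs} → All B xs → Carrier
    ∏ᴬ g []                = 1#
    ∏ᴬ g (_∷_ {x = x} b ρ) = g x b * ∏ᴬ g ρ

    ∏ᴬ-universal : {B : A → Set} (g : ∀ x → B x → Carrier) (f : ∀ x → B x) → ∀ xs →
                   ∏ᴬ g (All.universal f xs) ≈ ∏ xs (λ x → g x (f x))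
    ∏ᴬ-universal g f []       = ≈refl
    ∏ᴬ-universal g f (x ∷ xs) = *-congˡ (∏ᴬ-universal g f xs)

    -- The distributive law for a product of arbitrarily many sums, with a separate index type for
    -- each factor.
    ∏-∑ : {B : A → Set} (L : ∀ x → List (B x)) (g : ∀ x → B x → Carrier) → ∀ xs →
          ∏ xs (λ x → ∑ (L x) (g x)) ≈ ∑ (choices L xs) (∏ᴬ g)
    ∏-∑ L g []       = ≈sym (+-identityʳ 1#)
    ∏-∑ L g (x ∷ xs) = begin
      ∑ (L x) (g x) * ∏ xs (λ x → ∑ (L x) (g x))
        ≈⟨ *-congˡ (∏-∑ L g xs) ⟩
      ∑ (L x) (g x) * ∑ (choices L xs) (∏ᴬ g)
        ≈⟨ ∑-*-∑ (L x) (choices L xs) ⟩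
      ∑ (L x) (λ b → ∑ (choices L xs) λ ρ → g x b * ∏ᴬ g ρ)
        ≈⟨ ∑-product (L x) (choices L xs) ⟨
      ∑ (choices L (x ∷ xs)) (∏ᴬ g) ∎

    -- For `F = φ ∘ X K` this is the image under `φ` of the left tensor factor attached to `σ` in
    -- the coproduct of `X K π`.
    cells : (∀ {n} → NC n → Carrier) → NC n → NC n → Carrier
    cells F π σ = ∏ (blocks σ) (λ W → F (restrict π W))

    cells-cong : {F G : ∀ {n} → NC n → Carrier} → (∀ {n} (π : NC n) → F π ≈ G π) →
                 (π σ : NC n) → cells F π σ ≈ cells G π σ
    cells-cong e π σ = ∏-cong {xs = blocks σ} λ _ → e _

    cells-diagonal : {F : ∀ {n} → NC n → Carrier} → (∀ n → F (1ₙ n) ≈ 1#) →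
                     (π : NC n) → cells F π π ≈ 1#
    cells-diagonal {F = F} F-1 π = ∏-one {xs = blocks π} λ {W} W∈ →
      ≈trans (≈reflexive (cong F (restrict-block π W∈))) (F-1 _)

    module _ (F : ∀ {n} → NC n → Carrier) where

      F-pack : {α : NC m} {β : NC n} → _≡_ {A = Σ ℕ NC} (m , α) (n , β) → F α ≡ F β
      F-pack = cong (λ (_ , α) → F α)

      -- The blocks of `τ` are collected according to the block `W` of `σ` around them, and
      -- restricting `π` to such a block is the same as restricting it to `W` first.
      cells-factorisation : (π τ σ : NC n) → τ ≤ σ →
        cells F π τ ≈ ∏ (blocks σ) (λ W → cells F (restrict π W) (restrict τ W))
      cells-factorisation π τ σ τ≤σ = begin
        ∏ (blocks τ) (λ U → F (restrict π U))
          ≈⟨ ∏-↭ (blocks-decomposition τ σ τ≤σ) ⟩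
        ∏ (concatMap (λ W → map (embed W) (blocks (restrict τ W))) (blocks σ)) (λ U → F (restrict π U))
          ≈⟨ ∏-concatMap (blocks σ) ⟩
        ∏ (blocks σ) (λ W → ∏ (map (embed W) (blocks (restrict τ W))) λ U → F (restrict π U))
          ≈⟨ (∏-cong {xs = blocks σ} λ {W} _ → ≈trans (∏-map (blocks (restrict τ W)))
               (∏-cong {xs = blocks (restrict τ W)} λ {U} _ → ≈reflexive (F-pack (restrict-embed π W U)))) ⟩
        ∏ (blocks σ) (λ W → cells F (restrict π W) (restrict τ W)) ∎

    -- Expanding the product chooses a partition above π_W for every block `W` of `σ`, that is, a
    -- `τ` in [π, σ]. The factors with `G` then form `cells G τ σ` at once; those with `F` are
    -- reassembled by `cells-factorisation`.
    cells-∑ : (F G : ∀ {n} → NC n → Carrier) (π σ : NC n) → π ≤ σ →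
      cells (λ α → ∑ (above α) (λ β → cells F α β * G β)) π σ ≈
      ∑ (interval π σ) (λ τ → cells F π τ * cells G τ σ)
    cells-∑ F G π σ π≤σ = begin
      ∏ (blocks σ) (λ W → ∑ (above (restrict π W)) (g W))
        ≈⟨ ∏-∑ (λ W → above (restrict π W)) g (blocks σ) ⟩
      ∑ (choices (λ W → above (restrict π W)) (blocks σ)) (∏ᴬ g)
        ≈⟨ ∑-↭ (interval-factorisation π σ π≤σ) ⟨
      ∑ (map (λ τ → restrictions τ σ) (interval π σ)) (∏ᴬ g)
        ≈⟨ ∑-map (interval π σ) ⟩
      ∑ (interval π σ) (λ τ → ∏ᴬ g (restrictions τ σ))
        ≈⟨ (∑-cong {xs = interval π σ} λ {τ} τ∈ → ≈trans (∏ᴬ-universal g (restrict τ) (blocks σ))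
             (≈trans (∏-* (blocks σ))
               (*-congʳ (≈sym (cells-factorisation F π τ σ (proj₂ (∈-interval⁻ π σ τ∈))))))) ⟩
      ∑ (interval π σ) (λ τ → cells F π τ * cells G τ σ) ∎
      where
      g : ∀ W → NC _ → Carrier
      g W ρ = cells F (restrict π W) ρ * G ρ

  𝒯ᶜ : CommutativeAlgebra
  𝒯ᶜ = free Generator

  private
    module 𝒯ᶜ = CommutativeAlgebra 𝒯ᶜ

  X-1ₙ : ∀ n → X K (1ₙ n) ≡ 𝒯ᶜ.1#
  X-1ₙ n with 1ₙ n ≟ 1ₙ n
  ... | yes _   = refl
  ... | no  1≢1 = contradiction refl 1≢1

  X-generator : (π : NC n) .(π≢1 : π ≢ 1ₙ n) → X K π ≡ var (generator π π≢1)
  X-generator {n} π π≢1 with π ≟ 1ₙ n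
  ... | yes refl = ⊥-elim-irr (π≢1 refl)
  ... | no  _    = refl

  Δ-hom : IsHom 𝒯ᶜ (𝒯ᶜ ⊗ᶜ 𝒯ᶜ) (Δ K)
  Δ-hom = extend-hom Generator (𝒯ᶜ ⊗ᶜ 𝒯ᶜ) _

  ε-hom : IsHom 𝒯ᶜ scalarAlgebra (ε K)
  ε-hom = extend-hom Generator scalarAlgebra _

  module _ (C : CommutativeAlgebra) where
    open CommutativeAlgebra C
    open Relation.Binary.Reasoning.Setoid setoid
    private
      Map = 𝒯ᶜ.Carrier → Carrier

    -- Stated for all `X K π`, top partitions included, so that the convolution formula `⋆-X` can be
    -- used for every partition alike.
    X-ext : {φ ψ : Map} → IsHom 𝒯ᶜ C φ → IsHom 𝒯ᶜ C ψ →
            (∀ {n} (π : NC n) → φ (X K π) ≈ ψ (X K π)) → ∀ x → φ x ≈ ψ x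
    X-ext {φ} {ψ} hφ hψ e = hom-ext Generator C hφ hψ λ (generator π π≢1) →
      ≡.subst (λ x → φ x ≈ ψ x) (X-generator π π≢1) (e π)

    infixl 7 _⋆_
    _⋆_ : Map → Map → Map
    φ ⋆ ψ = copair {𝒯ᶜ} {𝒯ᶜ} {C} φ ψ ∘ Δ K

    ⋆-hom : {φ ψ : Map} → IsHom 𝒯ᶜ C φ → IsHom 𝒯ᶜ C ψ → IsHom 𝒯ᶜ C (φ ⋆ ψ)
    ⋆-hom hφ hψ = ∘-hom (copair-hom hφ hψ) Δ-hom

    hom-X-1ₙ : {φ : Map} → IsHom 𝒯ᶜ C φ → ∀ n → φ (X K (1ₙ n)) ≈ 1#
    hom-X-1ₙ {φ} hφ n = ≈trans (≈reflexive (cong φ (X-1ₙ n))) (IsHom.1-homo hφ)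

    -- Away from `1ₙ n` this unfolds the definition of `Δ`. At `1ₙ n` the left side is 1, while the
    -- sum has the single term `σ = 1ₙ n`, whose factors are all 1: the formula for `Δ` remains
    -- valid under the convention for `X`.
    ⋆-X : {φ ψ : Map} → IsHom 𝒯ᶜ C φ → IsHom 𝒯ᶜ C ψ → (π : NC n) →
          (φ ⋆ ψ) (X K π) ≈ ∑ (above π) (λ σ → cells C (φ ∘ X K) π σ * ψ (X K σ))
    ⋆-X {n} {φ} {ψ} hφ hψ π with π ≟ 1ₙ n
    ... | no π≢1 = ≈trans (∑-map (above π)) (∑-cong {xs = above π} λ {σ} _ →
          *-congʳ (IsHom.∏-homo hφ (blocks σ)))
    ... | yes refl = begin
      (φ ⋆ ψ) 𝒯ᶜ.1#
        ≈⟨ IsHom.1-homo (⋆-hom hφ hψ) ⟩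
      1#
        ≈⟨ ≈trans (*-cong (cells-diagonal C {F = φ ∘ X K} (hom-X-1ₙ hφ) (1ₙ n)) (hom-X-1ₙ hψ n))
             (*-identityˡ 1#) ⟨
      cells C (φ ∘ X K) (1ₙ n) (1ₙ n) * ψ (X K (1ₙ n))
        ≈⟨ ∑-single _≟_ (above-unique (1ₙ n)) (∈-above⁺ (1ₙ n) (≤-refl (1ₙ n)))
             (λ σ∈ σ≢1 → contradiction (1ₙ≤⇒≡ (∈-above⁻ (1ₙ n) σ∈)) σ≢1) ⟨
      ∑ (above (1ₙ n)) (λ σ → cells C (φ ∘ X K) (1ₙ n) σ * ψ (X K σ)) ∎

    -- Both sides are the sum over all chains π ≤ τ ≤ σ of `cells` of `φ` on (π, τ), times `cells`
    -- of `ψ` on (τ, σ), times `χ (X K σ)`; they differ in whether `σ` or `τ` is summed over first.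
    ⋆-assoc : {φ ψ χ : Map} → IsHom 𝒯ᶜ C φ → IsHom 𝒯ᶜ C ψ → IsHom 𝒯ᶜ C χ →
              ∀ x → ((φ ⋆ ψ) ⋆ χ) x ≈ (φ ⋆ (ψ ⋆ χ)) x
    ⋆-assoc {φ} {ψ} {χ} hφ hψ hχ = X-ext (⋆-hom (⋆-hom hφ hψ) hχ) (⋆-hom hφ (⋆-hom hψ hχ)) λ {n} π → begin
      ((φ ⋆ ψ) ⋆ χ) (X K π)
        ≈⟨ ⋆-X (⋆-hom hφ hψ) hχ π ⟩
      ∑ (above π) (λ σ → cells C ((φ ⋆ ψ) ∘ X K) π σ * χ (X K σ))
        ≈⟨ (∑-cong {xs = above π} λ {σ} σ∈ → ≈trans
             (*-congʳ (≈trans (cells-cong C {F = (φ ⋆ ψ) ∘ X K} (⋆-X hφ hψ) π σ)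
               (cells-∑ C (φ ∘ X K) (ψ ∘ X K) π σ (∈-above⁻ π σ∈))))
             (∑-distribʳ _ (interval π σ))) ⟩
      ∑ (above π) (λ σ → ∑ (interval π σ) λ τ → cells C (φ ∘ X K) π τ * cells C (ψ ∘ X K) τ σ * χ (X K σ))
        ≈⟨ ∑-filter-comm (allNC n) (allNC n) (π ≤?_) (λ σ τ → (π ≤? τ) ×-dec (τ ≤? σ)) (π ≤?_) _≤?_
             (λ _ _ _ q → q) (λ σ τ π≤τ τ≤σ → ≤-trans π τ σ π≤τ τ≤σ , π≤τ , τ≤σ) ⟩
      ∑ (above π) (λ τ → ∑ (above τ) λ σ → cells C (φ ∘ X K) π τ * cells C (ψ ∘ X K) τ σ * χ (X K σ))
        ≈⟨ (∑-cong {xs = above π} λ {τ} _ → ≈trans (∑-cong {xs = above τ} λ _ → *-assoc _ _ _)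
             (≈trans (≈sym (∑-distribˡ _ (above τ))) (*-congˡ (≈sym (⋆-X hψ hχ τ))))) ⟩
      ∑ (above π) (λ τ → cells C (φ ∘ X K) π τ * (ψ ⋆ χ) (X K τ))
        ≈⟨ ⋆-X hφ (⋆-hom hψ hχ) π ⟨
      (φ ⋆ (ψ ⋆ χ)) (X K π) ∎

  -- Counit and antipode

  module _ (C : CommutativeAlgebra) where
    open CommutativeAlgebra C
    open Relation.Binary.Reasoning.Setoid setoid
    private
      Map = 𝒯ᶜ.Carrier → Carrier

    η∘ε : Map
    η∘ε x = ε K x · 1#

    η∘ε-hom : IsHom 𝒯ᶜ C η∘ε
    η∘ε-hom = ∘-hom (scalar-hom C) ε-hom

    η∘ε-X : (π : NC n) → π ≢ 1ₙ n → η∘ε (X K π) ≈ 0#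
    η∘ε-X π π≢1 = ≈trans (≈reflexive (cong η∘ε (X-generator π π≢1))) (·-zeroˡ 1#)

    ∏-0 : ∀ {A : Set} {xs : List A} {x f} → x ∈ xs → f x ≈ 0# → ∏ xs f ≈ 0#
    ∏-0 (here refl) e = ≈trans (*-congʳ e) (zeroˡ _)
    ∏-0 (there x∈)  e = ≈trans (*-congˡ (∏-0 x∈ e)) (zeroʳ _)

    -- For positive size the only block is everything, and restriction to it gives `π` back. For
    -- size 0 the product is empty, and the value of `F` must be 1 there too.
    cells-1ₙ : {F : ∀ {n} → NC n → Carrier} → (∀ n → F (1ₙ n) ≈ 1#) →
               (π : NC n) → cells C F π (1ₙ n) ≈ F π
    cells-1ₙ {n = zero} {F} F-1 π = ≈sym (≈trans (≈reflexive (cong F (NC-0 π))) (F-1 0))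
    cells-1ₙ {n = suc n} {F} F-1 π =
      ≈trans (∏-↭ (blocks-1ₙ n)) (≈trans (*-identityʳ _) (≈reflexive (F-pack C F (restrict-⊤ π))))

    -- A term survives only if every π_W is trivial, which forces `σ = π`. For the right identity
    -- the surviving term is instead the one at the top.
    ⋆-identityˡ : {φ : Map} → IsHom 𝒯ᶜ C φ → ∀ x → _⋆_ C η∘ε φ x ≈ φ x
    ⋆-identityˡ {φ} hφ = X-ext C (⋆-hom C η∘ε-hom hφ) hφ λ π → begin
      _⋆_ C η∘ε φ (X K π)
        ≈⟨ ⋆-X C η∘ε-hom hφ π ⟩
      ∑ (above π) (λ σ → cells C (η∘ε ∘ X K) π σ * φ (X K σ))
        ≈⟨ ∑-single _≟_ (above-unique π) (∈-above⁺ π (≤-refl π)) (λ {σ} σ∈ σ≢π →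
             let W , W∈ , π_W≢1 = finer⇒nontrivial π σ (∈-above⁻ π σ∈) σ≢π
             in ≈trans (*-congʳ (∏-0 W∈ (η∘ε-X (restrict π W) π_W≢1))) (zeroˡ _)) ⟩
      cells C (η∘ε ∘ X K) π π * φ (X K π)
        ≈⟨ *-congʳ (cells-diagonal C {F = η∘ε ∘ X K} (hom-X-1ₙ C η∘ε-hom) π) ⟩
      1# * φ (X K π)
        ≈⟨ *-identityˡ _ ⟩
      φ (X K π) ∎

    ⋆-identityʳ : {φ : Map} → IsHom 𝒯ᶜ C φ → ∀ x → _⋆_ C φ η∘ε x ≈ φ x
    ⋆-identityʳ {φ} hφ = X-ext C (⋆-hom C hφ η∘ε-hom) hφ λ {n} π → begin
      _⋆_ C φ η∘ε (X K π)
        ≈⟨ ⋆-X C hφ η∘ε-hom π ⟩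
      ∑ (above π) (λ σ → cells C (φ ∘ X K) π σ * η∘ε (X K σ))
        ≈⟨ ∑-single _≟_ (above-unique π) (∈-above⁺ π (≤-1ₙ π)) (λ {σ} σ∈ σ≢1 →
             ≈trans (*-congˡ (η∘ε-X σ σ≢1)) (zeroʳ _)) ⟩
      cells C (φ ∘ X K) π (1ₙ n) * η∘ε (X K (1ₙ n))
        ≈⟨ *-cong (cells-1ₙ {F = φ ∘ X K} (hom-X-1ₙ C hφ) π) (hom-X-1ₙ C η∘ε-hom n) ⟩
      φ (X K π) * 1#
        ≈⟨ *-identityʳ _ ⟩
      φ (X K π) ∎

    module _ {φ : Map} (hφ : IsHom 𝒯ᶜ C φ) where

      -- The values on NC n of the ⋆-inverse of φ, correct when n ≤ k.
      inverseAt : ℕ → NC n → Carrier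
      inverseAt zero    π = 1#
      inverseAt {n} (suc k) π with π ≟ 1ₙ n
      ... | yes _ = 1#
      ... | no  _ = - ∑ (filter (λ σ → ¬? (σ ≟ 1ₙ n)) (above π))
                        (λ σ → cells C (inverseAt k) π σ * φ (X K σ))

      inverseAt-1ₙ : ∀ k n → inverseAt k (1ₙ n) ≈ 1#
      inverseAt-1ₙ zero    n = ≈refl
      inverseAt-1ₙ (suc k) n with 1ₙ n ≟ 1ₙ n
      ... | yes _   = ≈refl
      ... | no  1≢1 = contradiction refl 1≢1

      -- Blocks of a `σ` below the top have fewer than `n` points, so they still fit the bound after
      -- it has dropped by one on either side.
      inverseAt-stable : ∀ k l (π : NC n) → n ℕ.≤ k → n ℕ.≤ l → inverseAt k π ≈ inverseAt l π
      inverseAt-stable zero    l       π ℕ.z≤n _ =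
        ≈sym (≈trans (≈reflexive (cong (inverseAt l) (NC-0 π))) (inverseAt-1ₙ l 0))
      inverseAt-stable (suc k) zero    π _ ℕ.z≤n =
        ≈trans (≈reflexive (cong (inverseAt (suc k)) (NC-0 π))) (inverseAt-1ₙ (suc k) 0)
      inverseAt-stable {n} (suc k) (suc l) π n≤k n≤l with π ≟ 1ₙ n
      ... | yes _ = ≈refl
      ... | no  _ = -‿cong (∑-cong {xs = filter (λ σ → ¬? (σ ≟ 1ₙ n)) (above π)} λ {σ} σ∈ →
        *-congʳ (∏-cong {xs = blocks σ} λ {W} W∈ →
          let <n = ∣block∣<n σ (proj₂ (∈-filter⁻ (λ σ → ¬? (σ ≟ 1ₙ n)) {xs = above π} σ∈)) W∈
          in inverseAt-stable k l (restrict π W) (ℕ.s≤s⁻¹ (ℕ.≤-trans <n n≤k)) (ℕ.s≤s⁻¹ (ℕ.≤-trans <n n≤l))))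

      inverse : Map
      inverse = extend K raw (λ (generator {n} π _) → inverseAt n π)

      inverse-hom : IsHom 𝒯ᶜ C inverse
      inverse-hom = extend-hom Generator C _

      inverse-X : (π : NC n) → inverse (X K π) ≈ inverseAt n π
      inverse-X {n} π with π ≟ 1ₙ n
      ... | yes refl = ≈trans (IsHom.1-homo inverse-hom) (≈sym (inverseAt-1ₙ n n))
      ... | no  _    = ≈refl

      -- The equation `inverse ⋆ φ = η∘ε` at `X K π`, solved for the term at the top, which is
      -- `inverse (X K π)` itself. The values on the blocks come with the bound `k` in place of
      -- their own size; stability removes the difference.
      inverse-recursion : (π : NC n) → π ≢ 1ₙ n → inverse (X K π) ≈
        - ∑ (filter (λ σ → ¬? (σ ≟ 1ₙ n)) (above π)) (λ σ → cells C (inverse ∘ X K) π σ * φ (X K σ))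
      inverse-recursion {zero}  π π≢1 = contradiction (NC-0 π) π≢1
      inverse-recursion {suc k} π π≢1 = ≈trans (inverse-X π) (step π π≢1)
        where
        ≢1? = λ σ → ¬? (σ ≟ 1ₙ (suc k))
        step : (π : NC (suc k)) → π ≢ 1ₙ (suc k) → inverseAt (suc k) π ≈
               - ∑ (filter ≢1? (above π)) (λ σ → cells C (inverse ∘ X K) π σ * φ (X K σ))
        step π π≢1 with π ≟ 1ₙ (suc k)
        ... | yes π≡1 = contradiction π≡1 π≢1
        ... | no  _   = -‿cong (∑-cong {xs = filter ≢1? (above π)} λ {σ} σ∈ →
          *-congʳ (∏-cong {xs = blocks σ} λ {W} W∈ →
            let <n = ∣block∣<n σ (proj₂ (∈-filter⁻ ≢1? {xs = above π} σ∈)) W∈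
            in ≈trans (inverseAt-stable k ∣ W ∣ (restrict π W) (ℕ.s≤s⁻¹ <n) ℕ.≤-refl)
                 (≈sym (inverse-X (restrict π W)))))

      inverse-⋆ : ∀ x → _⋆_ C inverse φ x ≈ η∘ε x
      inverse-⋆ = X-ext C (⋆-hom C inverse-hom hφ) η∘ε-hom onX
        where
        onX : ∀ {n} (π : NC n) → _⋆_ C inverse φ (X K π) ≈ η∘ε (X K π)
        onX {n} π with π ≟ 1ₙ n
        ... | yes refl = ≈trans (IsHom.1-homo (⋆-hom C inverse-hom hφ)) (≈sym (IsHom.1-homo η∘ε-hom))
        ... | no π≢1 = ≡.subst (λ x → _⋆_ C inverse φ x ≈ η∘ε x) (X-generator π π≢1) (begin
          _⋆_ C inverse φ (X K π)
            ≈⟨ ⋆-X C inverse-hom hφ π ⟩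
          ∑ (above π) (λ σ → cells C (inverse ∘ X K) π σ * φ (X K σ))
            ≈⟨ ∑-remove _≟_ (above-unique π) (∈-above⁺ π (≤-1ₙ π)) ⟩
          cells C (inverse ∘ X K) π (1ₙ n) * φ (X K (1ₙ n)) + rest
            ≈⟨ +-congʳ (≈trans (*-cong (cells-1ₙ {F = inverse ∘ X K} (hom-X-1ₙ C inverse-hom) π)
                 (hom-X-1ₙ C hφ n)) (*-identityʳ _)) ⟩
          inverse (X K π) + rest
            ≈⟨ +-congʳ (inverse-recursion π π≢1) ⟩
          - rest + rest
            ≈⟨ -‿inverseˡ rest ⟩
          0#
            ≈⟨ η∘ε-X π π≢1 ⟨
          η∘ε (X K π) ∎)
          where
          rest = ∑ (filter (λ σ → ¬? (σ ≟ 1ₙ n)) (above π))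
                   (λ σ → cells C (inverse ∘ X K) π σ * φ (X K σ))

    ⋆-cong : {φ φ′ ψ ψ′ : Map} → (∀ x → φ x ≈ φ′ x) → (∀ x → ψ x ≈ ψ′ x) → ∀ x → _⋆_ C φ ψ x ≈ _⋆_ C φ′ ψ′ x
    ⋆-cong e e′ x = ∑-cong {xs = Δ K x} λ {(u , v)} _ → *-cong (e u) (e′ v)

    -- Every φ has a left inverse S, and S has a left inverse T; then
    -- T = T ⋆ (S ⋆ φ) = (T ⋆ S) ⋆ φ = φ, so S is a two-sided inverse of φ.
    ⋆-inverse : {φ : Map} (hφ : IsHom 𝒯ᶜ C φ) → ∀ x → _⋆_ C φ (inverse hφ) x ≈ η∘ε x
    ⋆-inverse {φ} hφ x = ≈trans (⋆-cong (λ y → ≈sym (T≈φ y)) (λ _ → ≈refl) x) (inverse-⋆ S-hom x)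
      where
      S-hom = inverse-hom hφ
      T = inverse S-hom
      T-hom = inverse-hom S-hom
      T≈φ : ∀ y → T y ≈ φ y
      T≈φ y = begin
        T y                                   ≈⟨ ⋆-identityʳ T-hom y ⟨
        _⋆_ C T η∘ε y                         ≈⟨ ⋆-cong (λ _ → ≈refl) (inverse-⋆ hφ) y ⟨
        _⋆_ C T (_⋆_ C (inverse hφ) φ) y      ≈⟨ ⋆-assoc C T-hom S-hom hφ y ⟨
        _⋆_ C (_⋆_ C T (inverse hφ)) φ y      ≈⟨ ⋆-cong (inverse-⋆ S-hom) (λ _ → ≈refl) y ⟩
        _⋆_ C η∘ε φ y                         ≈⟨ ⋆-identityˡ hφ y ⟩
        φ y ∎

  -- The bialgebra and antipode axioms as identities of convolution

  module _ {A : CommutativeAlgebra} where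
    open CommutativeAlgebra A

    induced-⊗₁ : {I J I′ J′ : Set} (β : I′ → J′ → Carrier) (f : I → I′) (g : J → J′) (s : List (I × J)) →
                 induced raw β ((f ⊗₁ g) s) ≈ ∑ s (λ (x , y) → β (f x) (g y))
    induced-⊗₁ β f g []      = ≈refl
    induced-⊗₁ β f g (a ∷ s) = +-congˡ (induced-⊗₁ β f g s)

  private
    module _ where
      private
        C₂ = 𝒯ᶜ ⊗ᶜ 𝒯ᶜ
        C₃ = 𝒯ᶜ ⊗ᶜ C₂
        module C₂ = CommutativeAlgebra C₂
      open CommutativeAlgebra C₃

      i₁ i₂ i₃ : 𝒯ᶜ.Carrier → Carrier
      i₁ = ι₁ {𝒯ᶜ} {C₂}
      i₂ = ι₂ {𝒯ᶜ} {C₂} ∘ ι₁ {𝒯ᶜ} {𝒯ᶜ}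
      i₃ = ι₂ {𝒯ᶜ} {C₂} ∘ ι₂ {𝒯ᶜ} {𝒯ᶜ}

      i₁-hom : IsHom 𝒯ᶜ C₃ i₁
      i₁-hom = ι₁-hom
      i₂-hom : IsHom 𝒯ᶜ C₃ i₂
      i₂-hom = ∘-hom (ι₂-hom {𝒯ᶜ} {C₂}) (ι₁-hom {𝒯ᶜ} {𝒯ᶜ})
      i₃-hom : IsHom 𝒯ᶜ C₃ i₃
      i₃-hom = ∘-hom (ι₂-hom {𝒯ᶜ} {C₂}) (ι₂-hom {𝒯ᶜ} {𝒯ᶜ})

      i₂*i₃ : ∀ y z → i₂ y * i₃ z ≈ ι₂ {𝒯ᶜ} {C₂} [ (y , z) ]
      i₂*i₃ y z = ≈trans (≈sym (*-homo (ι₁ {𝒯ᶜ} {𝒯ᶜ} y) (ι₂ {𝒯ᶜ} {𝒯ᶜ} z))) (f-cong (ι₁*ι₂ {𝒯ᶜ} {𝒯ᶜ} y z))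
        where open IsHom (ι₂-hom {𝒯ᶜ} {C₂})

      i₁*i₂*i₃ : ∀ x y z → i₁ x * i₂ y * i₃ z ≈ [ (x , [ (y , z) ]) ]
      i₁*i₂*i₃ x y z = ≈trans (*-assoc (i₁ x) (i₂ y) (i₃ z))
        (≈trans (*-congˡ {i₁ x} (i₂*i₃ y z)) (ι₁*ι₂ {𝒯ᶜ} {C₂} x [ (y , z) ]))

      -- A pure tensor is the product of the images of its entries under the three inclusions, which
      -- turns the iterated coproduct into an iterated convolution. A general list in place of
      -- `Δ K x` makes the induction possible.
      assoc-Δ⊗id : ∀ s → Defs.assoc ((Δ K ⊗₁ id) s) ≈ copair {𝒯ᶜ} {𝒯ᶜ} {C₃} (_⋆_ C₃ i₁ i₂) i₃ s
      assoc-Δ⊗id []            = ≈refl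
      assoc-Δ⊗id ((x , z) ∷ s) = +-cong
        (≈trans (map≋∑ 𝒯ᶜ C₂ (Δ K x)) (≈trans (∑-cong {xs = Δ K x} λ {(u , v)} _ → ≈sym (i₁*i₂*i₃ u v z))
          (≈sym (∑-distribʳ (i₃ z) (Δ K x)))))
        (assoc-Δ⊗id s)

      id⊗Δ : ∀ s → (id ⊗₁ Δ K) s ≈ copair {𝒯ᶜ} {𝒯ᶜ} {C₃} i₁ (_⋆_ C₃ i₂ i₃) s
      id⊗Δ s = ≈trans (map≋∑ 𝒯ᶜ C₂ s) (∑-cong {xs = s} λ {(x , y)} _ →
        ≈trans (≈sym (ι₁*ι₂ {𝒯ᶜ} {C₂} x (Δ K y))) (*-congˡ {i₁ x} (ι₂Δ y)))
        where
        open IsHom (ι₂-hom {𝒯ᶜ} {C₂})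
        ι₂Δ : ∀ y → ι₂ {𝒯ᶜ} {C₂} (Δ K y) ≈ _⋆_ C₃ i₂ i₃ y
        ι₂Δ y = ≈trans (f-cong (id≋∑ 𝒯ᶜ 𝒯ᶜ (Δ K y))) (≈trans (∑-homo (Δ K y))
          (∑-cong {xs = Δ K y} λ {(u , v)} _ → ≈sym (i₂*i₃ u v)))

      coassociative : ∀ x → Defs.assoc ((Δ K ⊗₁ id) (Δ K x)) ≈ (id ⊗₁ Δ K) (Δ K x)
      coassociative x = ≈trans (assoc-Δ⊗id (Δ K x))
        (≈trans (⋆-assoc C₃ i₁-hom i₂-hom i₃-hom x) (≈sym (id⊗Δ (Δ K x))))

  isBialgebra : IsBialgebra K (𝒯 K) (Δ K) (ε K)
  isBialgebra = record
    { isAlgebra        = isAlgebra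
    ; Δ-isHomomorphism = IsHom.isAlgebraHomomorphism Δ-hom
    ; ε-isHomomorphism = IsHom.isAlgebraHomomorphism ε-hom
    ; coassociative    = coassociative
    -- The counit laws say that `η∘ε` is neutral for the identity under convolution, once a scalar
    -- action is read as multiplication by a multiple of 1.
    ; counitˡ = λ x → ≈trans (induced-⊗₁ {𝒯ᶜ} _·_ (ε K) id (Δ K x))
        (≈trans (∑-cong {xs = Δ K x} λ _ → ·≈*1 _ _) (⋆-identityˡ 𝒯ᶜ id-hom x))
    ; counitʳ = λ x → ≈trans (induced-⊗₁ {𝒯ᶜ} (λ y k → k · y) id (ε K) (Δ K x))
        (≈trans (∑-cong {xs = Δ K x} λ _ → ≈trans (·≈*1 _ _) (*-comm _ _)) (⋆-identityʳ 𝒯ᶜ id-hom x)) }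
    where open 𝒯ᶜ

  antipode : ∃ (IsAntipode K (𝒯 K) (Δ K) (ε K))
  antipode = S , record
    { isLinear = IsAlgebraHomomorphism.isLinear (IsHom.isAlgebraHomomorphism (inverse-hom 𝒯ᶜ id-hom))
    ; inverseˡ = λ x → ≈trans (induced-⊗₁ {𝒯ᶜ} _*_ S id (Δ K x)) (inverse-⋆ 𝒯ᶜ id-hom x)
    ; inverseʳ = λ x → ≈trans (induced-⊗₁ {𝒯ᶜ} _*_ id S (Δ K x)) (⋆-inverse 𝒯ᶜ id-hom x) }
    where
    open 𝒯ᶜ
    S = inverse 𝒯ᶜ id-hom

  -- The grading

  Span-map : {M : RawLeftModule K.Carrier 0ℓ 0ℓ} {G H : Pred (RawLeftModule.Carrierᴹ M) 0ℓ} →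
             (∀ {x} → G x → H x) → ∀ {x} → Span M G x → Span M H x
  Span-map h (gen g)    = gen (h g)
  Span-map h zero       = zero
  Span-map h (add s t)  = add (Span-map h s) (Span-map h t)
  Span-map h (scal k s) = scal k (Span-map h s)
  Span-map h (resp e s) = resp e (Span-map h s)

  Span-isSubmodule : {M : RawLeftModule K.Carrier 0ℓ 0ℓ} {G : Pred (RawLeftModule.Carrierᴹ M) 0ℓ} →
                     IsSubmodule M (Span M G)
  Span-isSubmodule = record { respects = resp ; 0-closed = zero ; +-closed = add ; ·-closed = scal }

  module _ {A B : CommutativeAlgebra} {f : CommutativeAlgebra.Carrier A → CommutativeAlgebra.Carrier B}
           (hf : IsHom A B f) where
    private
      module A = CommutativeAlgebra A
      module B = CommutativeAlgebra B
    open IsHom hf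

    Span-hom : {G : Pred A.Carrier 0ℓ} {H : Pred B.Carrier 0ℓ} →
               (∀ {x} → G x → Span B.rawLeftModule H (f x)) →
               ∀ {x} → Span A.rawLeftModule G x → Span B.rawLeftModule H (f x)
    Span-hom h (gen g)    = h g
    Span-hom h zero       = resp (B.≈sym 0-homo) zero
    Span-hom h (add s t)  = resp (B.≈sym (+-homo _ _)) (add (Span-hom h s) (Span-hom h t))
    Span-hom h (scal k s) = resp (B.≈sym (·-homo k _)) (scal k (Span-hom h s))
    Span-hom h (resp e s) = resp (f-cong e) (Span-hom h s)

  module _ {A : CommutativeAlgebra} where
    open CommutativeAlgebra A

    Span-* : {G H P : Pred Carrier 0ℓ} →
             (∀ {x y} → G x → H y → Span rawLeftModule P (x * y)) →
             ∀ {x y} → Span rawLeftModule G x → Span rawLeftModule H y → Span rawLeftModule P (x * y)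
    Span-* {G} {H} {P} h = left
      where
      right : ∀ {x} → G x → ∀ {y} → Span rawLeftModule H y → Span rawLeftModule P (x * y)
      right g (gen g′)   = h g g′
      right g zero       = resp (≈sym (zeroʳ _)) zero
      right g (add s t)  = resp (≈sym (distribˡ _ _ _)) (add (right g s) (right g t))
      right g (scal k s) = resp (·-*-assocʳ k _ _) (scal k (right g s))
      right g (resp e s) = resp (*-congˡ e) (right g s)
      left : ∀ {x y} → Span rawLeftModule G x → Span rawLeftModule H y → Span rawLeftModule P (x * y)
      left (gen g)    t = right g t
      left zero       t = resp (≈sym (zeroˡ _)) zero
      left (add s s′) t = resp (≈sym (distribʳ _ _ _)) (add (left s t) (left s′ t))
      left (scal k s) t = resp (·-*-assocˡ k _ _) (scal k (left s t))
      left (resp e s) t = resp (*-congʳ e) (left s t)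

  degreeᵍ : Generator → ℕ
  degreeᵍ (generator π _) = degree π

  degreeᵐ : List Generator → ℕ
  degreeᵐ gs = ℕ-sum (map degreeᵍ gs)

  monomial : List Generator → 𝒯ᶜ.Carrier
  monomial gs = 𝒯ᶜ.product (map var gs)

  1≤degreeᵍ : ∀ g → 1 ℕ.≤ degreeᵍ g
  1≤degreeᵍ (generator π π≢1) = ℕ.∸-monoˡ-≤ 1 (recompute (2 ℕ.≤? #blocks π) (2≤#blocks π π≢1))

  length≤degreeᵐ : ∀ gs → length gs ℕ.≤ degreeᵐ gs
  length≤degreeᵐ []       = ℕ.z≤n
  length≤degreeᵐ (g ∷ gs) = ℕ.+-mono-≤ (1≤degreeᵍ g) (length≤degreeᵐ gs)

  #blocks-degreeᵐ : ∀ gs → ℕ-sum (map (#blocks ∘ Generator.π) gs) ≡ degreeᵐ gs ℕ.+ length gs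
  #blocks-degreeᵐ []       = refl
  #blocks-degreeᵐ (g ∷ gs) = ≡.trans
    (cong₂ ℕ._+_ (≡.sym (ℕ.m∸n+n≡m (ℕ.≤-trans (1≤degreeᵍ g) (ℕ.m∸n≤m _ 1)))) (#blocks-degreeᵐ gs))
    (ℕ-interchange (degreeᵍ g) 1 (degreeᵐ gs) (length gs))

  IsMonomial : ℕ → Pred 𝒯ᶜ.Carrier 0ℓ
  IsMonomial m x = ∃ λ gs → degreeᵐ gs ≡ m × x ≡ monomial gs

  -- The description of the graded pieces by degree alone, uniform at 0 and without a bound on the
  -- number of factors, so that products of monomials need no side conditions.
  Homogeneous : ℕ → Pred 𝒯ᶜ.Carrier 0ℓ
  Homogeneous m = Span 𝒯ᶜ.rawLeftModule (IsMonomial m)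

  𝒯ₘ⇒homogeneous : ∀ m {x} → 𝒯ₘ K m x → Homogeneous m x
  𝒯ₘ⇒homogeneous zero    = Span-map λ { refl → [] , refl , refl }
  𝒯ₘ⇒homogeneous (suc m) = Span-map λ (gs , _ , _ , eq , x≡) →
    gs , ℕ.+-cancelʳ-≡ (length gs) _ _ (≡.trans (≡.sym (#blocks-degreeᵐ gs)) eq) , x≡

  -- Every generator has degree at least 1. Hence a monomial of degree `m` has at most `m` factors,
  -- and in degree 0 only the empty monomial is left.
  homogeneous⇒𝒯ₘ : ∀ m {x} → Homogeneous m x → 𝒯ₘ K m x
  homogeneous⇒𝒯ₘ zero = Span-map λ where
    ([] , _ , x≡) → x≡
    (g ∷ gs , eq , _) → contradiction (≡.subst (1 ℕ.≤_) eq (ℕ.≤-trans (1≤degreeᵍ g) (ℕ.m≤m+n _ _))) λ ()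
  homogeneous⇒𝒯ₘ (suc m) = Span-map λ where
    ([] , () , _)
    (gs@(_ ∷ _) , eq , x≡) → gs , ℕ.s≤s ℕ.z≤n , ≡.subst (length gs ℕ.≤_) eq (length≤degreeᵐ gs)
      , ≡.trans (#blocks-degreeᵐ gs) (cong (ℕ._+ length gs) eq) , x≡

  monomial-++ : ∀ gs hs → monomial gs 𝒯ᶜ.* monomial hs 𝒯ᶜ.≈ monomial (gs ++ hs)
  monomial-++ []       hs = 𝒯ᶜ.*-identityˡ _
  monomial-++ (g ∷ gs) hs = 𝒯ᶜ.≈trans (𝒯ᶜ.*-assoc _ _ _) (𝒯ᶜ.*-congˡ (monomial-++ gs hs))

  degreeᵐ-++ : ∀ gs hs → degreeᵐ (gs ++ hs) ≡ degreeᵐ gs ℕ.+ degreeᵐ hs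
  degreeᵐ-++ gs hs = ≡.trans (cong ℕ-sum (List.map-++ degreeᵍ gs hs))
                               (ℕ-sum-++ (map degreeᵍ gs) (map degreeᵍ hs))

  homogeneous-* : ∀ {i j x y} → Homogeneous i x → Homogeneous j y → Homogeneous (i ℕ.+ j) (x 𝒯ᶜ.* y)
  homogeneous-* = Span-* {𝒯ᶜ} λ { (gs , refl , refl) (hs , refl , refl) →
    resp (𝒯ᶜ.≈sym (monomial-++ gs hs)) (gen (gs ++ hs , degreeᵐ-++ gs hs , refl)) }

  homogeneous-1 : Homogeneous 0 𝒯ᶜ.1#
  homogeneous-1 = gen ([] , refl , refl)

  homogeneous-X : (π : NC n) → Homogeneous (degree π) (X K π)
  homogeneous-X {n} π with π ≟ 1ₙ n
  ... | no π≢1   = resp (𝒯ᶜ.*-identityʳ _) (gen (generator π π≢1 ∷ [] , ℕ.+-identityʳ _ , refl))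
  ... | yes refl = ≡.subst (λ m → Homogeneous m 𝒯ᶜ.1#) (≡.sym (degree-1ₙ n)) homogeneous-1

  homogeneous-∏ : ∀ {I : Set} (xs : List I) {f : I → 𝒯ᶜ.Carrier} {d : I → ℕ} →
                  (∀ x → Homogeneous (d x) (f x)) → Homogeneous (ℕ-sum (map d xs)) (𝒯ᶜ.∏ xs f)
  homogeneous-∏ []       h = homogeneous-1
  homogeneous-∏ (x ∷ xs) h = homogeneous-* (h x) (homogeneous-∏ xs h)

  -- Compatibility of comultiplication and counit with degrees

  T² : CommutativeAlgebra
  T² = 𝒯ᶜ ⊗ᶜ 𝒯ᶜ

  private
    module T² = CommutativeAlgebra T²

  IsTensor : ℕ → Pred T².Carrier 0ℓ
  IsTensor m t = ∃ λ i → ∃ λ j → ∃ λ x → ∃ λ y → (i ℕ.+ j ≡ m) × 𝒯ₘ K i x × 𝒯ₘ K j y × (t ≡ [ x , y ])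

  tensorDegree-* : ∀ {i j s t} → tensorDegree K (𝒯 K) (𝒯ₘ K) i s → tensorDegree K (𝒯 K) (𝒯ₘ K) j t →
                   tensorDegree K (𝒯 K) (𝒯ₘ K) (i ℕ.+ j) (s T².* t)
  tensorDegree-* {i} {j} = Span-* {T²} {IsTensor i} {IsTensor j} {IsTensor (i ℕ.+ j)}
    λ { (i₁ , j₁ , x , y , refl , hx , hy , refl) (i₂ , j₂ , x′ , y′ , refl , hx′ , hy′ , refl) →
      gen (i₁ ℕ.+ i₂ , j₁ ℕ.+ j₂ , x 𝒯ᶜ.* x′ , y 𝒯ᶜ.* y′ , ℕ-interchange i₁ i₂ j₁ j₂
          , mult hx hx′ , mult hy hy′ , refl) }
    where
    mult : ∀ {i j x y} → 𝒯ₘ K i x → 𝒯ₘ K j y → 𝒯ₘ K (i ℕ.+ j) (x 𝒯ᶜ.* y)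
    mult {i} {j} hx hy =
      homogeneous⇒𝒯ₘ (i ℕ.+ j) (homogeneous-* (𝒯ₘ⇒homogeneous i hx) (𝒯ₘ⇒homogeneous j hy))

  Δ-monomial : ∀ gs → tensorDegree K (𝒯 K) (𝒯ₘ K) (degreeᵐ gs) (Δ K (monomial gs))
  Δ-monomial [] = resp (T².≈sym (IsHom.1-homo Δ-hom))
    (gen (0 , 0 , _ , _ , refl , gen refl , gen refl , refl))
  Δ-monomial (generator π π≢1 ∷ gs) = tensorDegree-* {degree π} (terms (above π) id) (Δ-monomial gs)
    where
    -- A sublist of `above π` is allowed, so that the induction still knows `π ≤ σ` for each term.
    terms : ∀ σs → (∀ {σ} → σ ∈ σs → σ ∈ above π) → tensorDegree K (𝒯 K) (𝒯ₘ K) (degree π)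
            (map (λ σ → 𝒯ᶜ.product (map (λ W → X K (restrict π W)) (blocks σ)) , X K σ) σs)
    terms []       h = zero
    terms (σ ∷ σs) h = add
      (gen (_ , degree σ , _ , _ , degree-sum π σ (∈-above⁻ π (h (here refl)))
          , homogeneous⇒𝒯ₘ _ (homogeneous-∏ (blocks σ) (λ W → homogeneous-X (restrict π W)))
          , homogeneous⇒𝒯ₘ _ (homogeneous-X σ) , refl))
      (terms σs (h ∘ there))

  Δ-degree : ∀ {m x} → 𝒯ₘ K m x → tensorDegree K (𝒯 K) (𝒯ₘ K) m (Δ K x)
  Δ-degree {m} x∈ = Span-hom Δ-hom {IsMonomial m} {IsTensor m} (λ { (gs , refl , refl) → Δ-monomial gs })
    (𝒯ₘ⇒homogeneous m x∈)

  ε-degree : ∀ {m x} → m ≢ 0 → 𝒯ₘ K m x → ε K x K.≈ K.0#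
  ε-degree {m} m≢0 x∈ = go (𝒯ₘ⇒homogeneous m x∈)
    where
    go : ∀ {x} → Homogeneous m x → ε K x K.≈ K.0#
    go (gen ([] , eq , refl))     = contradiction (≡.sym eq) m≢0
    go (gen (g ∷ gs , _ , refl))  = K.zeroˡ _
    go zero       = K.zeroˡ _
    go (add s t)  = K.trans (K.+-cong (go s) (go t)) (K.+-identityˡ _)
    go (scal k s) = K.trans (K.*-congˡ (go s)) (K.zeroʳ _)
    go (resp e s) = K.trans (IsHom.f-cong ε-hom (𝒯ᶜ.≈sym e)) (go s)

  connected : ∀ x → 𝒯ₘ K 0 x ⇔ (∃ λ k → x 𝒯ᶜ.≈ k 𝒯ᶜ.· 𝒯ᶜ.1#)
  connected x = mk⇔ to λ (k , e) → resp (𝒯ᶜ.≈sym e) (scal k (gen refl))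
    where
    open 𝒯ᶜ
    to : ∀ {x} → 𝒯ₘ K 0 x → ∃ λ k → x ≈ k · 1#
    to (gen refl) = K.1# , ≈sym (·-identityˡ _)
    to zero       = K.0# , ≈sym (·-zeroˡ _)
    to (add s t)  = let k , e = to s ; l , e′ = to t
                    in k K.+ l , ≈trans (+-cong e e′) (≈sym (·-distribʳ _ k l))
    to (scal k s) = let l , e = to s in k K.* l , ≈trans (·-cong K.refl e) (≈sym (·-assoc k l _))
    to (resp e s) = let k , e′ = to s in k , ≈trans (≈sym e) e′

  -- Existence of homogeneous decompositions

  module _ where
    open 𝒯ᶜ

    polynomial-span : ∀ x → Span rawLeftModule (λ y → ∃ λ gs → y ≡ monomial gs) x
    polynomial-span (con k)  = resp (*-identityʳ _) (scal k (gen ([] , refl)))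
    polynomial-span (var g)  = resp (*-identityʳ _) (gen (g ∷ [] , refl))
    polynomial-span (p :+ q) = add (polynomial-span p) (polynomial-span q)
    polynomial-span (p :* q) = Span-* {𝒯ᶜ} (λ { (gs , refl) (hs , refl) →
      resp (≈sym (monomial-++ gs hs)) (gen (gs ++ hs , refl)) }) (polynomial-span p) (polynomial-span q)
    polynomial-span (:- p)   = resp (≈trans (·≈*1 _ p) (≈trans (*-congʳ (*-identityʳ _)) -1p≈-p))
                                 (scal (K.- K.1#) (polynomial-span p))
      where
      open Algebra.Properties.Ring ring using (-1*x≈-x)
      -1p≈-p : con (K.- K.1#) * p ≈ - p
      -1p≈-p = ≈trans (*-congʳ (≈trans (≈sym (*-identityʳ _))
        (≈trans (IsHom.neg-homo (scalar-hom 𝒯ᶜ) K.1#) (-‿cong (·-identityˡ 1#))))) (-1*x≈-x p)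

    sumTo : ℕ → (ℕ → Carrier) → Carrier
    sumTo zero    f = 0#
    sumTo (suc N) f = f 0 + sumTo N (f ∘ suc)

    private
      sumTo-0 : ∀ N → sumTo N (λ _ → 0#) ≈ 0#
      sumTo-0 zero    = ≈refl
      sumTo-0 (suc N) = ≈trans (+-identityˡ _) (sumTo-0 N)

      sumTo-+ : ∀ N f g → sumTo N (λ i → f i + g i) ≈ sumTo N f + sumTo N g
      sumTo-+ zero    f g = ≈sym (+-identityˡ 0#)
      sumTo-+ (suc N) f g = ≈trans (+-congˡ (sumTo-+ N (f ∘ suc) (g ∘ suc))) (interchange _ _ _ _)
        where
        open Algebra.Properties.CommutativeSemigroup
          (CommutativeMonoid.commutativeSemigroup +-commutativeMonoid) using (interchange)

      sumTo-· : ∀ N k f → sumTo N (λ i → k · f i) ≈ k · sumTo N f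
      sumTo-· zero    k f = ≈sym (·-zeroʳ k)
      sumTo-· (suc N) k f = ≈trans (+-congˡ (sumTo-· N k (f ∘ suc))) (≈sym (·-distribˡ k _ _))

      single : ℕ → Carrier → ℕ → Carrier
      single zero    x zero    = x
      single zero    x (suc i) = 0#
      single (suc m) x zero    = 0#
      single (suc m) x (suc i) = single m x i

      sumTo-single : ∀ m x N → m ℕ.< N → sumTo N (single m x) ≈ x
      sumTo-single zero    x (suc N) _           = ≈trans (+-congˡ (sumTo-0 N)) (+-identityʳ x)
      sumTo-single (suc m) x (suc N) (ℕ.s≤s m<N) = ≈trans (+-identityˡ _) (sumTo-single m x N m<N)

      single-homogeneous : ∀ {m x} (P : ℕ → Pred Carrier 0ℓ) → (∀ i → P i 0#) → P m x →
                           ∀ i → P i (single m x i)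
      single-homogeneous {zero}  P P0 Px zero    = Px
      single-homogeneous {zero}  P P0 Px (suc i) = P0 (suc i)
      single-homogeneous {suc m} P P0 Px zero    = P0 0
      single-homogeneous {suc m} P P0 Px (suc i) = single-homogeneous {m} (P ∘ suc) (P0 ∘ suc) Px i

    -- All partial sums from some point on are required to be x, so that
    -- decompositions of different lengths can be added.
    Decomposition : Pred Carrier 0ℓ
    Decomposition x = ∃ λ N → ∃ λ f → (∀ m → Homogeneous m (f m)) × (∀ M → N ℕ.≤ M → sumTo M f ≈ x)

    decompose : ∀ x → Decomposition x
    decompose x = go (polynomial-span x)
      where
      go : ∀ {x} → Span rawLeftModule (λ y → ∃ λ gs → y ≡ monomial gs) x → Decomposition x
      go (gen (gs , refl)) = suc (degreeᵐ gs) , single (degreeᵐ gs) (monomial gs)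
        , single-homogeneous Homogeneous (λ _ → zero) (gen (gs , refl , refl))
        , sumTo-single (degreeᵐ gs) (monomial gs)
      go zero = 0 , (λ _ → 0#) , (λ _ → zero) , λ M _ → sumTo-0 M
      go (add s t) = let N , f , hf , ef = go s ; N′ , g , hg , eg = go t
        in N ℕ.⊔ N′ , (λ i → f i + g i) , (λ m → add (hf m) (hg m)) , λ M le →
          ≈trans (sumTo-+ M f g)
            (+-cong (ef M (ℕ.≤-trans (ℕ.m≤m⊔n N N′) le)) (eg M (ℕ.≤-trans (ℕ.m≤n⊔m N N′) le)))
      go (scal k s) = let N , f , hf , ef = go s
        in N , (λ i → k · f i) , (λ m → scal k (hf m))
          , λ M le → ≈trans (sumTo-· M k f) (·-cong K.refl (ef M le))
      go (resp e s) = let N , f , hf , ef = go s in N , f , hf , λ M le → ≈trans (ef M le) e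

    open Algebra.Properties.CommutativeMonoid.Sum +-commutativeMonoid
      using (sum; sum-cong-≋; sum-replicate-zero; ∑-distrib-+)
    open Algebra.Properties.Semiring.Sum (CommutativeRing.semiring commutativeRing) using (*-distribˡ-sum)

    sumTo≈sum : ∀ N f → sumTo N f ≈ sum {N} (f ∘ toℕ)
    sumTo≈sum zero    f = ≈refl
    sumTo≈sum (suc N) f = +-congˡ (sumTo≈sum N (f ∘ suc))

    -- The Euler derivation and independence of the homogeneous components

    natural : ℕ → K.Carrier
    natural zero    = K.0#
    natural (suc n) = K.1# K.+ natural n

    natural-+ : ∀ m n → natural (m ℕ.+ n) K.≈ natural m K.+ natural n
    natural-+ zero    n = K.sym (K.+-identityˡ _)
    natural-+ (suc m) n = K.trans (K.+-congˡ (natural-+ m n)) (K.sym (K.+-assoc _ _ _))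

    -- The Euler derivation, whose eigenspaces are the homogeneous components.
    euler : Carrier → Carrier
    euler (con k)  = 0#
    euler (var g)  = natural (degreeᵍ g) · var g
    euler (p :+ q) = euler p + euler q
    euler (p :* q) = euler p * q + p * euler q
    euler (:- p)   = - euler p

    private
      module S = Algebra.Solver.Ring.NaturalCoefficients.Default commutativeSemiring

      assoc-lemma : ∀ p q r p′ q′ r′ →
        (p′ * q + p * q′) * r + (p * q) * r′ ≈ p′ * (q * r) + p * (q′ * r + q * r′)
      assoc-lemma = solve 6 (λ p q r p′ q′ r′ →
        (p′ :× q :⊕ p :× q′) :× r :⊕ (p :× q) :× r′ := p′ :× (q :× r) :⊕ p :× (q′ :× r :⊕ q :× r′)) ≈refl
        where open S using (solve; _:=_) renaming (_:+_ to _:⊕_; _:*_ to _:×_)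

      comm-lemma : ∀ p q p′ q′ → p′ * q + p * q′ ≈ q′ * p + q * p′
      comm-lemma = solve 4 (λ p q p′ q′ → p′ :× q :⊕ p :× q′ := q′ :× p :⊕ q :× p′) ≈refl
        where open S using (solve; _:=_) renaming (_:+_ to _:⊕_; _:*_ to _:×_)

      distrib-lemma : ∀ p q r p′ q′ r′ →
        p′ * (q + r) + p * (q′ + r′) ≈ (p′ * q + p * q′) + (p′ * r + p * r′)
      distrib-lemma = solve 6 (λ p q r p′ q′ r′ →
        p′ :× (q :⊕ r) :⊕ p :× (q′ :⊕ r′) := (p′ :× q :⊕ p :× q′) :⊕ (p′ :× r :⊕ p :× r′)) ≈refl
        where open S using (solve; _:=_) renaming (_:+_ to _:⊕_; _:*_ to _:×_)

      module P = _≈ₚ_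

    -- The derivation is defined on expressions, so it must respect every generating law of
    -- polynomial equality. Additive laws carry over directly; the multiplicative ones reduce to
    -- semiring identities by the product rule.
    euler-cong : ∀ {x y} → x ≈ y → euler x ≈ euler y
    euler-cong P.≈-refl = ≈refl
    euler-cong (P.≈-sym e) = ≈sym (euler-cong e)
    euler-cong (P.≈-trans e e′) = ≈trans (euler-cong e) (euler-cong e′)
    euler-cong (P.+-cong e e′) = +-cong (euler-cong e) (euler-cong e′)
    euler-cong (P.*-cong e e′) = +-cong (*-cong (euler-cong e) e′) (*-cong e (euler-cong e′))
    euler-cong (P.neg-cong e) = -‿cong (euler-cong e)
    euler-cong (P.+-assoc p q r) = +-assoc _ _ _
    euler-cong (P.+-comm p q) = +-comm _ _
    euler-cong (P.+-identityˡ p) = +-identityˡ _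
    euler-cong (P.+-inverseˡ p) = -‿inverseˡ _
    euler-cong (P.*-assoc p q r) = assoc-lemma p q r (euler p) (euler q) (euler r)
    euler-cong (P.*-comm p q) = comm-lemma p q (euler p) (euler q)
    euler-cong (P.*-identityˡ p) = ≈trans (+-cong (zeroˡ p) (*-identityˡ (euler p))) (+-identityˡ _)
    euler-cong (P.distribˡ p q r) = distrib-lemma p q r (euler p) (euler q) (euler r)
    euler-cong (P.con-cong e) = ≈refl
    euler-cong (P.con-+ k l) = ≈sym (+-identityˡ _)
    euler-cong (P.con-* k l) = ≈sym (≈trans (+-cong (zeroˡ _) (zeroʳ _)) (+-identityˡ _))

    euler-· : ∀ k x → euler (k · x) ≈ k · euler x
    euler-· k x = ≈trans (+-congʳ (zeroˡ x)) (+-identityˡ _)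

    ·-swap : ∀ k l x → k · (l · x) ≈ l · (k · x)
    ·-swap k l x = ≈trans (≈sym (·-assoc k l x)) (≈trans (·-cong (K.*-comm k l) ≈refl) (·-assoc l k x))

    -- By the product rule the eigenvalues of the factors of a monomial add up, as their degrees do;
    -- linearity extends this to the span.
    euler-homogeneous : ∀ {m x} → Homogeneous m x → euler x ≈ natural m · x
    euler-homogeneous (gen (gs , refl , refl)) = onMonomial gs
      where
      onMonomial : ∀ gs → euler (monomial gs) ≈ natural (degreeᵐ gs) · monomial gs
      onMonomial []       = ≈sym (·-zeroˡ 1#)
      onMonomial (g ∷ gs) = ≈trans
        (+-cong (≈sym (·-*-assocˡ _ (var g) (monomial gs)))
          (≈trans (*-congˡ (onMonomial gs)) (≈sym (·-*-assocʳ _ (var g) (monomial gs)))))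
        (≈trans (≈sym (·-distribʳ _ _ _)) (·-cong (K.sym (natural-+ (degreeᵍ g) (degreeᵐ gs))) ≈refl))
    euler-homogeneous zero       = ≈sym (·-zeroʳ _)
    euler-homogeneous (add s t)  =
      ≈trans (+-cong (euler-homogeneous s) (euler-homogeneous t)) (≈sym (·-distribˡ _ _ _))
    euler-homogeneous (scal k s) =
      ≈trans (euler-· k _) (≈trans (·-cong K.refl (euler-homogeneous s)) (·-swap k _ _))
    euler-homogeneous (resp e s) =
      ≈trans (euler-cong (≈sym e)) (≈trans (euler-homogeneous s) (·-cong K.refl e))

    euler-sum : ∀ {N} (f : Fin N → Carrier) → euler (sum f) ≈ sum (euler ∘ f)
    euler-sum {zero}  f = ≈refl
    euler-sum {suc N} f = +-congˡ (euler-sum (f ∘ suc))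

    module _ (natural⁻¹ : ∀ n → ∃ λ k → k K.* natural (suc n) K.≈ K.1#) where

      -- Characteristic zero enters here: differences of distinct eigenvalues have to be invertible.
      natural-cancel : ∀ n {x} → natural (suc n) · x ≈ 0# → x ≈ 0#
      natural-cancel n {x} e = let k , k*n≈1 = natural⁻¹ n in
        ≈trans (≈sym (·-identityˡ x)) (≈trans (·-cong (K.sym k*n≈1) ≈refl)
          (≈trans (·-assoc k _ x) (≈trans (·-cong K.refl e) (·-zeroʳ k))))

      -- Applying euler - a to a vanishing sum of eigenvectors for a, a + 1, …
      -- kills the first one.
      eigenvectors-independent : ∀ N a (f : Fin N → Carrier) →
                                 (∀ m → euler (f m) ≈ natural (a ℕ.+ toℕ m) · f m) →
                                 sum f ≈ 0# → ∀ m → f m ≈ 0#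
      eigenvectors-independent (suc N) a f eigen Σf≈0 = λ { zero → f₀≈0 ; (suc m) → t≈0 m }
        where
        open Relation.Binary.Reasoning.Setoid setoid
        t g : Fin N → Carrier
        t = f ∘ suc
        -- The eigenvalue of `t m` exceeds `a` by `suc (toℕ m)`, so this is `euler - a` applied to
        -- `t m`.
        g m = natural (suc (toℕ m)) · t m
        euler-f : ∀ m → euler (f m) ≈ natural a · f m + natural (toℕ m) · f m
        euler-f m = ≈trans (eigen m) (≈trans (·-cong (natural-+ a (toℕ m)) ≈refl) (·-distribʳ _ _ _))
        Σg≈0 : sum g ≈ 0#
        Σg≈0 = begin
          sum g
            ≈⟨ ≈trans (+-congʳ (·-zeroˡ (f zero))) (+-identityˡ _) ⟨
          sum (λ m → natural (toℕ m) · f m)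
            ≈⟨ +-identityˡ _ ⟨
          -- Nothing is subtracted: the multiple by `a` of the vanishing sum is added instead, which
          -- completes each eigenvalue to `a + toℕ m`.
          0# + sum (λ m → natural (toℕ m) · f m)
            ≈⟨ +-congʳ (≈trans (·-cong K.refl Σf≈0) (·-zeroʳ _)) ⟨
          natural a · sum f + sum (λ m → natural (toℕ m) · f m)
            ≈⟨ +-congʳ (*-distribˡ-sum (con (natural a)) f) ⟩
          sum (λ m → natural a · f m) + sum (λ m → natural (toℕ m) · f m)
            ≈⟨ ∑-distrib-+ (λ m → natural a · f m) (λ m → natural (toℕ m) · f m) ⟨
          sum (λ m → natural a · f m + natural (toℕ m) · f m)
            ≈⟨ sum-cong-≋ euler-f ⟨
          sum (euler ∘ f)
            ≈⟨ euler-sum f ⟨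
          euler (sum f)
            ≈⟨ euler-cong Σf≈0 ⟩
          0# ∎
        eigen-g : ∀ m → euler (g m) ≈ natural (suc a ℕ.+ toℕ m) · g m
        eigen-g m = ≈trans (euler-· _ (t m)) (≈trans
          (·-cong K.refl (≈trans (eigen (suc m))
            (·-cong (K.reflexive (cong natural (ℕ.+-suc a (toℕ m)))) ≈refl)))
          (·-swap _ _ (t m)))
        t≈0 : ∀ m → t m ≈ 0#
        t≈0 m = natural-cancel (toℕ m) (eigenvectors-independent N (suc a) g eigen-g Σg≈0 m)
        f₀≈0 : f zero ≈ 0#
        f₀≈0 = begin
          f zero           ≈⟨ +-identityʳ _ ⟨
          f zero + 0#      ≈⟨ +-congˡ (≈trans (sum-cong-≋ t≈0) (sum-replicate-zero N)) ⟨
          sum f            ≈⟨ Σf≈0 ⟩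
          0# ∎

      isGrading : IsGrading K (𝒯 K) (𝒯ₘ K)
      isGrading = record
        { isSubmodule   = λ { zero → Span-isSubmodule ; (suc m) → Span-isSubmodule }
        ; decomposition = λ x → let N , f , hf , ef = decompose x in
            N , f ∘ toℕ , (λ m → homogeneous⇒𝒯ₘ (toℕ m) (hf (toℕ m)))
            , ≈trans (≈sym (ef N ℕ.≤-refl)) (sumTo≈sum N f)
        ; independent   = λ N f hf → eigenvectors-independent N 0 f
            λ m → euler-homogeneous (𝒯ₘ⇒homogeneous (toℕ m) (hf m))
        ; 1-degree      = gen refl
        ; *-degree      = λ {i} {j} hx hy →
            homogeneous⇒𝒯ₘ (i ℕ.+ j) (homogeneous-* (𝒯ₘ⇒homogeneous i hx) (𝒯ₘ⇒homogeneous j hy)) }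

-- Rational numbers in ℂ

private
  module ℂ = CommutativeRing ℂ
  open Real using (real; _~_; 0ᵣ)

constant-~ : ∀ {p q : ℚ} → p ≡ q → (λ _ → p) ~ (λ _ → q)
constant-~ {p} refl ε = 0 , λ _ _ _ _ → subst (λ t → ℚ.∣ t ∣ ℚ.< ε) (sym (ℚ.+-inverseʳ p)) (ℚ.positive⁻¹ ε)

rational : ℚ → ℂ.Carrier
rational q = real (λ _ → q) (constant-~ {q} refl) , 0ᵣ

naturalℚ : ℕ → ℚ
naturalℚ zero    = 0ℚ
naturalℚ (suc n) = 1ℚ ℚ.+ naturalℚ n

naturalℚ-nonNeg : ∀ n → NonNegative (naturalℚ n)
naturalℚ-nonNeg zero    = _
naturalℚ-nonNeg (suc n) = ℚ.nonNeg+nonNeg⇒nonNeg 1ℚ (naturalℚ n) {{naturalℚ-nonNeg n}}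

naturalℚ-pos : ∀ n → Positive (naturalℚ (suc n))
naturalℚ-pos n = ℚ.pos+nonNeg⇒pos 1ℚ (naturalℚ n) {{naturalℚ-nonNeg n}}

natural≈naturalℚ : ∀ n → natural ℂ n ℂ.≈ rational (naturalℚ n)
natural≈naturalℚ zero    = ℂ.refl {ℂ.0#}
natural≈naturalℚ (suc n) = 
  ℂ.trans {natural ℂ (suc n)} {ℂ.1# ℂ.+ rational (naturalℚ n)} {rational (naturalℚ (suc n))}
  (ℂ.+-congˡ {ℂ.1#} {natural ℂ n} {rational (naturalℚ n)} (natural≈naturalℚ n))
  (constant-~ {naturalℚ (suc n)} refl , constant-~ {0ℚ} refl)

-- A positive integer in ℂ is given by a constant rational sequence with zero imaginary part. Its
-- inverse is then the constant sequence of the rational inverse, and no Cauchy sequence has to be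
-- inverted.
naturalℂ⁻¹ : ∀ n → ∃ λ k → k ℂ.* natural ℂ (suc n) ℂ.≈ ℂ.1#
naturalℂ⁻¹ n = rational (ℚ.1/ q) ,
  ℂ.trans {rational (ℚ.1/ q) ℂ.* natural ℂ (suc n)} {rational (ℚ.1/ q) ℂ.* rational q} {ℂ.1#}
  (ℂ.*-congˡ {rational (ℚ.1/ q)} {natural ℂ (suc n)} {rational q} (natural≈naturalℚ (suc n)))
  ( constant-~ (trans (ℚ.+-identityʳ _) (ℚ.*-inverseˡ q))
  , constant-~ (cong₂ ℚ._+_ (ℚ.*-zeroʳ (ℚ.1/ q)) (ℚ.*-zeroˡ q)))
  where
  q = naturalℚ (suc n)
  instance
    q≢0 : ℚ.NonZero q
    q≢0 = ℚ.pos⇒nonZero q {{naturalℚ-pos n}}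

theorem12p6 : IsGradedConnectedHopfAlgebra ℂ (𝒯 ℂ) (Δ ℂ) (ε ℂ) (𝒯ₘ ℂ)
theorem12p6 = record
  { isBialgebra = isBialgebra ℂ
  ; isGrading   = isGrading ℂ naturalℂ⁻¹
  ; Δ-degree    = λ {m} {x} → Δ-degree ℂ {m} {x}
  ; ε-degree    = λ {m} {x} → ε-degree ℂ {m} {x}
  ; connected   = connected ℂ
  ; antipode    = antipode ℂ }
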